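{- Let $n\ge3$, let $\Delta$ be a maximal simplex of $\Gamma_{2,n}$ with vertex set $\{\epsilon_I: I\in E\}$, let $G$ be the graph on $[n]$ with edge set $E$, and let $C$ be the unique cycle of $G$. If $G$ is a triangle (so $n=3$), then $\Delta=\Delta_{2,3}$ is the unique maximal simplex of $\Gamma_{2,3}$ and has degree $0$. If $G$ is not a triangle, $|C|=3$ and $G$ has two vertices of degree two, then $\Delta$ has degree $2$. In all other cases, $\Delta$ has degree $|C|$.
   Context: For $I\subseteq[n]$, $\epsilon_I\in\mathbb{R}^n$ is its 0/1 indicator vector; $\Delta_{2,n}=\mathrm{conv}\{\epsilon_I:|I|=2\}$. For 2-subsets $I,J$ let $(a_1,a_2,a_3,a_4)$ be the nondecreasing ordering of the multiset union, $U(I,J)=\{a_1,a_3\}$, $V(I,J)=\{a_2,a_4\}$; $(I,J)$ is sorted if $I=U(I,J)$, $J=V(I,J)$, and an ordered collection is sorted if each pair $(I_i,I_j)$, $i<j$, is sorted. $\Gamma_{2,n}$ is the triangulation of $\Delta_{2,n}$ whose maximal simplices are $\mathrm{conv}\{\epsilon_{I_1},\dots,\epsilon_{I_n}\}$ for maximal sorted collections $(I_1,\dots,I_n)$. Identify 2-subsets with edges of a graph on $[n]$ whose vertices are drawn on a circle, labelled clockwise in increasing order, with edges drawn as chords; a thrackle is such a graph in which every two edges intersect (sharing an endpoint counts). The graphs $G$ arising from maximal simplices are exactly the thrackles with $n$ edges; each such $G$ contains a unique cycle $C$, which has odd length and pairwise crossing edges, and every other edge of $G$ joins a vertex not on $C$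 to the unique vertex of $C$ opposite to it (so that the edge crosses all edges of $C$). The degree of a maximal simplex $\Delta$ is the number of other maximal simplices of $\Gamma_{2,n}$ sharing a facet with $\Delta$. -}

module Defs where

open import Data.Nat using (ℕ; zero; suc; _≤_)
open import Data.Bool using (Bool; true; false; if_then_else_)
open import Data.Fin using (Fin) renaming (_<_ to _<ᶠ_; _≤?_ to _≤ᶠ?_)
open import Data.Vec using (Vec; []; _∷_; lookup)
open import Data.List using (List; length; _++_; take)
open import Data.List.Relation.Unary.Any using (Any)
open import Data.List.Relation.Unary.AllPairs using (AllPairs)
open import Data.List.Relation.Unary.Linked using (Linked)
open import Data.List.Relation.Unary.Unique.Propositional using (Unique)
open import Data.List.Membership.Propositional using (_∈_)
open import Data.Product using (Σ; ∃; _×_; _,_)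
open import Data.Sum using (_⊎_)
open import Relation.Nullary using (¬_; does)
open import Relation.Binary.PropositionalEquality using (_≡_; _≢_)
open import Function.Bundles using (_⇔_)

record Edge (n : ℕ) : Set where
  constructor edge
  field
    lo hi : Fin n
    lo<hi : lo <ᶠ hi
open Edge public

SameEdge : ∀ {n} → Edge n → Edge n → Set
SameEdge I J = lo I ≡ lo J × hi I ≡ hi J

insert : ∀ {n m} → Fin n → Vec (Fin n) m → Vec (Fin n) (suc m)
insert x [] = x ∷ []
insert x (y ∷ ys) = if does (x ≤ᶠ? y) then x ∷ y ∷ ys else y ∷ insert x ys

-- nondecreasing ordering (a₁,a₂,a₃,a₄) of the multiset union I ∪ J
sort4 : ∀ {n} → Edge n → Edge n → Vec (Fin n) 4
sort4 I J = insert (lo I) (insert (hi I) (insert (lo J) (hi J ∷ [])))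

a₁ a₂ a₃ a₄ : ∀ {n} → Edge n → Edge n → Fin n
a₁ I J = lookup (sort4 I J) (Fin.zero)
  where import Data.Fin as Fin
a₂ I J = lookup (sort4 I J) (Fin.suc Fin.zero)
  where import Data.Fin as Fin
a₃ I J = lookup (sort4 I J) (Fin.suc (Fin.suc Fin.zero))
  where import Data.Fin as Fin
a₄ I J = lookup (sort4 I J) (Fin.suc (Fin.suc (Fin.suc Fin.zero)))
  where import Data.Fin as Fin

-- (I,J) is sorted: I = U(I,J) = {a₁,a₃} and J = V(I,J) = {a₂,a₄}.
-- (Since lo < hi, equality of 2-sets {lo,hi} = {x,y} with x ≤ y is lo ≡ x × hi ≡ y.)
SortedPair : ∀ {n} → Edge n → Edge n → Set
SortedPair I J = (lo I ≡ a₁ I J × hi I ≡ a₃ I J) × (lo J ≡ a₂ I J × hi J ≡ a₄ I J)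

-- A set of 2-subsets of [n] (equivalently, a set of vertices ε_I of Δ_{2,n}),
-- encoded canonically as an n×n Boolean table; entry (i,j) true means {i,j} ∈ set (i<j).
VSet : ℕ → Set
VSet n = Vec (Vec Bool n) n

entry : ∀ {n} → VSet n → Fin n → Fin n → Bool
entry s i j = lookup (lookup s i) j

WF : ∀ {n} → VSet n → Set
WF {n} s = (i j : Fin n) → entry s i j ≡ true → i <ᶠ j

Mem : ∀ {n} → Edge n → VSet n → Set
Mem I s = entry s (lo I) (hi I) ≡ true

_⊆V_ : ∀ {n} → VSet n → VSet n → Set
s ⊆V t = ∀ I → Mem I s → Mem I t

SortedColl : ∀ {n} → VSet n → Set
SortedColl {n} s = WF s × Σ (List (Edge n)) λ L →
  AllPairs SortedPair L × (∀ I → Mem I s ⇔ Any (SameEdge I) L)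

-- vertex set of a maximal simplex of Γ_{2,n}: a maximal sorted collection
MaxSimplex : ∀ {n} → VSet n → Set
MaxSimplex s = SortedColl s × (∀ t → SortedColl t → s ⊆V t → t ⊆V s)

ShareFacet : ∀ {n} → VSet n → VSet n → Set
ShareFacet {n} Δ Δ' = Δ ≢ Δ' × Σ (Edge n) λ I → Σ (Edge n) λ J →
  Mem I Δ × Mem J Δ' ×
  (∀ K → (Mem K Δ × ¬ SameEdge K I) ⇔ (Mem K Δ' × ¬ SameEdge K J))

HasDegree : ∀ {n} → VSet n → ℕ → Set
HasDegree {n} Δ d = Σ (List (VSet n)) λ Ds →
  Unique Ds × (∀ Δ' → (MaxSimplex Δ' × ShareFacet Δ Δ') ⇔ Δ' ∈ Ds) × length Ds ≡ d

Adj : ∀ {n} → VSet n → Fin n → Fin n → Set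
Adj s u v = entry s u v ≡ true ⊎ entry s v u ≡ true

-- a cycle of G: distinct vertices v₀,…,v_{k-1}, k ≥ 3, consecutive ones adjacent, v_{k-1} ~ v₀
IsCycle : ∀ {n} → VSet n → List (Fin n) → Set
IsCycle s cyc = 3 ≤ length cyc × Unique cyc × Linked (Adj s) (cyc ++ take 1 cyc)

DegTwo : ∀ {n} → VSet n → Fin n → Set
DegTwo {n} s v = Σ (Fin n) λ u → Σ (Fin n) λ w → u ≢ w × Adj s v u × Adj s v w ×
  (∀ x → Adj s v x → x ≡ u ⊎ x ≡ w)

TwoDegTwo : ∀ {n} → VSet n → Set
TwoDegTwo {n} s = Σ (Fin n) λ v → Σ (Fin n) λ w → v ≢ w × DegTwo s v × DegTwo s w

IsTriangle : ∀ {n} → VSet n → List (Fin n) → Set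
IsTriangle {n} s cyc = length cyc ≡ 3 × (∀ (v : Fin n) → v ∈ cyc)

{-# OPTIONS --safe #-}
-- Number the vertices 0, …, N. The vertex set of a maximal simplex Δ is a maximal family of
-- pairwise crossing chords, and some vertex p lies weakly inside every chord. Listed
-- lexicographically, the N + 1 chords form a lattice path from {0, p} to {p, N}, each step
-- raising one endpoint by one. A neighbour of Δ exchanges one chord for the unique non-chord
-- crossing all the others; this is possible only where the path bends, and there it fails only
-- when the new chord would degenerate to a loop. A vertex with two neighbours is an endpoint of
-- a bend, consecutive bends share an endpoint, and no vertex lies on three bends; hence the
-- chords at bends are exactly the edges of the cycle C. A degenerate bend forces C to be a
-- triangle whose bend edge joins two vertices of degree two, and for n = 3 the triangle is all
-- of Δ₂,₃.
module Submission where

open import Defs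
open import Data.Bool as Bool using (Bool; true; false; if_then_else_; _∧_; _∨_; not)
import Data.Bool.Properties as Boolₚ
open import Data.Empty using (⊥; ⊥-elim)
open import Data.Fin as Fin using (Fin; toℕ; fromℕ<)
import Data.Fin.Properties as Finₚ
open Finₚ using (toℕ<n; fromℕ<-toℕ; toℕ-fromℕ<; toℕ-injective)
open import Data.List as List using (List; []; _∷_; _++_; length; map; filter; take)
import Data.List.Properties as Listₚ
open import Data.List.Membership.Propositional using (_∈_)
import Data.List.Membership.Propositional.Properties as ∈ₚ
import Data.List.Membership.DecPropositional
open import Data.List.Relation.Unary.All as All using (All; []; _∷_)
open import Data.List.Relation.Unary.All.Properties using (All¬⇒¬Any)
open import Data.List.Relation.Unary.AllPairs using (AllPairs; []; _∷_)
import Data.List.Relation.Unary.AllPairs.Properties as AllPairsₚ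
open import Data.List.Relation.Unary.Any as Any using (Any; here; there)
import Data.List.Relation.Unary.Any.Properties as Anyₚ
open import Data.List.Relation.Unary.Linked using (Linked; []; [-]; _∷_)
open import Data.List.Relation.Unary.Unique.Propositional using (Unique)
open import Data.Nat as ℕ using (ℕ; zero; suc; pred; _+_; _∸_; _≤_; _<_; z≤n; s≤s)
import Data.Nat.Properties as ℕₚ
open import Data.Product as Product using (Σ; ∃; _×_; _,_; proj₁; proj₂)
open import Data.Sum as Sum using (_⊎_; inj₁; inj₂)
open import Data.Vec as Vec using (Vec; []; _∷_)
open import Data.Vec.Properties using (lookup∘tabulate; tabulate∘lookup; tabulate-cong)
open import Function.Bundles using (_⇔_; mk⇔; Equivalence)
open import Relation.Binary.Definitions using (tri<; tri≈; tri>)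
open import Relation.Binary.PropositionalEquality
open import Relation.Nullary using (¬_; Dec; yes; no; does; contradiction)
import Relation.Nullary.Decidable as Decidable
open Decidable using (_×-dec_; _⊎-dec_)
open import Relation.Unary using (Decidable)

module _ {A : Set} where

  adjacentPairs : List A → List (A × A)
  adjacentPairs [] = []
  adjacentPairs (a ∷ []) = []
  adjacentPairs (a ∷ b ∷ t) = (a , b) ∷ adjacentPairs (b ∷ t)

  SameUnordered : A × A → A × A → Set
  SameUnordered (a , b) (c , d) = (a ≡ c × b ≡ d) ⊎ (a ≡ d × b ≡ c)

  DistinctUnordered : A × A → A × A → Set
  DistinctUnordered e e' = ¬ SameUnordered e e'

  adjacentPairs-length : ∀ (a : A) (w : List A) → length (adjacentPairs (a ∷ w)) ≡ length w
  adjacentPairs-length a [] = refl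
  adjacentPairs-length a (b ∷ w) = cong suc (adjacentPairs-length b w)

  linked-adjacentPairs : ∀ {R : A → A → Set} {xs : List A} {u v : A} → Linked R xs → (u , v) ∈ adjacentPairs xs → R u v
  linked-adjacentPairs (r ∷ l) (here refl) = r
  linked-adjacentPairs (r ∷ l) (there m) = linked-adjacentPairs l m

  adjacentPairs-∈ : ∀ {xs : List A} {u v : A} → (u , v) ∈ adjacentPairs xs → u ∈ xs × v ∈ xs
  adjacentPairs-∈ {a ∷ b ∷ t} (here refl) = here refl , there (here refl)
  adjacentPairs-∈ {a ∷ b ∷ t} (there m) = let (m1 , m2) = adjacentPairs-∈ {b ∷ t} m in there m1 , there m2

  ∃-successor : ∀ {x : A} (xs : List A) (z : A) → x ∈ xs → ∃ λ y → (x , y) ∈ adjacentPairs (xs ++ z ∷ [])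
  ∃-successor (a ∷ []) z (here refl) = z , here refl
  ∃-successor (a ∷ b ∷ t) z (here refl) = b , here refl
  ∃-successor (a ∷ []) z (there ())
  ∃-successor (a ∷ b ∷ t) z (there m) = let (y , p) = ∃-successor (b ∷ t) z m in y , there p

  ∃-predecessor : ∀ {x : A} (a : A) (w : List A) → x ∈ w → ∃ λ y → (y , x) ∈ adjacentPairs (a ∷ w)
  ∃-predecessor a (b ∷ w) (here refl) = a , here refl
  ∃-predecessor a (b ∷ w) (there m) = let (y , p) = ∃-predecessor b w m in y , there p

  adjacentPairs-snoc-∈₁ : ∀ {c d : A} (R : List A) (x : A) → (c , d) ∈ adjacentPairs (R ++ x ∷ []) → c ∈ R
  adjacentPairs-snoc-∈₁ (a ∷ []) x (here refl) = here refl
  adjacentPairs-snoc-∈₁ (a ∷ b ∷ R) x (here refl) = here refl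
  adjacentPairs-snoc-∈₁ (a ∷ b ∷ R) x (there m) = there (adjacentPairs-snoc-∈₁ (b ∷ R) x m)

  adjacentPairs-distinct : ∀ (Z : List A) → Unique Z → AllPairs DistinctUnordered (adjacentPairs Z)
  adjacentPairs-distinct [] _ = []
  adjacentPairs-distinct (a ∷ []) _ = []
  adjacentPairs-distinct (a ∷ b ∷ t) (na ∷ u) = All.tabulate h ∷ adjacentPairs-distinct (b ∷ t) u
    where
    h : ∀ {e} → e ∈ adjacentPairs (b ∷ t) → DistinctUnordered (a , b) e
    h {c , d} m (inj₁ (refl , _)) = All¬⇒¬Any na (proj₁ (adjacentPairs-∈ {b ∷ t} m))
    h {c , d} m (inj₂ (refl , _)) = All¬⇒¬Any na (proj₂ (adjacentPairs-∈ {b ∷ t} m))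

  unique-snoc : ∀ (R : List A) (x : A) → Unique R → All (λ y → x ≢ y) R → Unique (R ++ x ∷ [])
  unique-snoc [] x _ _ = [] ∷ []
  unique-snoc (a ∷ R) x (na ∷ u) (nx ∷ nxs) = app na (λ e → nx (sym e)) ∷ unique-snoc R x u nxs
    where
    app : ∀ {ys : List A} → All (λ y → a ≢ y) ys → a ≢ x → All (λ y → a ≢ y) (ys ++ x ∷ [])
    app [] ne = ne ∷ []
    app (p ∷ ps) ne = p ∷ app ps ne

  closedWalk-pairs-distinct : ∀ (v0 : A) (R : List A) → Unique (v0 ∷ R) → 2 ≤ length R → AllPairs DistinctUnordered (adjacentPairs (v0 ∷ (R ++ v0 ∷ [])))
  closedWalk-pairs-distinct v0 (z1 ∷ R') (nv ∷ u) len = All.tabulate h ∷ adjacentPairs-distinct (z1 ∷ (R' ++ v0 ∷ [])) (unique-snoc (z1 ∷ R') v0 u nv)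
    where
    h : ∀ {e} → e ∈ adjacentPairs (z1 ∷ (R' ++ v0 ∷ [])) → DistinctUnordered (v0 , z1) e
    h {c , d} m (inj₁ (refl , _)) = All¬⇒¬Any nv (adjacentPairs-snoc-∈₁ (z1 ∷ R') v0 m)
    h {c , d} m (inj₂ (refl , refl)) = g R' len u nv m
      where
      g : ∀ (R' : List A) → 2 ≤ suc (length R') → Unique (c ∷ R') → All (λ y → v0 ≢ y) (c ∷ R') → ¬ ((c , v0) ∈ adjacentPairs (c ∷ (R' ++ v0 ∷ [])))
      g [] (s≤s ()) _ _ _
      g (b ∷ R'') _ _ (_ ∷ (nb ∷ _)) (here refl) = nb refl
      g (b ∷ R'') _ (nc ∷ _) _ (there m') = All¬⇒¬Any nc (adjacentPairs-snoc-∈₁ (b ∷ R'') v0 m')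

  allPairs-∈ : ∀ {R : A → A → Set} {xs : List A} {a b : A} → AllPairs R xs → a ∈ xs → b ∈ xs → a ≡ b ⊎ (R a b ⊎ R b a)
  allPairs-∈ (r ∷ rs) (here refl) (here refl) = inj₁ refl
  allPairs-∈ (r ∷ rs) (here refl) (there mb) = inj₂ (inj₁ (All.lookup r mb))
  allPairs-∈ (r ∷ rs) (there ma) (here refl) = inj₂ (inj₂ (All.lookup r ma))
  allPairs-∈ (r ∷ rs) (there ma) (there mb) = allPairs-∈ rs ma mb

  allPairs-mono-∈ : ∀ {P Q : A → A → Set} {xs : List A} → AllPairs P xs → (∀ {a b} → a ∈ xs → b ∈ xs → P a b → Q a b) → AllPairs Q xs
  allPairs-mono-∈ [] f = []
  allPairs-mono-∈ (p ∷ ps) f = All.tabulate (λ {b} mb → f (here refl) (there mb) (All.lookup p mb)) ∷ allPairs-mono-∈ ps (λ ma mb → f (there ma) (there mb))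

  map-unique : ∀ {B : Set} (f : A → B) {xs : List A} → AllPairs (λ a b → f a ≢ f b) xs → Unique (map f xs)
  map-unique f [] = []
  map-unique f (p ∷ ps) = allMap p ∷ map-unique f ps
    where
    allMap : ∀ {a : A} {ys : List A} → All (λ b → f a ≢ f b) ys → All (λ y → f a ≢ y) (map f ys)
    allMap [] = []
    allMap (q ∷ qs) = q ∷ allMap qs

module _ {A : Set} where
  unique-lookup-injective : ∀ (xs : List A) → Unique xs → ∀ {i j : Fin (length xs)} → i Fin.< j → List.lookup xs i ≢ List.lookup xs j
  unique-lookup-injective (a ∷ t) (na ∷ u) {Fin.zero} {Fin.suc j} _ e = All.lookup na (∈ₚ.∈-lookup {xs = t} j) e
  unique-lookup-injective (a ∷ t) (na ∷ u) {Fin.suc i} {Fin.suc j} (s≤s lt) e = unique-lookup-injective t u lt e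

  unique-length≤ : ∀ {m} (xs : List A) → Unique xs → (cls : ∀ {a} → a ∈ xs → Fin m) →
    (∀ {a b} (ma : a ∈ xs) (mb : b ∈ xs) → cls ma ≡ cls mb → a ≡ b) → length xs ≤ m
  unique-length≤ {m} xs u cls inj with length xs ℕₚ.≤? m
  ... | yes le = le
  ... | no nle with Finₚ.pigeonhole (ℕₚ.≰⇒> nle) (λ i → cls (∈ₚ.∈-lookup {xs = xs} i))
  ...   | i , j , i<j , eq = ⊥-elim (unique-lookup-injective xs u i<j (inj (∈ₚ.∈-lookup {xs = xs} i) (∈ₚ.∈-lookup {xs = xs} j) eq))

module _ {A : Set} {P : A → Set} (P? : Decidable P) where
  filter-length-3₁ : ∀ a b c → ¬ P a → P b → P c → length (filter P? (a ∷ b ∷ c ∷ [])) ≡ 2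
  filter-length-3₁ a b c na pb pc rewrite Listₚ.filter-reject P? {xs = b ∷ c ∷ []} na | Listₚ.filter-accept P? {xs = c ∷ []} pb | Listₚ.filter-accept P? {xs = []} pc = refl
  filter-length-3₂ : ∀ a b c → P a → ¬ P b → P c → length (filter P? (a ∷ b ∷ c ∷ [])) ≡ 2
  filter-length-3₂ a b c pa nb pc rewrite Listₚ.filter-accept P? {xs = b ∷ c ∷ []} pa | Listₚ.filter-reject P? {xs = c ∷ []} nb | Listₚ.filter-accept P? {xs = []} pc = refl
  filter-length-3₃ : ∀ a b c → P a → P b → ¬ P c → length (filter P? (a ∷ b ∷ c ∷ [])) ≡ 2
  filter-length-3₃ a b c pa pb nc rewrite Listₚ.filter-accept P? {xs = b ∷ c ∷ []} pa | Listₚ.filter-accept P? {xs = c ∷ []} pb | Listₚ.filter-reject P? {xs = []} nc = refl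

module _ {P : ℕ → Set} (P? : Decidable P) where

  <suc∧≢⇒< : ∀ {y k} → y < suc k → y ≢ k → y < k
  <suc∧≢⇒< y<sk y≢k = ℕₚ.≤∧≢⇒< (ℕₚ.≤-pred y<sk) y≢k

  greatestBelow : ∀ k → (Σ ℕ λ m → m < k × P m × (∀ y → y < k → P y → y ≤ m)) ⊎ (∀ y → y < k → ¬ P y)
  greatestBelow zero = inj₂ (λ y ())
  greatestBelow (suc k) with P? k
  ... | yes pk = inj₁ (k , ℕₚ.≤-refl , pk , λ y y<sk _ → ℕₚ.≤-pred y<sk)
  ... | no ¬pk with greatestBelow k
  ...   | inj₁ (m , m<k , pm , below-m) = inj₁ (m , ℕₚ.m≤n⇒m≤1+n m<k , pm , below-suc)
    where
    below-suc : ∀ y → y < suc k → P y → y ≤ m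
    below-suc y y<sk py with y ℕₚ.≟ k
    ... | yes refl = contradiction py ¬pk
    ... | no y≢k = below-m y (<suc∧≢⇒< y<sk y≢k) py
  ...   | inj₂ none = inj₂ none-suc
    where
    none-suc : ∀ y → y < suc k → ¬ P y
    none-suc y y<sk py with y ℕₚ.≟ k
    ... | yes refl = ¬pk py
    ... | no y≢k = none y (<suc∧≢⇒< y<sk y≢k) py

  leastBelow : ∀ k → (Σ ℕ λ m → m < k × P m × (∀ y → P y → m ≤ y)) ⊎ (∀ y → y < k → ¬ P y)
  leastBelow zero = inj₂ (λ y ())
  leastBelow (suc k) with leastBelow k
  ... | inj₁ (m , m<k , pm , above-m) = inj₁ (m , ℕₚ.m≤n⇒m≤1+n m<k , pm , above-m)
  ... | inj₂ none with P? k
  ...   | yes pk = inj₁ (k , ℕₚ.≤-refl , pk , above-k)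
    where
    above-k : ∀ y → P y → k ≤ y
    above-k y py with ℕₚ.<-cmp y k
    ... | tri< lt _ _ = contradiction py (none y lt)
    ... | tri≈ _ refl _ = ℕₚ.≤-refl
    ... | tri> _ _ gt = ℕₚ.<⇒≤ gt
  ...   | no ¬pk = inj₂ none-suc
    where
    none-suc : ∀ y → y < suc k → ¬ P y
    none-suc y y<sk py with y ℕₚ.≟ k
    ... | yes refl = ¬pk py
    ... | no y≢k = none y (<suc∧≢⇒< y<sk y≢k) py

+-squeeze : ∀ {a b c d} → a ≤ c → b ≤ d → a + b ≡ c + d → a ≡ c × b ≡ d
+-squeeze {a} {b} {c} {d} ac bd e with ℕₚ.m≤n⇒m<n∨m≡n ac
... | inj₁ lt = contradiction e (ℕₚ.<⇒≢ (ℕₚ.+-mono-<-≤ lt bd))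
... | inj₂ refl = refl , ℕₚ.+-cancelˡ-≡ a b d e

n≢1+n : ∀ {k} → k ≢ suc k
n≢1+n e = ℕₚ.1+n≢n (sym e)

pred< : ∀ {k} → 1 ≤ k → pred k < k
pred< {suc k} _ = ℕₚ.≤-refl

one-step-above : ∀ {a b x y} → a ≤ x → b ≤ y → x + y ≡ suc (a + b) → (x ≡ suc a × y ≡ b) ⊎ (x ≡ a × y ≡ suc b)
one-step-above {a} {b} {x} {y} ax bx e with ℕₚ.m≤n⇒m<n∨m≡n ax
... | inj₁ a<x = let (e1 , e2) = +-squeeze a<x bx (sym e) in inj₁ (sym e1 , sym e2)
... | inj₂ refl = inj₂ (refl , ℕₚ.+-cancelˡ-≡ a y (suc b) (trans e (sym (ℕₚ.+-suc a b))))

≤≤suc⇒≡⊎≡suc : ∀ {u a} → a ≤ u → u ≤ suc a → u ≡ a ⊎ u ≡ suc a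
≤≤suc⇒≡⊎≡suc {u} {a} au ua with ℕₚ.m≤n⇒m<n∨m≡n au
... | inj₂ e = inj₁ (sym e)
... | inj₁ lt = inj₂ (ℕₚ.≤-antisym ua lt)

trichotomy-suc : ∀ t q → t ≤ q ⊎ t ≡ suc q ⊎ suc (suc q) ≤ t
trichotomy-suc t q with ℕₚ.<-cmp t (suc q)
... | tri< lt _ _ = inj₁ (ℕₚ.≤-pred lt)
... | tri≈ _ e _ = inj₂ (inj₁ e)
... | tri> _ _ gt = inj₂ (inj₂ gt)

false≢true : false ≡ true → ⊥
false≢true ()

∨-true : ∀ {u v} → (u ∨ v) ≡ true → u ≡ true ⊎ v ≡ true
∨-true {true} _ = inj₁ refl
∨-true {false} e = inj₂ e

∧-true : ∀ {u v} → (u ∧ v) ≡ true → u ≡ true × v ≡ true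
∧-true {true} {true} _ = refl , refl

≡ᵇ-true : ∀ {a b} → (a ℕ.≡ᵇ b) ≡ true → a ≡ b
≡ᵇ-true {a} {b} e = ℕₚ.≡ᵇ⇒≡ a b (subst Bool.T (sym e) _)

≡ᵇ-refl : ∀ a → (a ℕ.≡ᵇ a) ≡ true
≡ᵇ-refl zero = refl
≡ᵇ-refl (suc a) = ≡ᵇ-refl a

∨-introʳ : ∀ u {v} → v ≡ true → (u ∨ v) ≡ true
∨-introʳ true _ = refl
∨-introʳ false e = e

≢⇒≡ᵇ-false : ∀ {a b} → a ≢ b → (a ℕ.≡ᵇ b) ≡ false
≢⇒≡ᵇ-false {a} {b} ne with a ℕ.≡ᵇ b in e
... | true = ⊥-elim (ne (≡ᵇ-true e))
... | false = refl

data Ascending {n : ℕ} : ∀ {m} → Vec (Fin n) m → Set where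
  asc-[-] : ∀ {x} → Ascending (x ∷ [])
  asc-∷ : ∀ {m x y} {ys : Vec (Fin n) m} → toℕ x ≤ toℕ y → Ascending (y ∷ ys) → Ascending (x ∷ y ∷ ys)

≤ᵇ≡true⇒≤ : ∀ {m n} → (m ℕ.≤ᵇ n) ≡ true → m ≤ n
≤ᵇ≡true⇒≤ {m} {n} eq = ℕₚ.≤ᵇ⇒≤ m n (subst Bool.T (sym eq) _)

≤ᵇ≡false⇒≰ : ∀ {m n} → (m ℕ.≤ᵇ n) ≡ false → ¬ (m ≤ n)
≤ᵇ≡false⇒≰ {m} {n} eq le with ℕₚ.≤⇒≤ᵇ le
... | t rewrite eq = t

insert-ascending-∷ : ∀ {n m} (y x : Fin n) (ys : Vec (Fin n) m) → toℕ y ≤ toℕ x → Ascending (y ∷ ys) → Ascending (y ∷ insert x ys)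
insert-ascending-∷ y x [] le _ = asc-∷ le asc-[-]
insert-ascending-∷ y x (z ∷ zs) le (asc-∷ yz sz) with toℕ x ℕ.≤ᵇ toℕ z in eq
... | true = asc-∷ le (asc-∷ (≤ᵇ≡true⇒≤ eq) sz)
... | false = asc-∷ yz (insert-ascending-∷ z x zs (ℕₚ.≰⇒≥ (≤ᵇ≡false⇒≰ eq)) sz)

insert-ascending : ∀ {n m} (x : Fin n) (ys : Vec (Fin n) m) → Ascending ys → Ascending (insert x ys)
insert-ascending x [] _ = asc-[-]
insert-ascending x (y ∷ ys) sy with toℕ x ℕ.≤ᵇ toℕ y in eq
... | true = asc-∷ (≤ᵇ≡true⇒≤ eq) sy
... | false = insert-ascending-∷ y x ys (ℕₚ.≰⇒≥ (≤ᵇ≡false⇒≰ eq)) sy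

insert-≤ : ∀ {n m} (x y : Fin n) (ys : Vec (Fin n) m) → toℕ x ≤ toℕ y → insert x (y ∷ ys) ≡ x ∷ y ∷ ys
insert-≤ x y ys le with toℕ x ℕ.≤ᵇ toℕ y in eq
... | true = refl
... | false = contradiction le (≤ᵇ≡false⇒≰ eq)

insert-≰ : ∀ {n m} (x y : Fin n) (ys : Vec (Fin n) m) → ¬ (toℕ x ≤ toℕ y) → insert x (y ∷ ys) ≡ y ∷ insert x ys
insert-≰ x y ys nle with toℕ x ℕ.≤ᵇ toℕ y in eq
... | true = contradiction (≤ᵇ≡true⇒≤ eq) nle
... | false = refl

Staggered : ℕ → ℕ → ℕ → ℕ → Set
Staggered a b c d = a ≤ c × c ≤ b × b ≤ d

-- The chords {a < b} and {c < d} of the circle meet (a shared endpoint counts) iff one is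
-- staggered before the other; for chords this is exactly SortedPair (sortedPair⇒staggered).
Cross : ℕ → ℕ → ℕ → ℕ → Set
Cross a b c d = Staggered a b c d ⊎ Staggered c d a b

staggered? : ∀ a b c d → Dec (Staggered a b c d)
staggered? a b c d = (a ℕ.≤? c) Decidable.×-dec (c ℕ.≤? b) Decidable.×-dec (b ℕ.≤? d)

cross? : ∀ a b c d → Dec (Cross a b c d)
cross? a b c d = staggered? a b c d Decidable.⊎-dec staggered? c d a b

PairLe : ℕ → ℕ → ℕ → ℕ → Set
PairLe a b c d = a ≤ c × b ≤ d

cross⇒pairLe : ∀ {a b c d} → Cross a b c d → PairLe a b c d ⊎ PairLe c d a b
cross⇒pairLe (inj₁ (ac , _ , bd)) = inj₁ (ac , bd)
cross⇒pairLe (inj₂ (ca , _ , db)) = inj₂ (ca , db)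

pairLe-+<-contra : ∀ {x y a b} → PairLe x y a b → a + b < x + y → ⊥
pairLe-+<-contra (xa , yb) lt = ℕₚ.<⇒≱ lt (ℕₚ.+-mono-≤ xa yb)

loℕ hiℕ : ∀ {n} → Edge n → ℕ
loℕ I = toℕ (lo I)
hiℕ I = toℕ (hi I)

sort4-ascending : ∀ {n} (I J : Edge n) → toℕ (a₁ I J) ≤ toℕ (a₂ I J) × toℕ (a₂ I J) ≤ toℕ (a₃ I J) × toℕ (a₃ I J) ≤ toℕ (a₄ I J)
sort4-ascending I J = go (sort4 I J) (insert-ascending (lo I) _ (insert-ascending (hi I) _ (insert-ascending (lo J) _ asc-[-])))
  where
  go : ∀ {n} (v : Vec (Fin n) 4) → Ascending v → toℕ (Vec.lookup v Fin.zero) ≤ toℕ (Vec.lookup v (Fin.suc Fin.zero)) × toℕ (Vec.lookup v (Fin.suc Fin.zero)) ≤ toℕ (Vec.lookup v (Fin.suc (Fin.suc Fin.zero))) × toℕ (Vec.lookup v (Fin.suc (Fin.suc Fin.zero))) ≤ toℕ (Vec.lookup v (Fin.suc (Fin.suc (Fin.suc Fin.zero))))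
  go (a ∷ b ∷ c ∷ d ∷ []) (asc-∷ ab (asc-∷ bc (asc-∷ cd _))) = ab , bc , cd

sortedPair⇒staggered : ∀ {n} (I J : Edge n) → SortedPair I J → Staggered (loℕ I) (hiℕ I) (loℕ J) (hiℕ J)
sortedPair⇒staggered I J sp = go (sort4-ascending I J) (cong toℕ (proj₁ (proj₁ sp))) (cong toℕ (proj₁ (proj₂ sp))) (cong toℕ (proj₂ (proj₁ sp))) (cong toℕ (proj₂ (proj₂ sp)))
  where
  go : ∀ {a b c d w x y z : ℕ} → w ≤ x × x ≤ y × y ≤ z → a ≡ w → c ≡ x → b ≡ y → d ≡ z → Staggered a b c d
  go (l12 , l23 , l34) refl refl refl refl = l12 , l23 , l34

staggered⇒sortedPair : ∀ {n} (I J : Edge n) → Staggered (loℕ I) (hiℕ I) (loℕ J) (hiℕ J) → SortedPair I J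
staggered⇒sortedPair {n} I J (ac , cb , bd) = go (lo I) (hi I) (lo J) (hi J) (lo<hi I) (lo<hi J) ac cb bd
  where
  go : (a b c d : Fin n) → toℕ a ℕ.< toℕ b → toℕ c ℕ.< toℕ d → toℕ a ≤ toℕ c → toℕ c ≤ toℕ b → toℕ b ≤ toℕ d →
       let v = insert a (insert b (insert c (d ∷ []))) in
       (a ≡ Vec.lookup v Fin.zero × b ≡ Vec.lookup v (Fin.suc (Fin.suc Fin.zero))) × (c ≡ Vec.lookup v (Fin.suc Fin.zero) × d ≡ Vec.lookup v (Fin.suc (Fin.suc (Fin.suc Fin.zero))))
  go a b c d ab cd ac cb bd rewrite insert-≤ c d [] (ℕₚ.<⇒≤ cd) with toℕ b ℕₚ.≤? toℕ c
  ... | yes bc rewrite insert-≤ b c (d ∷ []) bc | insert-≤ a b (c ∷ d ∷ []) (ℕₚ.<⇒≤ ab) =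
        (refl , toℕ-injective (ℕₚ.≤-antisym bc cb)) , (toℕ-injective (ℕₚ.≤-antisym cb bc) , refl)
  ... | no nbc rewrite insert-≰ b c (d ∷ []) nbc | insert-≤ b d [] bd | insert-≤ a c (b ∷ d ∷ []) ac =
        (refl , refl) , (refl , refl)

-- Table entries addressed by natural numbers; out-of-range coordinates read as false.
opaque
  entryℕ : ∀ {n} → VSet n → ℕ → ℕ → Bool
  entryℕ {n} s a b with a ℕ.<? n | b ℕ.<? n
  ... | yes pa | yes pb = entry s (fromℕ< pa) (fromℕ< pb)
  ... | yes _ | no _ = false
  ... | no _ | _ = false

  entryℕ-fromℕ< : ∀ {n} (s : VSet n) {a b} (pa : a < n) (pb : b < n) → entryℕ s a b ≡ entry s (fromℕ< pa) (fromℕ< pb)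
  entryℕ-fromℕ< {n} s {a} {b} pa pb with a ℕ.<? n | b ℕ.<? n
  ... | yes pa' | yes pb' rewrite ℕₚ.<-irrelevant pa pa' | ℕₚ.<-irrelevant pb pb' = refl
  ... | yes _ | no npb = contradiction pb npb
  ... | no npa | _ = contradiction pa npa

  entryℕ-toℕ : ∀ {n} (s : VSet n) (i j : Fin n) → entryℕ s (toℕ i) (toℕ j) ≡ entry s i j
  entryℕ-toℕ s i j rewrite entryℕ-fromℕ< s (toℕ<n i) (toℕ<n j) | fromℕ<-toℕ i (toℕ<n i) | fromℕ<-toℕ j (toℕ<n j) = refl

  entryℕ-bounded : ∀ {n} (s : VSet n) {a b} → entryℕ s a b ≡ true → a < n × b < n
  entryℕ-bounded {n} s {a} {b} m with a ℕ.<? n | b ℕ.<? n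
  ... | yes pa | yes pb = pa , pb
  ... | yes _ | no _ = ⊥-elim (false≢true m)
  ... | no _ | _ = ⊥-elim (false≢true m)

record HasEdge {n : ℕ} (s : VSet n) (a b : ℕ) : Set where
  constructor hasEdge
  field entry≡true : entryℕ s a b ≡ true
open HasEdge public

hasEdge-bounded : ∀ {n} (s : VSet n) {a b} → HasEdge s a b → a < n × b < n
hasEdge-bounded s m = entryℕ-bounded s (entry≡true m)

hasEdge-hi≤N : ∀ {N} (s : VSet (suc N)) {a b} → HasEdge s a b → b ≤ N
hasEdge-hi≤N s m = ℕₚ.≤-pred (proj₂ (hasEdge-bounded s m))

hasEdge-< : ∀ {n} (s : VSet n) → WF s → ∀ {a b} → HasEdge s a b → a < b
hasEdge-< s wf {a} {b} m with hasEdge-bounded s m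
... | pa , pb = subst₂ ℕ._<_ (toℕ-fromℕ< pa) (toℕ-fromℕ< pb) (wf _ _ (trans (sym (entryℕ-fromℕ< s pa pb)) (entry≡true m)))

Mem⇒HasEdge : ∀ {n} (s : VSet n) (I : Edge n) → Mem I s → HasEdge s (loℕ I) (hiℕ I)
Mem⇒HasEdge s I m = hasEdge (trans (entryℕ-toℕ s (lo I) (hi I)) m)

HasEdge⇒Mem : ∀ {n} (s : VSet n) (I : Edge n) → HasEdge s (loℕ I) (hiℕ I) → Mem I s
HasEdge⇒Mem s I m = trans (sym (entryℕ-toℕ s (lo I) (hi I))) (entry≡true m)

toEdge : ∀ {n a b} → a < b → b < n → Edge n
toEdge {n} {a} {b} ab bn = edge (fromℕ< (ℕₚ.<-trans ab bn)) (fromℕ< bn)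
  (subst₂ ℕ._<_ (sym (toℕ-fromℕ< (ℕₚ.<-trans ab bn))) (sym (toℕ-fromℕ< bn)) ab)

toEdge-lo : ∀ {n a b} (ab : a < b) (bn : b < n) → loℕ (toEdge ab bn) ≡ a
toEdge-lo ab bn = toℕ-fromℕ< _
toEdge-hi : ∀ {n a b} (ab : a < b) (bn : b < n) → hiℕ (toEdge ab bn) ≡ b
toEdge-hi ab bn = toℕ-fromℕ< _

HasEdge⇒Mem-toEdge : ∀ {n} (s : VSet n) {a b} (ab : a < b) (bn : b < n) → HasEdge s a b → Mem (toEdge ab bn) s
HasEdge⇒Mem-toEdge s ab bn m = HasEdge⇒Mem s (toEdge ab bn) (subst₂ (HasEdge s) (sym (toEdge-lo ab bn)) (sym (toEdge-hi ab bn)) m)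

-- Maximal simplices as maximal families of pairwise crossing chords

record MaxThrackle {n : ℕ} (s : VSet n) : Set where
  field
    wf : WF s
    crossing : ∀ {a b c d} → HasEdge s a b → HasEdge s c d → Cross a b c d
    maximal : ∀ {x y} → x < y → y < n → (∀ {a b} → HasEdge s a b → Cross x y a b) → HasEdge s x y

staggered-refl : ∀ {a b} → a ≤ b → Staggered a b a b
staggered-refl ab = ℕₚ.≤-refl , ab , ℕₚ.≤-refl

sameEdge⇒ℕ : ∀ {n} (I K : Edge n) → SameEdge I K → loℕ I ≡ loℕ K × hiℕ I ≡ hiℕ K
sameEdge⇒ℕ I K (e1 , e2) = cong toℕ e1 , cong toℕ e2

all-any⇒∃ : ∀ {A : Set} {P Q : A → Set} {xs : List A} → All P xs → Any Q xs → ∃ λ x → P x × Q x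
all-any⇒∃ (px ∷ _) (here qx) = _ , px , qx
all-any⇒∃ (_ ∷ pxs) (there q) = all-any⇒∃ pxs q

sortedColl-cross : ∀ {n} (L : List (Edge n)) → AllPairs SortedPair L → (I J : Edge n) → Any (SameEdge I) L → Any (SameEdge J) L →
  Cross (loℕ I) (hiℕ I) (loℕ J) (hiℕ J)
sortedColl-cross (K ∷ L) (a ∷ ap) I J (here sI) (here sJ) with sameEdge⇒ℕ I K sI | sameEdge⇒ℕ J K sJ
... | (e1 , e2) | (e3 , e4) rewrite e1 | e2 | e3 | e4 = inj₁ (staggered-refl (ℕₚ.<⇒≤ (lo<hi K)))
sortedColl-cross (K ∷ L) (a ∷ ap) I J (here sI) (there aJ) with all-any⇒∃ a aJ
... | (K' , sp , sJ) with sameEdge⇒ℕ I K sI | sameEdge⇒ℕ J K' sJ | sortedPair⇒staggered K K' sp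
... | (e1 , e2) | (e3 , e4) | cr rewrite e1 | e2 | e3 | e4 = inj₁ cr
sortedColl-cross (K ∷ L) (a ∷ ap) I J (there aI) (here sJ) with all-any⇒∃ a aI
... | (K' , sp , sI) with sameEdge⇒ℕ I K' sI | sameEdge⇒ℕ J K sJ | sortedPair⇒staggered K K' sp
... | (e1 , e2) | (e3 , e4) | cr rewrite e1 | e2 | e3 | e4 = inj₂ cr
sortedColl-cross (K ∷ L) (a ∷ ap) I J (there aI) (there aJ) = sortedColl-cross L ap I J aI aJ

sortedColl⇒crossing : ∀ {n} (s : VSet n) → SortedColl s → ∀ {a b c d} → HasEdge s a b → HasEdge s c d → Cross a b c d
sortedColl⇒crossing s (wf , L , ap , mem) {a} {b} {c} {d} m1 m2 =
  let ab = hasEdge-< s wf m1 ; bn = proj₂ (hasEdge-bounded s m1)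
      cd = hasEdge-< s wf m2 ; dn = proj₂ (hasEdge-bounded s m2)
      I = toEdge ab bn ; J = toEdge cd dn
      r = sortedColl-cross L ap I J (Equivalence.to (mem I) (HasEdge⇒Mem-toEdge s ab bn m1)) (Equivalence.to (mem J) (HasEdge⇒Mem-toEdge s cd dn m2))
  in subst₂ (λ u v → Cross u v c d) (toEdge-lo ab bn) (toEdge-hi ab bn) (subst₂ (Cross (loℕ I) (hiℕ I)) (toEdge-lo cd dn) (toEdge-hi cd dn) r)

tableOf : ∀ {n} → (ℕ → ℕ → Bool) → VSet n
tableOf f = Vec.tabulate (λ i → Vec.tabulate (λ j → f (toℕ i) (toℕ j)))

entry-tableOf : ∀ {n} f (i j : Fin n) → entry (tableOf {n} f) i j ≡ f (toℕ i) (toℕ j)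
entry-tableOf f i j = trans (cong (λ v → Vec.lookup v j) (lookup∘tabulate (λ i → Vec.tabulate (λ j → f (toℕ i) (toℕ j))) i)) (lookup∘tabulate (λ j → f (toℕ i) (toℕ j)) j)

entryℕ-tableOf : ∀ {n} f {a b} → a < n → b < n → entryℕ (tableOf {n} f) a b ≡ f a b
entryℕ-tableOf f pa pb = trans (entryℕ-fromℕ< _ pa pb) (trans (entry-tableOf f _ _) (cong₂ f (toℕ-fromℕ< pa) (toℕ-fromℕ< pb)))

hasEdge-tableOf⁻ : ∀ {n} f {a b} → HasEdge (tableOf {n} f) a b → f a b ≡ true
hasEdge-tableOf⁻ {n} f m with hasEdge-bounded (tableOf {n} f) m
... | pa , pb = trans (sym (entryℕ-tableOf f pa pb)) (entry≡true m)

hasEdge-tableOf⁺ : ∀ {n} f {a b} → a < n → b < n → f a b ≡ true → HasEdge (tableOf {n} f) a b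
hasEdge-tableOf⁺ f pa pb e = hasEdge (trans (entryℕ-tableOf f pa pb) e)

WF-tableOf : ∀ {n} f → (∀ a b → f a b ≡ true → a < b) → WF (tableOf {n} f)
WF-tableOf f h i j e = h _ _ (trans (sym (entry-tableOf f i j)) e)

vset-ext : ∀ {n} {s t : VSet n} → (∀ i j → entry s i j ≡ entry t i j) → s ≡ t
vset-ext {n} {s} {t} h = trans (sym (tabulate∘lookup s)) (trans (tabulate-cong (λ i → trans (sym (tabulate∘lookup (Vec.lookup s i))) (trans (tabulate-cong (h i)) (tabulate∘lookup (Vec.lookup t i))))) (tabulate∘lookup t))

vset-ext-hasEdge : ∀ {n} {s t : VSet n} → (∀ {a b} → HasEdge s a b → HasEdge t a b) → (∀ {a b} → HasEdge t a b → HasEdge s a b) → s ≡ t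
vset-ext-hasEdge {n} {s} {t} st ts = vset-ext go
  where
  go : ∀ i j → entry s i j ≡ entry t i j
  go i j with entry s i j in e1 | entry t i j in e2
  ... | true | true = refl
  ... | false | false = refl
  ... | true | false = sym (trans (sym e2) (trans (sym (entryℕ-toℕ t i j)) (entry≡true (st (hasEdge (trans (entryℕ-toℕ s i j) e1))))))
  ... | false | true = trans (sym e1) (trans (sym (entryℕ-toℕ s i j)) (entry≡true (ts (hasEdge (trans (entryℕ-toℕ t i j) e2)))))

LexLe : ℕ → ℕ → ℕ → ℕ → Set
LexLe a b c d = a < c ⊎ (a ≡ c × b ≤ d)

lexLe? : ∀ a b c d → Dec (LexLe a b c d)
lexLe? a b c d = (a ℕ.<? c) ⊎-dec ((a ℕₚ.≟ c) ×-dec (b ℕ.≤? d))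

insertLex : ∀ {n} → Edge n → List (Edge n) → List (Edge n)
insertLex K [] = K ∷ []
insertLex K (E ∷ L) with lexLe? (loℕ K) (hiℕ K) (loℕ E) (hiℕ E)
... | yes _ = K ∷ E ∷ L
... | no _ = E ∷ insertLex K L

any-insertLex⁻ : ∀ {n} {P : Edge n → Set} K L → Any P (insertLex K L) → P K ⊎ Any P L
any-insertLex⁻ K [] (here p) = inj₁ p
any-insertLex⁻ K (E ∷ L) a with lexLe? (loℕ K) (hiℕ K) (loℕ E) (hiℕ E)
any-insertLex⁻ K (E ∷ L) (here p) | yes _ = inj₁ p
any-insertLex⁻ K (E ∷ L) (there a) | yes _ = inj₂ a
any-insertLex⁻ K (E ∷ L) (here p) | no _ = inj₂ (here p)
any-insertLex⁻ K (E ∷ L) (there a) | no _ with any-insertLex⁻ K L a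
... | inj₁ p = inj₁ p
... | inj₂ q = inj₂ (there q)

any-insertLex⁺ : ∀ {n} {P : Edge n → Set} K L → P K ⊎ Any P L → Any P (insertLex K L)
any-insertLex⁺ K [] (inj₁ p) = here p
any-insertLex⁺ K (E ∷ L) x with lexLe? (loℕ K) (hiℕ K) (loℕ E) (hiℕ E)
any-insertLex⁺ K (E ∷ L) (inj₁ p) | yes _ = here p
any-insertLex⁺ K (E ∷ L) (inj₂ a) | yes _ = there a
any-insertLex⁺ K (E ∷ L) (inj₁ p) | no _ = there (any-insertLex⁺ K L (inj₁ p))
any-insertLex⁺ K (E ∷ L) (inj₂ (here p)) | no _ = here p
any-insertLex⁺ K (E ∷ L) (inj₂ (there a)) | no _ = there (any-insertLex⁺ K L (inj₂ a))

all-insertLex : ∀ {n} {P : Edge n → Set} K L → P K → All P L → All P (insertLex K L)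
all-insertLex K [] p [] = p ∷ []
all-insertLex K (E ∷ L) p (q ∷ qs) with lexLe? (loℕ K) (hiℕ K) (loℕ E) (hiℕ E)
... | yes _ = p ∷ q ∷ qs
... | no _ = q ∷ all-insertLex K L p qs

all-zipWith : ∀ {A : Set} {P Q R : A → Set} {xs : List A} → All P xs → All Q xs → (∀ {x} → P x → Q x → R x) → All R xs
all-zipWith [] [] f = []
all-zipWith (p ∷ ps) (q ∷ qs) f = f p q ∷ all-zipWith ps qs f

staggered⇒lexLe : ∀ {a b c d} → Staggered a b c d → LexLe a b c d
staggered⇒lexLe {a} {b} {c} {d} (ac , cb , bd) with ℕₚ.m≤n⇒m<n∨m≡n ac
... | inj₁ lt = inj₁ lt
... | inj₂ eq = inj₂ (eq , bd)

lexLe-trans : ∀ {x y a b c d} → LexLe x y a b → LexLe a b c d → LexLe x y c d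
lexLe-trans (inj₁ xa) (inj₁ ac) = inj₁ (ℕₚ.<-trans xa ac)
lexLe-trans (inj₁ xa) (inj₂ (refl , _)) = inj₁ xa
lexLe-trans (inj₂ (refl , _)) (inj₁ ac) = inj₁ ac
lexLe-trans (inj₂ (refl , yb)) (inj₂ (refl , bd)) = inj₂ (refl , ℕₚ.≤-trans yb bd)

cross∧lexLe⇒staggered : ∀ {a b c d} → a ≤ b → Cross a b c d → LexLe a b c d → Staggered a b c d
cross∧lexLe⇒staggered ab (inj₁ cr) _ = cr
cross∧lexLe⇒staggered ab (inj₂ (ca , ad , db)) (inj₁ ac) = contradiction ca (ℕₚ.<⇒≱ ac)
cross∧lexLe⇒staggered ab (inj₂ (ca , ad , db)) (inj₂ (refl , bd)) with ℕₚ.≤-antisym bd db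
... | refl = staggered-refl ab

¬lexLe⇒lexLe : ∀ {a b c d} → ¬ LexLe a b c d → LexLe c d a b
¬lexLe⇒lexLe {a} {b} {c} {d} nl with ℕₚ.<-cmp a c
... | tri< lt _ _ = contradiction (inj₁ lt) nl
... | tri> _ _ gt = inj₁ gt
... | tri≈ _ refl _ = inj₂ (refl , ℕₚ.<⇒≤ (ℕₚ.≰⇒> (λ bd → nl (inj₂ (refl , bd)))))

cross-sym : ∀ {a b c d} → Cross a b c d → Cross c d a b
cross-sym (inj₁ x) = inj₂ x
cross-sym (inj₂ x) = inj₁ x

allPairs-insertLex : ∀ {n} (K : Edge n) L → AllPairs SortedPair L → All (λ E → Cross (loℕ K) (hiℕ K) (loℕ E) (hiℕ E)) L → AllPairs SortedPair (insertLex K L)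
allPairs-insertLex K [] [] [] = [] ∷ []
allPairs-insertLex K (E ∷ L) (a ∷ ap) (c ∷ cs) with lexLe? (loℕ K) (hiℕ K) (loℕ E) (hiℕ E)
... | yes kl = (staggered⇒sortedPair K E (cross∧lexLe⇒staggered kK c kl) ∷ all-zipWith a cs (λ {E'} sp cr → staggered⇒sortedPair K E' (cross∧lexLe⇒staggered kK cr (lexLe-trans kl (staggered⇒lexLe (sortedPair⇒staggered E E' sp)))))) ∷ a ∷ ap
  where
  kK : loℕ K ≤ hiℕ K
  kK = ℕₚ.<⇒≤ (lo<hi K)
... | no nl = all-insertLex K L (staggered⇒sortedPair E K (cross∧lexLe⇒staggered (ℕₚ.<⇒≤ (lo<hi E)) (cross-sym c) (¬lexLe⇒lexLe nl))) a ∷ allPairs-insertLex K L ap cs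

sameEdge-refl : ∀ {n} (I : Edge n) → SameEdge I I
sameEdge-refl I = refl , refl

maxSimplex⇒maxThrackle : ∀ {n} (s : VSet n) → MaxSimplex s → MaxThrackle s
maxSimplex⇒maxThrackle {n} s ((wf , L , ap , mem) , maximal) = record { wf = wf ; crossing = sortedColl⇒crossing s (wf , L , ap , mem) ; maximal = crossing-all⇒edge }
  where
  crossing-all⇒edge : ∀ {x y} → x < y → y < n → (∀ {a b} → HasEdge s a b → Cross x y a b) → HasEdge s x y
  crossing-all⇒edge {x} {y} xy yn h = subst₂ (HasEdge s) (toEdge-lo xy yn) (toEdge-hi xy yn) (Mem⇒HasEdge s K' K∈s)
    where
    K' : Edge n
    K' = toEdge xy yn
    entry-s+K : ℕ → ℕ → Bool
    entry-s+K a b = entryℕ s a b ∨ ((a ℕ.≡ᵇ x) ∧ (b ℕ.≡ᵇ y))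
    s+K : VSet n
    s+K = tableOf entry-s+K
    s+K-wf : ∀ a b → entry-s+K a b ≡ true → a < b
    s+K-wf a b e with ∨-true {entryℕ s a b} e
    ... | inj₁ m = hasEdge-< s wf (hasEdge m)
    ... | inj₂ e2 with ∧-true {a ℕ.≡ᵇ x} e2
    ... | e3 , e4 rewrite ≡ᵇ-true {a} e3 | ≡ᵇ-true {b} e4 = xy
    mem-s+K⁻ : ∀ I → Mem I s+K → Mem I s ⊎ SameEdge I K'
    mem-s+K⁻ I m with ∨-true {entryℕ s (loℕ I) (hiℕ I)} (trans (sym (entry-tableOf entry-s+K (lo I) (hi I))) m)
    ... | inj₁ m' = inj₁ (HasEdge⇒Mem s I (hasEdge m'))
    ... | inj₂ e2 with ∧-true {loℕ I ℕ.≡ᵇ x} e2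
    ... | e3 , e4 = inj₂ (toℕ-injective (trans (≡ᵇ-true e3) (sym (toEdge-lo xy yn))) , toℕ-injective (trans (≡ᵇ-true e4) (sym (toEdge-hi xy yn))))
    mem-s+K⁺ : ∀ I → Mem I s ⊎ SameEdge I K' → Mem I s+K
    mem-s+K⁺ I (inj₁ m) = trans (entry-tableOf entry-s+K (lo I) (hi I)) (cong (_∨ _) (entry≡true (Mem⇒HasEdge s I m)))
    mem-s+K⁺ I (inj₂ (e1 , e2)) = trans (entry-tableOf entry-s+K (lo I) (hi I)) (∨-introʳ (entryℕ s (loℕ I) (hiℕ I))
      (subst₂ (λ u v → ((u ℕ.≡ᵇ x) ∧ (v ℕ.≡ᵇ y)) ≡ true) (sym (trans (cong toℕ e1) (toEdge-lo xy yn))) (sym (trans (cong toℕ e2) (toEdge-hi xy yn)))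
        (cong₂ _∧_ (≡ᵇ-refl x) (≡ᵇ-refl y))))
    K-crosses-L : All (λ E → Cross (loℕ K') (hiℕ K') (loℕ E) (hiℕ E)) L
    K-crosses-L = All.tabulate (λ {E} E∈ →
      subst₂ (λ u v → Cross u v (loℕ E) (hiℕ E)) (sym (toEdge-lo xy yn)) (sym (toEdge-hi xy yn))
        (h (Mem⇒HasEdge s E (Equivalence.from (mem E) (Any.map (λ eq → cong lo eq , cong hi eq) E∈)))))
    s+K-sorted : SortedColl s+K
    s+K-sorted = WF-tableOf entry-s+K s+K-wf , insertLex K' L , allPairs-insertLex K' L ap K-crosses-L ,
      (λ I → mk⇔ (λ m → any-insertLex⁺ K' L (Sum.map (λ x → x) (Equivalence.to (mem I)) (Sum.swap (mem-s+K⁻ I m))))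
                  (λ a → mem-s+K⁺ I (Sum.swap (Sum.map (λ x → x) (Equivalence.from (mem I)) (any-insertLex⁻ K' L a)))))
    K∈s : Mem K' s
    K∈s = maximal s+K s+K-sorted (λ I m → mem-s+K⁺ I (inj₁ m)) K' (mem-s+K⁺ K' (inj₂ (sameEdge-refl K')))

maxThrackle⇒maxSimplex : ∀ {n} (s : VSet n) → MaxThrackle s → SortedColl s → MaxSimplex s
maxThrackle⇒maxSimplex {n} s mt sc = sc , λ t sct sub I mI → HasEdge⇒Mem s I (MaxThrackle.maximal mt (lo<hi I) (toℕ<n (hi I)) (λ {a} {b} m → go t sct sub I mI m))
  where
  go : ∀ t → SortedColl t → s ⊆V t → ∀ I → Mem I t → ∀ {a b} → HasEdge s a b → Cross (loℕ I) (hiℕ I) a b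
  go t sct sub I mI {a} {b} m =
    let ab = hasEdge-< s (MaxThrackle.wf mt) m ; bn = proj₂ (hasEdge-bounded s m) ; E = toEdge ab bn
        mt' = Mem⇒HasEdge t E (sub E (HasEdge⇒Mem-toEdge s ab bn m))
    in sortedColl⇒crossing t sct (Mem⇒HasEdge t I mI) (subst₂ (HasEdge t) (toEdge-lo ab bn) (toEdge-hi ab bn) mt')

isPairᵇ : ℕ → ℕ → ℕ × ℕ → Bool
isPairᵇ a b xy = (a ℕ.≡ᵇ proj₁ xy) ∧ (b ℕ.≡ᵇ proj₂ xy)

isPairᵇ-true : ∀ {a b xy} → isPairᵇ a b xy ≡ true → a ≡ proj₁ xy × b ≡ proj₂ xy
isPairᵇ-true {a} {b} e with ∧-true {a ℕ.≡ᵇ _} e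
... | e1 , e2 = ≡ᵇ-true e1 , ≡ᵇ-true e2

isPairᵇ-refl : ∀ a b → isPairᵇ a b (a , b) ≡ true
isPairᵇ-refl a b rewrite ≡ᵇ-refl a | ≡ᵇ-refl b = refl

isPairᵇ-false : ∀ {a b xy} → ¬ (a ≡ proj₁ xy × b ≡ proj₂ xy) → isPairᵇ a b xy ≡ false
isPairᵇ-false {a} {b} {xy} ne with isPairᵇ a b xy in e
... | true = ⊥-elim (ne (isPairᵇ-true e))
... | false = refl

swapEntry : ∀ {n} → VSet n → ℕ × ℕ → ℕ × ℕ → ℕ → ℕ → Bool
swapEntry s I J a b = (entryℕ s a b ∧ not (isPairᵇ a b I)) ∨ isPairᵇ a b J

swapEdge : ∀ {n} → VSet n → ℕ × ℕ → ℕ × ℕ → VSet n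
swapEdge s I J = tableOf (swapEntry s I J)

hasEdge-swap⁻ : ∀ {n} (s : VSet n) I J {a b} → HasEdge (swapEdge s I J) a b → (HasEdge s a b × ¬ (a ≡ proj₁ I × b ≡ proj₂ I)) ⊎ (a ≡ proj₁ J × b ≡ proj₂ J)
hasEdge-swap⁻ s I J {a} {b} m with ∨-true {entryℕ s a b ∧ not (isPairᵇ a b I)} (hasEdge-tableOf⁻ (swapEntry s I J) m)
... | inj₂ e = inj₂ (isPairᵇ-true e)
... | inj₁ e with ∧-true {entryℕ s a b} e
... | e1 , e2 = inj₁ (hasEdge e1 , λ eq → false≢true (trans (sym (not-isPairᵇ⇒false e2)) (pair⇒isPairᵇ eq)))
  where
  not-isPairᵇ⇒false : not (isPairᵇ a b I) ≡ true → isPairᵇ a b I ≡ false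
  not-isPairᵇ⇒false e with isPairᵇ a b I
  ... | false = refl
  pair⇒isPairᵇ : (a ≡ proj₁ I × b ≡ proj₂ I) → isPairᵇ a b I ≡ true
  pair⇒isPairᵇ (refl , refl) = isPairᵇ-refl (proj₁ I) (proj₂ I)

hasEdge-swap-kept : ∀ {n} (s : VSet n) I J {a b} → HasEdge s a b → ¬ (a ≡ proj₁ I × b ≡ proj₂ I) → HasEdge (swapEdge s I J) a b
hasEdge-swap-kept s I J {a} {b} m ne with hasEdge-bounded s m
... | pa , pb = hasEdge-tableOf⁺ (swapEntry s I J) pa pb (subst (λ z → (z ∨ isPairᵇ a b J) ≡ true) (sym (cong₂ _∧_ (entry≡true m) (cong not (isPairᵇ-false ne)))) refl)

hasEdge-swap-new : ∀ {n} (s : VSet n) I J → proj₁ J < n → proj₂ J < n → HasEdge (swapEdge s I J) (proj₁ J) (proj₂ J)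
hasEdge-swap-new s I J pa pb = hasEdge-tableOf⁺ (swapEntry s I J) pa pb (∨-introʳ (entryℕ s (proj₁ J) (proj₂ J) ∧ not (isPairᵇ (proj₁ J) (proj₂ J) I)) (isPairᵇ-refl (proj₁ J) (proj₂ J)))

swapEdge-WF : ∀ {n} (s : VSet n) I J → WF s → proj₁ J < proj₂ J → WF (swapEdge s I J)
swapEdge-WF s I J wf lt = WF-tableOf (swapEntry s I J) g
  where
  g : ∀ a b → swapEntry s I J a b ≡ true → a < b
  g a b e with ∨-true {entryℕ s a b ∧ not (isPairᵇ a b I)} e
  ... | inj₂ e' = let (e1 , e2) = isPairᵇ-true {a} {b} e' in subst₂ _<_ (sym e1) (sym e2) lt
  ... | inj₁ e' = hasEdge-< s wf (hasEdge (proj₁ (∧-true {entryℕ s a b} e')))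

DistinctPair : ℕ → ℕ → ℕ → ℕ → Set
DistinctPair a b x y = ¬ (a ≡ x × b ≡ y)

shareFacet-intro : ∀ {n} (s t : VSet n) (I J : Edge n) → s ≢ t → Mem I s → Mem J t →
  (∀ {a b} → HasEdge s a b → DistinctPair a b (loℕ I) (hiℕ I) → HasEdge t a b × DistinctPair a b (loℕ J) (hiℕ J)) →
  (∀ {a b} → HasEdge t a b → DistinctPair a b (loℕ J) (hiℕ J) → HasEdge s a b × DistinctPair a b (loℕ I) (hiℕ I)) → ShareFacet s t
shareFacet-intro s t I J ne mI mJ f g = ne , I , J , mI , mJ , λ K → mk⇔ (to K) (from K)
  where
  toNE : ∀ K L → ¬ SameEdge K L → DistinctPair (loℕ K) (hiℕ K) (loℕ L) (hiℕ L)
  toNE K L ns (e1 , e2) = ns (toℕ-injective e1 , toℕ-injective e2)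
  fromNE : ∀ K L → DistinctPair (loℕ K) (hiℕ K) (loℕ L) (hiℕ L) → ¬ SameEdge K L
  fromNE K L ne (e1 , e2) = ne (cong toℕ e1 , cong toℕ e2)
  to : ∀ K → Mem K s × ¬ SameEdge K I → Mem K t × ¬ SameEdge K J
  to K (m , ns) = let (m' , ne') = f (Mem⇒HasEdge s K m) (toNE K I ns) in HasEdge⇒Mem t K m' , fromNE K J ne'
  from : ∀ K → Mem K t × ¬ SameEdge K J → Mem K s × ¬ SameEdge K I
  from K (m , ns) = let (m' , ne') = g (Mem⇒HasEdge t K m) (toNE K J ns) in HasEdge⇒Mem s K m' , fromNE K I ne'

record ShareFacetℕ {n : ℕ} (s t : VSet n) : Set where
  field
    i1 i2 j1 j2 : ℕ
    neq : s ≢ t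
    mI : HasEdge s i1 i2
    mJ : HasEdge t j1 j2
    j12 : j1 < j2
    fwd : ∀ {a b} → HasEdge s a b → DistinctPair a b i1 i2 → HasEdge t a b × DistinctPair a b j1 j2
    bwd : ∀ {a b} → HasEdge t a b → DistinctPair a b j1 j2 → HasEdge s a b × DistinctPair a b i1 i2

shareFacet-elim : ∀ {n} (s t : VSet n) → WF s → WF t → ShareFacet s t → ShareFacetℕ s t
shareFacet-elim s t ws wt (ne , I , J , mI , mJ , iff) = record
  { i1 = loℕ I ; i2 = hiℕ I ; j1 = loℕ J ; j2 = hiℕ J ; neq = ne ; mI = Mem⇒HasEdge s I mI ; mJ = Mem⇒HasEdge t J mJ ; j12 = lo<hi J
  ; fwd = λ {a} {b} m nei → fw m nei ; bwd = λ {a} {b} m nej → bw m nej }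
  where
  fw : ∀ {a b} → HasEdge s a b → DistinctPair a b (loℕ I) (hiℕ I) → HasEdge t a b × DistinctPair a b (loℕ J) (hiℕ J)
  fw {a} {b} m nei =
    let ab = hasEdge-< s ws m ; bn = proj₂ (hasEdge-bounded s m) ; K = toEdge ab bn
        r = Equivalence.to (iff K) (HasEdge⇒Mem-toEdge s ab bn m , λ (e1 , e2) → nei (trans (sym (toEdge-lo ab bn)) (cong toℕ e1) , trans (sym (toEdge-hi ab bn)) (cong toℕ e2)))
    in subst₂ (HasEdge t) (toEdge-lo ab bn) (toEdge-hi ab bn) (Mem⇒HasEdge t K (proj₁ r)) ,
       λ (e1 , e2) → proj₂ r (toℕ-injective (trans (toEdge-lo ab bn) e1) , toℕ-injective (trans (toEdge-hi ab bn) e2))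
  bw : ∀ {a b} → HasEdge t a b → DistinctPair a b (loℕ J) (hiℕ J) → HasEdge s a b × DistinctPair a b (loℕ I) (hiℕ I)
  bw {a} {b} m nej =
    let ab = hasEdge-< t wt m ; bn = proj₂ (hasEdge-bounded t m) ; K = toEdge ab bn
        r = Equivalence.from (iff K) (HasEdge⇒Mem-toEdge t ab bn m , λ (e1 , e2) → nej (trans (sym (toEdge-lo ab bn)) (cong toℕ e1) , trans (sym (toEdge-hi ab bn)) (cong toℕ e2)))
    in subst₂ (HasEdge s) (toEdge-lo ab bn) (toEdge-hi ab bn) (Mem⇒HasEdge s K (proj₁ r)) ,
       λ (e1 , e2) → proj₂ r (toℕ-injective (trans (toEdge-lo ab bn) e1) , toℕ-injective (trans (toEdge-hi ab bn) e2))

hasEdge? : ∀ {n} (s : VSet n) a b → Dec (HasEdge s a b)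
hasEdge? s a b with entryℕ s a b in e
... | true = yes (hasEdge e)
... | false = no (λ m → false≢true (trans (sym e) (entry≡true m)))

-- The lattice path of a maximal simplex

record Pivot {N : ℕ} (s : VSet (suc N)) : Set where
  field
    p : ℕ
    p≥1 : 1 ≤ p
    p<N : p < N
    straddle : ∀ {a b} → HasEdge s a b → a ≤ p × p ≤ b
    edge-0p : HasEdge s 0 p
    edge-pN : HasEdge s p N

module PivotOf (N : ℕ) (N≥2 : 2 ≤ N) (s : VSet (suc N)) (mt : MaxThrackle s) where
  open MaxThrackle mt

  HasEdgeFrom : ℕ → Set
  HasEdgeFrom a = ∃ λ b → b < suc N × HasEdge s a b
  HasEdgeTo : ℕ → Set
  HasEdgeTo b = ∃ λ a → a < suc N × HasEdge s a b
  hasEdgeFrom? : ∀ a → Dec (HasEdgeFrom a)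
  hasEdgeFrom? a = ℕₚ.anyUpTo? (λ b → hasEdge? s a b) (suc N)
  hasEdgeTo? : ∀ b → Dec (HasEdgeTo b)
  hasEdgeTo? b = ℕₚ.anyUpTo? (λ a → hasEdge? s a b) (suc N)

  someEdge : ∃ λ a → HasEdgeFrom a
  someEdge with ℕₚ.anyUpTo? hasEdgeFrom? (suc N)
  ... | yes (a , _ , l) = a , l
  ... | no h = 0 , 1 , s≤s (ℕₚ.≤-trans (s≤s z≤n) N≥2) , maximal (s≤s z≤n) (s≤s (ℕₚ.≤-trans (s≤s z≤n) N≥2)) (λ {a} {b} m → ⊥-elim (h (a , proj₁ (hasEdge-bounded s m) , b , proj₂ (hasEdge-bounded s m) , m)))

  -- The largest low endpoint m equals the smallest high endpoint h: if m < h, then {0, m}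
  -- (or {1, N} when m = 0) crosses every chord, so it is a chord, against the choice of h (of m).
  pivot : Pivot s
  pivot with greatestBelow hasEdgeFrom? (suc N) | leastBelow hasEdgeTo? (suc N)
  ... | inj₂ h | _ = ⊥-elim (h (proj₁ someEdge) (proj₁ (hasEdge-bounded s (proj₂ (proj₂ (proj₂ someEdge))))) (proj₂ someEdge))
  ... | inj₁ _ | inj₂ h = ⊥-elim (h _ (proj₂ (hasEdge-bounded s mm)) (_ , proj₁ (hasEdge-bounded s mm) , mm))
    where
    mm : HasEdge s (proj₁ someEdge) (proj₁ (proj₂ someEdge))
    mm = proj₂ (proj₂ (proj₂ someEdge))
  ... | inj₁ (m , _ , (b0 , _ , mb0) , hm) | inj₁ (h , _ , (a1 , _ , ma1) , hh) = record
      { p = m ; p≥1 = subst (1 ≤_) (sym m≡h) h≥1 ; p<N = ℕₚ.<-≤-trans (hasEdge-< s wf mb0) (ℕₚ.≤-pred (proj₂ (hasEdge-bounded s mb0)))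
      ; straddle = λ mab → loLe mab , subst (_≤ _) (sym m≡h) (hiGe mab)
      ; edge-0p = edge-0p′ ; edge-pN = edge-pN′ }
    where
    loLe : ∀ {a b} → HasEdge s a b → a ≤ m
    loLe {a} {b} mab = hm a (proj₁ (hasEdge-bounded s mab)) (b , proj₂ (hasEdge-bounded s mab) , mab)
    hiGe : ∀ {a b} → HasEdge s a b → h ≤ b
    hiGe {a} {b} mab = hh b (a , proj₁ (hasEdge-bounded s mab) , mab)
    h≥1 : 1 ≤ h
    h≥1 = ℕₚ.≤-<-trans z≤n (hasEdge-< s wf ma1)
    m≤h : m ≤ h
    m≤h with crossing mb0 ma1
    ... | inj₁ (ma , _ , _) = ℕₚ.<⇒≤ (ℕₚ.≤-<-trans ma (hasEdge-< s wf ma1))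
    ... | inj₂ (_ , mh , _) = mh
    m<n : m < suc N
    m<n = s≤s (ℕₚ.≤-trans (ℕₚ.<⇒≤ (hasEdge-< s wf mb0)) (hasEdge-hi≤N s mb0))
    m≡h : m ≡ h
    m≡h with ℕₚ.m≤n⇒m<n∨m≡n m≤h
    ... | inj₂ e = e
    ... | inj₁ m<h with m ℕₚ.≟ 0
    ...   | no m≢0 = contradiction (hh m (0 , s≤s z≤n , maximal (ℕₚ.n≢0⇒n>0 m≢0) m<n (λ {a} {b} mab → inj₁ (z≤n , loLe mab , ℕₚ.<⇒≤ (ℕₚ.<-≤-trans m<h (hiGe mab)))))) (ℕₚ.<⇒≱ m<h)
    ...   | yes m0 = contradiction (subst (1 ≤_) m0 (hm 1 (s≤s (ℕₚ.≤-trans (s≤s z≤n) N≥2)) (N , ℕₚ.≤-refl , m1N))) (λ ())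
      where
      m1N : HasEdge s 1 N
      m1N = maximal N≥2 ℕₚ.≤-refl (λ {a} {b} mab → inj₂ (ℕₚ.≤-trans (loLe mab) (subst (_≤ 1) (sym m0) z≤n) , ℕₚ.≤-trans h≥1 (hiGe mab) , hasEdge-hi≤N s mab))
    edge-0p′ : HasEdge s 0 m
    edge-0p′ = maximal (subst (1 ≤_) (sym m≡h) h≥1) m<n (λ {a} {b} mab → inj₁ (z≤n , loLe mab , subst (_≤ b) (sym m≡h) (hiGe mab)))
    edge-pN′ : HasEdge s m N
    edge-pN′ = maximal (ℕₚ.<-≤-trans (hasEdge-< s wf mb0) (hasEdge-hi≤N s mb0)) ℕₚ.≤-refl (λ {a} {b} mab → inj₂ (loLe mab , subst (_≤ b) (sym m≡h) (hiGe mab) , hasEdge-hi≤N s mab))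

step : Bool → ℕ × ℕ → ℕ × ℕ
step true (a , b) = suc a , b
step false (a , b) = a , suc b

step-cases : ∀ b x → (b ≡ true × proj₁ (step b x) ≡ suc (proj₁ x) × proj₂ (step b x) ≡ proj₂ x)
                ⊎ (b ≡ false × proj₁ (step b x) ≡ proj₁ x × proj₂ (step b x) ≡ suc (proj₂ x))
step-cases true x = inj₁ (refl , refl , refl)
step-cases false x = inj₂ (refl , refl , refl)

module Path (N : ℕ) (N≥2 : 2 ≤ N) (s : VSet (suc N)) (mt : MaxThrackle s) (pv : Pivot s) where
  open MaxThrackle mt
  open Pivot pv

  n : ℕ
  n = suc N

  -- The chords in lexicographic order, c 0 = {0, p}, …, c N = {p, N}: each step raises the low
  -- endpoint when that gives a chord and the high endpoint otherwise, so cL r + cH r = r + p.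
  c : ℕ → ℕ × ℕ
  raisesLo : ℕ → Bool
  c zero = 0 , p
  c (suc r) = step (raisesLo r) (c r)
  raisesLo r = entryℕ s (suc (proj₁ (c r))) (proj₂ (c r))

  cL cH : ℕ → ℕ
  cL r = proj₁ (c r)
  cH r = proj₂ (c r)

  StepAt : ℕ → Set
  StepAt r = (raisesLo r ≡ true × cL (suc r) ≡ suc (cL r) × cH (suc r) ≡ cH r)
           ⊎ (raisesLo r ≡ false × cL (suc r) ≡ cL r × cH (suc r) ≡ suc (cH r))

  step-at : ∀ r → StepAt r
  step-at r = step-cases (raisesLo r) (c r)

  path-rank : ∀ r → cL r + cH r ≡ r + p
  path-rank zero = refl
  path-rank (suc r) with step-at r
  ... | inj₁ (_ , e1 , e2) rewrite e1 | e2 = cong suc (path-rank r)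
  ... | inj₂ (_ , e1 , e2) rewrite e1 | e2 = trans (ℕₚ.+-suc (cL r) (cH r)) (cong suc (path-rank r))

  straddle-cross : ∀ {k1 k2 x y} → k1 ≤ p → p ≤ k2 → HasEdge s x y → PairLe x y k1 k2 ⊎ PairLe k1 k2 x y → Cross k1 k2 x y
  straddle-cross k1p pk2 mxy (inj₁ (xk1 , yk2)) = inj₂ (xk1 , ℕₚ.≤-trans k1p (proj₂ (straddle mxy)) , yk2)
  straddle-cross k1p pk2 mxy (inj₂ (k1x , k2y)) = inj₁ (k1x , ℕₚ.≤-trans (proj₁ (straddle mxy)) pk2 , k2y)

  extend-hi : ∀ {a b} → HasEdge s a b → suc b < n → (∀ {x} → a < x → ¬ HasEdge s x b) → HasEdge s a (suc b)
  extend-hi {a} {b} mab sbn nb = maximal (ℕₚ.m≤n⇒m≤1+n (hasEdge-< s wf mab)) sbn (λ {x} {y} mxy → straddle-cross (proj₁ (straddle mab)) (ℕₚ.m≤n⇒m≤1+n (proj₂ (straddle mab))) mxy (g mxy))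
    where
    g : ∀ {x y} → HasEdge s x y → PairLe x y a (suc b) ⊎ PairLe a (suc b) x y
    g {x} {y} mxy with cross⇒pairLe (crossing mxy mab)
    ... | inj₁ (xa , yb) = inj₁ (xa , ℕₚ.m≤n⇒m≤1+n yb)
    ... | inj₂ (ax , by) with ℕₚ.m≤n⇒m<n∨m≡n by
    ...   | inj₁ b<y = inj₂ (ax , b<y)
    ...   | inj₂ refl with ℕₚ.m≤n⇒m<n∨m≡n ax
    ...     | inj₁ a<x = ⊥-elim (nb a<x mxy)
    ...     | inj₂ refl = inj₁ (ℕₚ.≤-refl , ℕₚ.n≤1+n _)

  extend-lo : ∀ {a b} → HasEdge s a b → suc a < b → suc a ≤ p → (∀ {y} → b < y → ¬ HasEdge s a y) → HasEdge s (suc a) b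
  extend-lo {a} {b} mab sab sap nb = maximal sab (proj₂ (hasEdge-bounded s mab)) (λ {x} {y} mxy → straddle-cross sap (proj₂ (straddle mab)) mxy (g mxy))
    where
    g : ∀ {x y} → HasEdge s x y → PairLe x y (suc a) b ⊎ PairLe (suc a) b x y
    g {x} {y} mxy with cross⇒pairLe (crossing mxy mab)
    ... | inj₁ (xa , yb) = inj₁ (ℕₚ.m≤n⇒m≤1+n xa , yb)
    ... | inj₂ (ax , by) with ℕₚ.m≤n⇒m<n∨m≡n ax
    ...   | inj₁ a<x = inj₂ (a<x , by)
    ...   | inj₂ refl with ℕₚ.m≤n⇒m<n∨m≡n by
    ...     | inj₁ b<y = ⊥-elim (nb b<y mxy)
    ...     | inj₂ refl = inj₁ (ℕₚ.n≤1+n _ , ℕₚ.≤-refl)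

  next-edge : ∀ {a b} → HasEdge s a b → a + b < N + p → HasEdge s (suc a) b ⊎ HasEdge s a (suc b)
  next-edge {a} {b} mab rk with ℕₚ.m≤n⇒m<n∨m≡n (proj₁ (straddle mab))
  ... | inj₂ refl = inj₂ (extend-hi mab bnd (λ {x} ax mxb → contradiction (proj₁ (straddle mxb)) (ℕₚ.<⇒≱ ax)))
    where
    bnd : suc b < n
    bnd = s≤s (ℕₚ.+-cancelˡ-< p b N (subst (p + b <_) (ℕₚ.+-comm N p) rk))
  ... | inj₁ a<p with ℕₚ.m≤n⇒m<n∨m≡n (hasEdge-< s wf mab)
  ...   | inj₂ refl = inj₂ (extend-hi mab (s≤s (ℕₚ.≤-trans (s≤s a<p) p<N))
                 (λ {x} ax mxb → contradiction (hasEdge-< s wf mxb) (ℕₚ.≤⇒≯ ax)))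
  ...   | inj₁ sa<b with ℕₚ.anyUpTo? (λ y → ℕₚ._<?_ b y Decidable.×-dec hasEdge? s a y) n
  ...     | yes (y , yn , by , may) = inj₂ (extend-hi mab (ℕₚ.≤-<-trans by yn) nb)
    where
    nb : ∀ {x} → a < x → ¬ HasEdge s x b
    nb {x} ax mxb with cross⇒pairLe (crossing mxb may)
    ... | inj₁ (xa , _) = ℕₚ.<⇒≱ ax xa
    ... | inj₂ (_ , yb) = ℕₚ.<⇒≱ by yb
  ...     | no nD = inj₁ (extend-lo mab sa<b a<p (λ {y} by may → nD (y , proj₂ (hasEdge-bounded s may) , by , may)))

  path-edge : ∀ r → r ≤ N → HasEdge s (cL r) (cH r)
  path-edge zero _ = edge-0p
  path-edge (suc r) sr with step-at r | next-edge (path-edge r (ℕₚ.<⇒≤ sr)) rk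
    where
    rk : cL r + cH r < N + p
    rk = subst (_< N + p) (sym (path-rank r)) (ℕₚ.+-monoˡ-< p sr)
  ... | inj₁ (e , e1 , e2) | _ rewrite e1 | e2 = hasEdge e
  ... | inj₂ (e , e1 , e2) | inj₁ m = ⊥-elim (false≢true (trans (sym e) (entry≡true m)))
  ... | inj₂ (e , e1 , e2) | inj₂ m rewrite e1 | e2 = m

  path-lo≤p : ∀ r → r ≤ N → cL r ≤ p
  path-lo≤p r rN = proj₁ (straddle (path-edge r rN))
  path-p≤hi : ∀ r → r ≤ N → p ≤ cH r
  path-p≤hi r rN = proj₂ (straddle (path-edge r rN))
  path-hi≤N : ∀ r → r ≤ N → cH r ≤ N
  path-hi≤N r rN = hasEdge-hi≤N s (path-edge r rN)
  path-lo<hi : ∀ r → r ≤ N → cL r < cH r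
  path-lo<hi r rN = hasEdge-< s wf (path-edge r rN)

  path-mono-step : ∀ r → cL r ≤ cL (suc r) × cH r ≤ cH (suc r)
  path-mono-step r with step-at r
  ... | inj₁ (_ , e1 , e2) rewrite e1 | e2 = ℕₚ.n≤1+n _ , ℕₚ.≤-refl
  ... | inj₂ (_ , e1 , e2) rewrite e1 | e2 = ℕₚ.≤-refl , ℕₚ.n≤1+n _

  path-mono : ∀ {r t} → r ≤ t → cL r ≤ cL t × cH r ≤ cH t
  path-mono {r} {zero} z≤n = ℕₚ.≤-refl , ℕₚ.≤-refl
  path-mono {r} {suc t} rt with ℕₚ.m≤n⇒m<n∨m≡n rt
  ... | inj₂ refl = ℕₚ.≤-refl , ℕₚ.≤-refl
  ... | inj₁ r<st = ℕₚ.≤-trans (proj₁ (path-mono (ℕₚ.≤-pred r<st))) (proj₁ (path-mono-step t)) , ℕₚ.≤-trans (proj₂ (path-mono (ℕₚ.≤-pred r<st))) (proj₂ (path-mono-step t))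

  edge-on-path : ∀ {x y} → HasEdge s x y → Σ ℕ λ r → r ≤ N × x ≡ cL r × y ≡ cH r
  edge-on-path {x} {y} mxy = r , rN , on-path
    where
    r : ℕ
    r = (x + y) ∸ p
    pxy : p ≤ x + y
    pxy = ℕₚ.≤-trans (proj₂ (straddle mxy)) (ℕₚ.m≤n+m y x)
    rp : r + p ≡ x + y
    rp = ℕₚ.m∸n+n≡m pxy
    rN : r ≤ N
    rN = ℕₚ.≤-trans (ℕₚ.∸-monoˡ-≤ p (ℕₚ.+-mono-≤ (proj₁ (straddle mxy)) (hasEdge-hi≤N s mxy))) (ℕₚ.≤-reflexive (ℕₚ.m+n∸m≡n p N))
    on-path : x ≡ cL r × y ≡ cH r
    on-path with cross⇒pairLe (crossing mxy (path-edge r rN))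
    ... | inj₁ (a , b) = +-squeeze a b (trans (sym rp) (sym (path-rank r)))
    ... | inj₂ (a , b) = let (e1 , e2) = +-squeeze a b (trans (path-rank r) rp) in sym e1 , sym e2

  cross-sameRank⇒≡ : ∀ {x y a b} → Cross x y a b → x + y ≡ a + b → x ≡ a × y ≡ b
  cross-sameRank⇒≡ cr e with cross⇒pairLe cr
  ... | inj₁ (xa , yb) = +-squeeze xa yb e
  ... | inj₂ (ax , by) = let (e1 , e2) = +-squeeze ax by (sym e) in sym e1 , sym e2

  path-end : cL N ≡ p × cH N ≡ N
  path-end = +-squeeze (path-lo≤p N ℕₚ.≤-refl) (path-hi≤N N ℕₚ.≤-refl) (trans (path-rank N) (ℕₚ.+-comm N p))

  path-staggered : ∀ {r t} → r ≤ t → t ≤ N → Staggered (cL r) (cH r) (cL t) (cH t)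
  path-staggered rt tN = proj₁ (path-mono rt) , ℕₚ.≤-trans (path-lo≤p _ tN) (path-p≤hi _ (ℕₚ.≤-trans rt tN)) , proj₂ (path-mono rt)

  pathEdge : Fin n → Edge n
  pathEdge i = toEdge (path-lo<hi (toℕ i) (ℕₚ.≤-pred (toℕ<n i))) (s≤s (path-hi≤N (toℕ i) (ℕₚ.≤-pred (toℕ<n i))))

  pathEdge-lo : ∀ i → loℕ (pathEdge i) ≡ cL (toℕ i)
  pathEdge-lo i = toEdge-lo (path-lo<hi (toℕ i) (ℕₚ.≤-pred (toℕ<n i))) (s≤s (path-hi≤N (toℕ i) (ℕₚ.≤-pred (toℕ<n i))))
  pathEdge-hi : ∀ i → hiℕ (pathEdge i) ≡ cH (toℕ i)
  pathEdge-hi i = toEdge-hi (path-lo<hi (toℕ i) (ℕₚ.≤-pred (toℕ<n i))) (s≤s (path-hi≤N (toℕ i) (ℕₚ.≤-pred (toℕ<n i))))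

  pathEdges : List (Edge n)
  pathEdges = List.tabulate pathEdge

  path-sortedColl : SortedColl s
  path-sortedColl = wf , pathEdges , AllPairsₚ.tabulate⁺-< {f = pathEdge} (λ {i} {j} i<j → staggered⇒sortedPair (pathEdge i) (pathEdge j) (cr i j i<j)) , (λ I → mk⇔ (to I) (from I))
    where
    cr : ∀ i j → toℕ i < toℕ j → Staggered (loℕ (pathEdge i)) (hiℕ (pathEdge i)) (loℕ (pathEdge j)) (hiℕ (pathEdge j))
    cr i j ij rewrite pathEdge-lo i | pathEdge-hi i | pathEdge-lo j | pathEdge-hi j = path-staggered (ℕₚ.<⇒≤ ij) (ℕₚ.≤-pred (toℕ<n j))
    to : ∀ I → Mem I s → Any (SameEdge I) pathEdges
    to I m with edge-on-path (Mem⇒HasEdge s I m)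
    ... | r , rN , e1 , e2 = Anyₚ.tabulate⁺ {f = pathEdge} (fromℕ< (s≤s rN))
        (toℕ-injective (trans e1 (trans (cong cL (sym (toℕ-fromℕ< (s≤s rN)))) (sym (pathEdge-lo (fromℕ< (s≤s rN)))))) ,
         toℕ-injective (trans e2 (trans (cong cH (sym (toℕ-fromℕ< (s≤s rN)))) (sym (pathEdge-hi (fromℕ< (s≤s rN)))))))
    from : ∀ I → Any (SameEdge I) pathEdges → Mem I s
    from I a with Anyₚ.tabulate⁻ {f = pathEdge} a
    ... | i , (e1 , e2) = HasEdge⇒Mem s I (subst₂ (HasEdge s) (sym (trans (cong toℕ e1) (pathEdge-lo i))) (sym (trans (cong toℕ e2) (pathEdge-hi i))) (path-edge (toℕ i) (ℕₚ.≤-pred (toℕ<n i))))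

  path-maxSimplex : MaxSimplex s
  path-maxSimplex = maxThrackle⇒maxSimplex s mt path-sortedColl

  cL-mono : ∀ {t k} → t ≤ k → cL t ≤ cL k
  cL-mono tk = proj₁ (path-mono tk)
  cH-mono : ∀ {t k} → t ≤ k → cH t ≤ cH k
  cH-mono tk = proj₂ (path-mono tk)

-- Flips

ValidEdge : ℕ → ℕ → ℕ → Set
ValidEdge N x y = x < y × y ≤ N

module Flips (N : ℕ) (N≥2 : 2 ≤ N) (s : VSet (suc N)) (mt : MaxThrackle s) (pv : Pivot s) where
  open MaxThrackle mt
  open Pivot pv
  open Path N N≥2 s mt pv

  CrossesPathBut : ℕ → ℕ → ℕ → Set
  CrossesPathBut r x y = ∀ t → t ≤ N → t ≢ r → Cross x y (cL t) (cH t)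

  -- The only candidate to replace c r: at an inner bend the opposite corner of the unit square
  -- through c (r - 1), c r, c (r + 1); at the ends {p + 1, N} and {0, p - 1}. Off the bends it is
  -- c r itself.
  partnerFirst : ℕ × ℕ
  partnerFirst = if raisesLo 0 then c 0 else (suc p , N)
  N-1 : ℕ
  N-1 = pred N
  partnerLast : ℕ × ℕ
  partnerLast = if raisesLo N-1 then (0 , pred p) else c N
  partnerInner : ℕ → ℕ × ℕ
  partnerInner r = if raisesLo (pred r) then (if raisesLo r then c r else (cL (pred r) , suc (cH (pred r))))
                       else (if raisesLo r then (suc (cL (pred r)) , cH (pred r)) else c r)
  partner : ℕ → ℕ × ℕ
  partner r = if r ℕ.≡ᵇ 0 then partnerFirst else (if r ℕ.≡ᵇ N then partnerLast else partnerInner r)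

  N≢0 : N ≢ 0
  N≢0 e = contradiction (subst (2 ≤_) e N≥2) (λ ())

  partner-last : partner N ≡ partnerLast
  partner-last rewrite ≢⇒≡ᵇ-false N≢0 | ≡ᵇ-refl N = refl

  partner-inner : ∀ r → r ≢ 0 → r ≢ N → partner r ≡ partnerInner r
  partner-inner r r0 rN rewrite ≢⇒≡ᵇ-false r0 | ≢⇒≡ᵇ-false rN = refl

  suc[N-1]≡N : suc N-1 ≡ N
  suc[N-1]≡N = ℕₚ.suc-pred N ⦃ ℕ.≢-nonZero N≢0 ⦄

  cross-ends⇒straddle : ∀ {x y} → Cross x y 0 p → Cross x y p N → x ≤ p × p ≤ y
  cross-ends⇒straddle (inj₂ (_ , xp , py)) _ = xp , py
  cross-ends⇒straddle (inj₁ _) (inj₁ (xp , py , _)) = xp , py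
  cross-ends⇒straddle (inj₁ (x0 , _ , yp)) (inj₂ (px , _ , Ny)) = contradiction (ℕₚ.≤-trans px x0) (ℕₚ.<⇒≱ p≥1)

  rank-exists : ∀ {x y} → x ≤ p → p ≤ y → y ≤ N → Σ ℕ λ t → t ≤ N × x + y ≡ t + p
  rank-exists {x} {y} xp py yN = (x + y) ∸ p ,
    ℕₚ.≤-trans (ℕₚ.∸-monoˡ-≤ p (ℕₚ.+-mono-≤ xp yN)) (ℕₚ.≤-reflexive (ℕₚ.m+n∸m≡n p N)) ,
    sym (ℕₚ.m∸n+n≡m (ℕₚ.≤-trans py (ℕₚ.m≤n+m y x)))

  cross-sameRank⇒hasEdge : ∀ {x y} t → t ≤ N → Cross x y (cL t) (cH t) → x + y ≡ t + p → HasEdge s x y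
  cross-sameRank⇒hasEdge t tN cr e with cross-sameRank⇒≡ cr (trans e (sym (path-rank t)))
  ... | e1 , e2 rewrite e1 | e2 = path-edge t tN

  nonEdge-rank : ∀ r {x y} → x ≤ p → p ≤ y → y ≤ N → ¬ HasEdge s x y → CrossesPathBut r x y → x + y ≡ r + p
  nonEdge-rank r xp py yN nm cf with rank-exists xp py yN
  ... | t , tN , e with t ℕₚ.≟ r
  ...   | yes refl = e
  ...   | no tr = ⊥-elim (nm (cross-sameRank⇒hasEdge t tN (cf t tN tr) e))

  no-nonEdge-at-first : ∀ {x y} → x ≤ p → p ≤ y → y ≤ N → ¬ HasEdge s x y → CrossesPathBut 0 x y → ⊥
  no-nonEdge-at-first {x} {y} xp py yN nm cf with +-squeeze (z≤n {x}) py (sym (nonEdge-rank 0 xp py yN nm cf))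
  ... | refl , refl = nm edge-0p

  partner-unique-first : ∀ {x y} → ValidEdge N x y → ¬ HasEdge s x y → CrossesPathBut 0 x y → (x , y) ≡ partner 0
  partner-unique-first {x} {y} (xy , yN) nm cf with cf N ℕₚ.≤-refl N≢0
  ... | crN rewrite proj₁ path-end | proj₂ path-end with crN
  ...   | inj₁ (xp , py , _) = ⊥-elim (no-nonEdge-at-first xp py yN nm cf)
  ...   | inj₂ (px , xN , Ny) with ℕₚ.m≤n⇒m<n∨m≡n px | ℕₚ.≤-antisym yN Ny
  ...     | inj₂ refl | refl = ⊥-elim (no-nonEdge-at-first ℕₚ.≤-refl (ℕₚ.<⇒≤ p<N) ℕₚ.≤-refl nm cf)
  ...     | inj₁ p<x | refl with step-at 0 | cf 1 (ℕₚ.≤-trans (s≤s z≤n) N≥2) (λ ())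
  ...       | inj₁ (e , e1 , e2) | c1 rewrite e1 | e2 with c1
  ...         | inj₁ (_ , _ , Np) = ⊥-elim (ℕₚ.<⇒≱ p<N Np)
  ...         | inj₂ (_ , xp , _) = ⊥-elim (ℕₚ.<⇒≱ p<x xp)
  partner-unique-first {x} {y} (xy , yN) nm cf | crN | inj₂ (px , xN , Ny) | inj₁ p<x | refl | inj₂ (e , e1 , e2) | c1 rewrite e1 | e2 with c1
  ...         | inj₁ (x0 , _ , _) = ⊥-elim (ℕₚ.<⇒≱ (ℕₚ.≤-<-trans z≤n p<x) x0)
  ...         | inj₂ (_ , xsp , _) rewrite e | ℕₚ.≤-antisym xsp p<x = refl

  no-nonEdge-at-last : ∀ {x y} → x ≤ p → p ≤ y → y ≤ N → ¬ HasEdge s x y → CrossesPathBut N x y → ⊥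
  no-nonEdge-at-last xp py yN nm cf with +-squeeze xp yN (trans (nonEdge-rank N xp py yN nm cf) (ℕₚ.+-comm N p))
  ... | refl , refl = nm edge-pN

  cL-last : cL (suc N-1) ≡ p
  cL-last = trans (cong cL suc[N-1]≡N) (proj₁ path-end)
  cH-last : cH (suc N-1) ≡ N
  cH-last = trans (cong cH suc[N-1]≡N) (proj₂ path-end)

  N-1≤N : N-1 ≤ N
  N-1≤N = ℕₚ.≤-trans (ℕₚ.n≤1+n N-1) (ℕₚ.≤-reflexive suc[N-1]≡N)

  N-1≢N : N-1 ≢ N
  N-1≢N e = n≢1+n (trans e (sym suc[N-1]≡N))

  partnerLast-raise : raisesLo N-1 ≡ true → partnerLast ≡ (0 , pred p)
  partnerLast-raise e rewrite e = refl

  partner-unique-last : ∀ {x y} → ValidEdge N x y → ¬ HasEdge s x y → CrossesPathBut N x y → (x , y) ≡ partner N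
  partner-unique-last {x} {y} (xy , yN) nm cf with cf 0 z≤n (λ e → N≢0 (sym e))
  ... | inj₂ (_ , xp , py) = ⊥-elim (no-nonEdge-at-last xp py yN nm cf)
  ... | inj₁ (x0 , _ , yp) with ℕₚ.n≤0⇒n≡0 x0
  ...   | refl with ℕₚ.m≤n⇒m<n∨m≡n yp
  ...     | inj₂ refl = ⊥-elim (nm edge-0p)
  ...     | inj₁ y<p with step-at N-1 | cf N-1 N-1≤N N-1≢N
  ...       | inj₁ (e , e1 , e2) | inj₁ (_ , ly , _) = trans (cong (0 ,_) yv) (trans (sym (partnerLast-raise e)) (sym partner-last))
    where
    sl : suc (cL N-1) ≡ p
    sl = trans (sym e1) cL-last
    yv : y ≡ pred p
    yv = trans (ℕₚ.≤-antisym (ℕₚ.≤-pred (subst (suc y ≤_) (sym sl) y<p)) ly) (cong pred sl)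
  ...       | inj₁ (e , e1 , e2) | inj₂ (_ , _ , hy) = ⊥-elim (ℕₚ.<⇒≱ (ℕₚ.<-trans y<p p<N) (subst (_≤ y) (trans (sym e2) cH-last) hy))
  ...       | inj₂ (e , e1 , e2) | inj₁ (_ , ly , _) = ⊥-elim (ℕₚ.<⇒≱ y<p (subst (_≤ y) (trans (sym e1) cL-last) ly))
  ...       | inj₂ (e , e1 , e2) | inj₂ (l0 , _ , _) = ⊥-elim (ℕₚ.<⇒≱ p≥1 (subst (_≤ 0) (trans (sym e1) cL-last) l0))

  partnerInner-raise-up : ∀ q → raisesLo q ≡ true → raisesLo (suc q) ≡ false → partnerInner (suc q) ≡ (cL q , suc (cH q))
  partnerInner-raise-up q e1 e2 rewrite e1 | e2 = refl
  partnerInner-up-raise : ∀ q → raisesLo q ≡ false → raisesLo (suc q) ≡ true → partnerInner (suc q) ≡ (suc (cL q) , cH q)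
  partnerInner-up-raise q e1 e2 rewrite e1 | e2 = refl

  partner-unique-inner : ∀ q → suc (suc q) ≤ N → ∀ {x y} → ValidEdge N x y → ¬ HasEdge s x y → CrossesPathBut (suc q) x y → (x , y) ≡ partnerInner (suc q)
  partner-unique-inner q qN {x} {y} (xy , yN) nm cf = body (step-at q) (step-at (suc q)) os
    where
    sqN : suc q ≢ N
    sqN e = ℕₚ.<-irrefl e qN
    inP : x ≤ p × p ≤ y
    inP = cross-ends⇒straddle (cf 0 z≤n (λ ())) (subst₂ (Cross x y) (proj₁ path-end) (proj₂ path-end) (cf N ℕₚ.≤-refl (λ e → sqN (sym e))))
    e : x + y ≡ suc q + p
    e = nonEdge-rank (suc q) (proj₁ inP) (proj₂ inP) yN nm cf
    lowq : PairLe (cL q) (cH q) x y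
    lowq with cross⇒pairLe (cf q (ℕₚ.≤-trans (ℕₚ.n≤1+n q) (ℕₚ.<⇒≤ qN)) n≢1+n)
    ... | inj₁ le = ⊥-elim (pairLe-+<-contra le (subst (_< x + y) (sym (path-rank q)) (subst (q + p <_) (sym e) ℕₚ.≤-refl)))
    ... | inj₂ le = le
    upq : PairLe x y (cL (suc (suc q))) (cH (suc (suc q)))
    upq with cross⇒pairLe (cf (suc (suc q)) qN (λ e → n≢1+n (sym e)))
    ... | inj₁ le = le
    ... | inj₂ le = ⊥-elim (pairLe-+<-contra le (subst (x + y <_) (sym (path-rank (suc (suc q)))) (subst (_< suc (suc q) + p) (sym e) ℕₚ.≤-refl)))
    os : (x ≡ suc (cL q) × y ≡ cH q) ⊎ (x ≡ cL q × y ≡ suc (cH q))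
    os = one-step-above (proj₁ lowq) (proj₂ lowq) (trans e (sym (cong suc (path-rank q))))
    mq1 : HasEdge s (cL (suc q)) (cH (suc q))
    mq1 = path-edge (suc q) (ℕₚ.<⇒≤ qN)
    contraC : x ≡ cL (suc q) → y ≡ cH (suc q) → ⊥
    contraC ex ey = nm (subst₂ (HasEdge s) (sym ex) (sym ey) mq1)
    body : StepAt q → StepAt (suc q) → (x ≡ suc (cL q) × y ≡ cH q) ⊎ (x ≡ cL q × y ≡ suc (cH q)) → (x , y) ≡ partnerInner (suc q)
    body (inj₁ (r1 , a1 , b1)) _ (inj₁ (ex , ey)) = ⊥-elim (contraC (trans ex (sym a1)) (trans ey (sym b1)))
    body (inj₂ (r1 , a1 , b1)) _ (inj₂ (ex , ey)) = ⊥-elim (contraC (trans ex (sym a1)) (trans ey (sym b1)))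
    body (inj₁ (r1 , a1 , b1)) (inj₁ (r2 , a2 , b2)) (inj₂ (ex , ey)) =
      ⊥-elim (ℕₚ.1+n≰n (subst₂ _≤_ ey (trans b2 b1) (proj₂ upq)))
    body (inj₁ (r1 , a1 , b1)) (inj₂ (r2 , a2 , b2)) (inj₂ (ex , ey)) = trans (cong₂ _,_ ex ey) (sym (partnerInner-raise-up q r1 r2))
    body (inj₂ (r1 , a1 , b1)) (inj₁ (r2 , a2 , b2)) (inj₁ (ex , ey)) = trans (cong₂ _,_ ex ey) (sym (partnerInner-up-raise q r1 r2))
    body (inj₂ (r1 , a1 , b1)) (inj₂ (r2 , a2 , b2)) (inj₁ (ex , ey)) =
      ⊥-elim (ℕₚ.1+n≰n (subst₂ _≤_ ex (trans a2 a1) (proj₁ upq)))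

  partner-unique : ∀ r → r ≤ N → ∀ {x y} → ValidEdge N x y → ¬ HasEdge s x y → CrossesPathBut r x y → (x , y) ≡ partner r
  partner-unique zero _ v nm cf = partner-unique-first v nm cf
  partner-unique (suc q) rN {x} {y} v nm cf with suc q ℕₚ.≟ N
  ... | yes e = subst (λ k → (x , y) ≡ partner k) (sym e) (partner-unique-last v nm (subst (λ k → CrossesPathBut k x y) e cf))
  ... | no ne = trans (partner-unique-inner q (ℕₚ.≤∧≢⇒< rN ne) v nm cf) (sym (partner-inner (suc q) (λ ()) ne))

  partnerLo partnerHi : ℕ → ℕ
  partnerLo r = proj₁ (partner r)
  partnerHi r = proj₂ (partner r)

  Flippable : ℕ → Set
  Flippable r = ValidEdge N (partnerLo r) (partnerHi r) × ¬ HasEdge s (partnerLo r) (partnerHi r) × CrossesPathBut r (partnerLo r) (partnerHi r)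

  Bend : ℕ → Set
  Bend r = (r ≡ 0 × raisesLo 0 ≡ false) ⊎ (r ≡ N × raisesLo N-1 ≡ true) ⊎ (Σ ℕ λ q → r ≡ suc q × suc q < N × raisesLo q ≢ raisesLo (suc q))

  -- The bends whose candidate chord degenerates to a loop.
  Exceptional : ℕ → Set
  Exceptional r = (r ≡ 0 × raisesLo 0 ≡ false × suc p ≡ N) ⊎ (r ≡ N × raisesLo N-1 ≡ true × p ≡ 1)
        ⊎ (Σ ℕ λ q → r ≡ suc q × suc q < N × raisesLo q ≡ false × raisesLo (suc q) ≡ true × suc (cL q) ≡ cH q)

  partnerFirst-raise : raisesLo 0 ≡ true → partnerFirst ≡ c 0
  partnerFirst-raise e rewrite e = refl
  partnerFirst-up : raisesLo 0 ≡ false → partnerFirst ≡ (suc p , N)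
  partnerFirst-up e rewrite e = refl
  partnerLast-up : raisesLo N-1 ≡ false → partnerLast ≡ c N
  partnerLast-up e rewrite e = refl
  partnerInner-straight : ∀ q → raisesLo q ≡ raisesLo (suc q) → partnerInner (suc q) ≡ c (suc q)
  partnerInner-straight q e with raisesLo q | raisesLo (suc q)
  ... | true | true = refl
  ... | false | false = refl

  partner-on-path⇒¬flippable : ∀ r → r ≤ N → partner r ≡ c r → ¬ Flippable r
  partner-on-path⇒¬flippable r rN e (_ , nm , _) = nm (subst₂ (HasEdge s) (sym (cong proj₁ e)) (sym (cong proj₂ e)) (path-edge r rN))

  flippable⇒bend : ∀ r → r ≤ N → Flippable r → Bend r
  flippable⇒bend zero rN fo with raisesLo 0 Boolₚ.≟ false
  ... | yes e = inj₁ (refl , e)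
  ... | no ne = ⊥-elim (partner-on-path⇒¬flippable 0 rN (partnerFirst-raise (Boolₚ.¬-not ne)) fo)
  flippable⇒bend (suc q) rN fo with suc q ℕₚ.≟ N
  ... | yes eN with raisesLo N-1 Boolₚ.≟ true
  ...   | yes e = inj₂ (inj₁ (eN , e))
  ...   | no ne = ⊥-elim (partner-on-path⇒¬flippable (suc q) rN (subst (λ k → partner k ≡ c k) (sym eN) (trans partner-last (partnerLast-up (Boolₚ.¬-not ne)))) fo)
  flippable⇒bend (suc q) rN fo | no ne with raisesLo q Boolₚ.≟ raisesLo (suc q)
  ... | yes e = ⊥-elim (partner-on-path⇒¬flippable (suc q) rN (trans (partner-inner (suc q) (λ ()) ne) (partnerInner-straight q e)) fo)
  ... | no ne' = inj₂ (inj₂ (q , refl , ℕₚ.≤∧≢⇒< rN ne , ne'))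

  FlippableWith : ℕ × ℕ → ℕ → Set
  FlippableWith xy r = ValidEdge N (proj₁ xy) (proj₂ xy) × ¬ HasEdge s (proj₁ xy) (proj₂ xy) × CrossesPathBut r (proj₁ xy) (proj₂ xy)

  flippable-intro : ∀ r {x y} → partner r ≡ (x , y) → ValidEdge N x y → ¬ HasEdge s x y → CrossesPathBut r x y → Flippable r
  flippable-intro r e v nm cf = subst (λ z → FlippableWith z r) (sym e) (v , nm , cf)

  pairLe-trans : ∀ {a b c d e f} → PairLe a b c d → PairLe c d e f → PairLe a b e f
  pairLe-trans (x1 , y1) (x2 , y2) = ℕₚ.≤-trans x1 x2 , ℕₚ.≤-trans y1 y2

  crosses-between : ∀ q {x y} → x ≤ p → p ≤ y → PairLe (cL q) (cH q) x y → PairLe x y (cL (suc (suc q))) (cH (suc (suc q))) → CrossesPathBut (suc q) x y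
  crosses-between q xp py lq uq t tN tne with ℕₚ.<-cmp t (suc q)
  ... | tri< lt _ _ = straddle-cross xp py (path-edge t tN) (inj₁ (pairLe-trans (path-mono (ℕₚ.≤-pred lt)) lq))
  ... | tri≈ _ eq _ = ⊥-elim (tne eq)
  ... | tri> _ _ gt = straddle-cross xp py (path-edge t tN) (inj₂ (pairLe-trans uq (path-mono gt)))

  incomparable⇒¬hasEdge : ∀ {x y} r → r ≤ N → ¬ PairLe x y (cL r) (cH r) → ¬ PairLe (cL r) (cH r) x y → ¬ HasEdge s x y
  incomparable⇒¬hasEdge r rN n1 n2 m with cross⇒pairLe (crossing m (path-edge r rN))
  ... | inj₁ le = n1 le
  ... | inj₂ le = n2 le

  up-first⇒cH1 : raisesLo 0 ≡ false → cH 1 ≡ suc p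
  up-first⇒cH1 b0 with step-at 0
  ... | inj₁ (e , _ , _) = ⊥-elim (false≢true (trans (sym b0) e))
  ... | inj₂ (_ , _ , e2) = e2

  raise-last⇒cL : raisesLo N-1 ≡ true → cL N-1 ≡ pred p
  raise-last⇒cL bN with step-at N-1
  ... | inj₁ (_ , e1 , _) = cong pred (trans (sym e1) cL-last)
  ... | inj₂ (e , _ , _) = ⊥-elim (false≢true (trans (sym e) bN))

  bend-first-cases : raisesLo 0 ≡ false → Flippable 0 ⊎ Exceptional 0
  bend-first-cases b0 with ℕₚ.m≤n⇒m<n∨m≡n p<N
  ... | inj₂ e = inj₂ (inj₁ (refl , b0 , e))
  ... | inj₁ lt = inj₁ (flippable-intro 0 (partnerFirst-up b0) (lt , ℕₚ.≤-refl) nm cf)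
    where
    nm : ¬ HasEdge s (suc p) N
    nm m = ℕₚ.1+n≰n (proj₁ (straddle m))
    cf : CrossesPathBut 0 (suc p) N
    cf t tN tne = inj₂ (ℕₚ.≤-trans (path-lo≤p t tN) (ℕₚ.n≤1+n p) , subst (_≤ cH t) (up-first⇒cH1 b0) (proj₂ (path-mono (ℕₚ.n≢0⇒n>0 tne))) , path-hi≤N t tN)

  bend-last-cases : raisesLo N-1 ≡ true → Flippable N ⊎ Exceptional N
  bend-last-cases bN with ℕₚ.m≤n⇒m<n∨m≡n p≥1
  ... | inj₂ e = inj₂ (inj₂ (inj₁ (refl , bN , sym e)))
  ... | inj₁ lt = inj₁ (flippable-intro N (trans partner-last (partnerLast-raise bN)) (v lt , ℕₚ.≤-trans (ℕₚ.<⇒≤ (pred< p≥1)) (ℕₚ.<⇒≤ p<N)) nm cf)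
    where
    v : 1 < p → 0 < pred p
    v (s≤s {n = suc k} _) = s≤s z≤n
    nm : ¬ HasEdge s 0 (pred p)
    nm m = ℕₚ.<⇒≱ (pred< p≥1) (proj₂ (straddle m))
    cf : CrossesPathBut N 0 (pred p)
    cf t tN tne = inj₁ (z≤n , subst (cL t ≤_) (raise-last⇒cL bN) (proj₁ (path-mono tNm)) , ℕₚ.≤-trans (ℕₚ.<⇒≤ (pred< p≥1)) (path-p≤hi t tN))
      where
      tNm : t ≤ N-1
      tNm = ℕₚ.≤-pred (subst (t <_) (sym suc[N-1]≡N) (ℕₚ.≤∧≢⇒< tN tne))

  bend-inner-cases : ∀ q → suc q < N → raisesLo q ≢ raisesLo (suc q) → Flippable (suc q) ⊎ Exceptional (suc q)
  bend-inner-cases q lt ne = go (step-at q) (step-at (suc q))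
    where
    pEq : partner (suc q) ≡ partnerInner (suc q)
    pEq = partner-inner (suc q) (λ ()) (λ e → ℕₚ.<-irrefl e lt)
    qN : q ≤ N
    qN = ℕₚ.≤-trans (ℕₚ.n≤1+n q) (ℕₚ.<⇒≤ lt)
    q1N : suc q ≤ N
    q1N = ℕₚ.<⇒≤ lt
    go : StepAt q → StepAt (suc q) → Flippable (suc q) ⊎ Exceptional (suc q)
    go (inj₁ (r1 , _ , _)) (inj₁ (r2 , _ , _)) = ⊥-elim (ne (trans r1 (sym r2)))
    go (inj₂ (r1 , _ , _)) (inj₂ (r2 , _ , _)) = ⊥-elim (ne (trans r1 (sym r2)))
    go (inj₁ (r1 , a1 , b1)) (inj₂ (r2 , a2 , b2)) =
      inj₁ (flippable-intro (suc q) (trans pEq (partnerInner-raise-up q r1 r2)) (s≤s (ℕₚ.<⇒≤ (path-lo<hi q qN)) , subst (_≤ N) (trans b2 (cong suc b1)) (path-hi≤N (suc (suc q)) lt))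
        (incomparable⇒¬hasEdge (suc q) q1N (λ le → ℕₚ.1+n≰n (subst (suc (cH q) ≤_) b1 (proj₂ le))) (λ le → ℕₚ.1+n≰n (subst (_≤ cL q) a1 (proj₁ le))))
        (crosses-between q (path-lo≤p q qN) (ℕₚ.≤-trans (path-p≤hi q qN) (ℕₚ.n≤1+n _)) (ℕₚ.≤-refl , ℕₚ.n≤1+n _)
           (ℕₚ.≤-trans (ℕₚ.n≤1+n _) (ℕₚ.≤-reflexive (sym (trans a2 a1))) , ℕₚ.≤-reflexive (sym (trans b2 (cong suc b1))))))
    go (inj₂ (r1 , a1 , b1)) (inj₁ (r2 , a2 , b2)) with ℕₚ.m≤n⇒m<n∨m≡n (path-lo<hi q qN)
    ... | inj₂ e = inj₂ (inj₂ (inj₂ (q , refl , lt , r1 , r2 , e)))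
    ... | inj₁ lt' =
      inj₁ (flippable-intro (suc q) (trans pEq (partnerInner-up-raise q r1 r2)) (lt' , path-hi≤N q qN)
        (incomparable⇒¬hasEdge (suc q) q1N (λ le → ℕₚ.1+n≰n (subst (suc (cL q) ≤_) a1 (proj₁ le))) (λ le → ℕₚ.1+n≰n (subst (_≤ cH q) b1 (proj₂ le))))
        (crosses-between q (subst (_≤ p) (trans a2 (cong suc a1)) (path-lo≤p (suc (suc q)) lt)) (path-p≤hi q qN) (ℕₚ.n≤1+n _ , ℕₚ.≤-refl)
           (ℕₚ.≤-reflexive (sym (trans a2 (cong suc a1))) , ℕₚ.≤-trans (ℕₚ.n≤1+n _) (ℕₚ.≤-reflexive (sym (trans b2 b1))))))

  bend⇒flippable⊎exceptional : ∀ r → Bend r → Flippable r ⊎ Exceptional r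
  bend⇒flippable⊎exceptional r (inj₁ (refl , b0)) = bend-first-cases b0
  bend⇒flippable⊎exceptional r (inj₂ (inj₁ (refl , bN))) = bend-last-cases bN
  bend⇒flippable⊎exceptional r (inj₂ (inj₂ (q , refl , lt , ne))) = bend-inner-cases q lt ne

  exceptional⇒¬flippable : ∀ r → Exceptional r → ¬ Flippable r
  exceptional⇒¬flippable r (inj₁ (refl , b0 , e)) fo = ℕₚ.<-irrefl e (proj₁ (subst (λ z → ValidEdge N (proj₁ z) (proj₂ z)) (partnerFirst-up b0) (proj₁ fo)))
  exceptional⇒¬flippable r (inj₂ (inj₁ (refl , bN , e))) fo with subst (λ z → ValidEdge N (proj₁ z) (proj₂ z)) (trans partner-last (partnerLast-raise bN)) (proj₁ fo)
  ... | (v , _) rewrite e = ℕₚ.<-irrefl refl v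
  exceptional⇒¬flippable r (inj₂ (inj₂ (q , refl , lt , r1 , r2 , e))) fo with subst (λ z → ValidEdge N (proj₁ z) (proj₂ z)) (trans (partner-inner (suc q) (λ ()) (λ e → ℕₚ.<-irrefl e lt)) (partnerInner-up-raise q r1 r2)) (proj₁ fo)
  ... | (v , _) = ℕₚ.<-irrefl e v

  flipAt : ℕ → VSet (suc N)
  flipAt r = swapEdge s (c r) (partner r)

  path-distinct : ∀ {t r} → t ≢ r → DistinctPair (cL t) (cH t) (cL r) (cH r)
  path-distinct {t} {r} ne (e1 , e2) = ne (ℕₚ.+-cancelʳ-≡ p t r (trans (sym (path-rank t)) (trans (cong₂ _+_ e1 e2) (path-rank r))))

  partner-crosses : ∀ r → Flippable r → ∀ {a b} → HasEdge s a b → DistinctPair a b (cL r) (cH r) → Cross (partnerLo r) (partnerHi r) a b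
  partner-crosses r fo {a} {b} m ne with edge-on-path m
  ... | t , tN , e1 , e2 = subst₂ (Cross (partnerLo r) (partnerHi r)) (sym e1) (sym e2) (proj₂ (proj₂ fo) t tN (λ eq → ne (trans e1 (cong cL eq) , trans e2 (cong cH eq))))

  flip-maxThrackle : ∀ r → r ≤ N → Flippable r → MaxThrackle (flipAt r)
  flip-maxThrackle r rN fo = record { wf = swapEdge-WF s (c r) (partner r) wf (proj₁ (proj₁ fo)) ; crossing = flip-crossing ; maximal = flip-maximal }
    where
    partner-valid : ValidEdge N (partnerLo r) (partnerHi r)
    partner-valid = proj₁ fo
    flip-crossing : ∀ {a b c' d} → HasEdge (flipAt r) a b → HasEdge (flipAt r) c' d → Cross a b c' d
    flip-crossing m1 m2 with hasEdge-swap⁻ s (c r) (partner r) m1 | hasEdge-swap⁻ s (c r) (partner r) m2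
    ... | inj₁ (ma , _) | inj₁ (mc , _) = crossing ma mc
    ... | inj₁ (ma , na) | inj₂ (refl , refl) = cross-sym (partner-crosses r fo ma na)
    ... | inj₂ (refl , refl) | inj₁ (mc , nc) = partner-crosses r fo mc nc
    ... | inj₂ (refl , refl) | inj₂ (refl , refl) = inj₁ (staggered-refl (ℕₚ.<⇒≤ (proj₁ partner-valid)))
    flip-maximal : ∀ {x y} → x < y → y < suc N → (∀ {a b} → HasEdge (flipAt r) a b → Cross x y a b) → HasEdge (flipAt r) x y
    flip-maximal {x} {y} xy yn h with hasEdge? s x y
    ... | yes m with x ℕₚ.≟ cL r | y ℕₚ.≟ cH r
    ...   | yes refl | yes refl = ⊥-elim (proj₁ (proj₂ fo) (maximal (proj₁ partner-valid) (s≤s (proj₂ partner-valid)) partner-crosses-all))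
      where
      partner-crosses-all : ∀ {a b} → HasEdge s a b → Cross (partnerLo r) (partnerHi r) a b
      partner-crosses-all {a} {b} mab with a ℕₚ.≟ cL r | b ℕₚ.≟ cH r
      ... | yes refl | yes refl = cross-sym (h (hasEdge-swap-new s (c r) (partner r) (ℕₚ.≤-<-trans (ℕₚ.<⇒≤ (proj₁ partner-valid)) (s≤s (proj₂ partner-valid))) (s≤s (proj₂ partner-valid))))
      ... | no ne | _ = partner-crosses r fo mab (λ (e1 , _) → ne e1)
      ... | yes _ | no ne = partner-crosses r fo mab (λ (_ , e2) → ne e2)
    ...   | no ne | _ = hasEdge-swap-kept s (c r) (partner r) m (λ (e1 , _) → ne e1)
    ...   | yes _ | no ne = hasEdge-swap-kept s (c r) (partner r) m (λ (_ , e2) → ne e2)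
    flip-maximal {x} {y} xy yn h | no nm with partner-unique r rN (xy , ℕₚ.≤-pred yn) nm (λ t tN tne → h (hasEdge-swap-kept s (c r) (partner r) (path-edge t tN) (path-distinct tne)))
    ... | e = subst₂ (HasEdge (flipAt r)) (sym (cong proj₁ e)) (sym (cong proj₂ e)) (hasEdge-swap-new s (c r) (partner r) (ℕₚ.≤-<-trans (ℕₚ.<⇒≤ (proj₁ partner-valid)) (s≤s (proj₂ partner-valid))) (s≤s (proj₂ partner-valid)))

  flip-maxSimplex : ∀ r → r ≤ N → Flippable r → MaxSimplex (flipAt r)
  flip-maxSimplex r rN fo = Path.path-maxSimplex N N≥2 (flipAt r) (flip-maxThrackle r rN fo) (PivotOf.pivot N N≥2 (flipAt r) (flip-maxThrackle r rN fo))

  partner∈flip : ∀ r → Flippable r → HasEdge (flipAt r) (partnerLo r) (partnerHi r)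
  partner∈flip r fo = hasEdge-swap-new s (c r) (partner r) (ℕₚ.≤-<-trans (ℕₚ.<⇒≤ (proj₁ (proj₁ fo))) (s≤s (proj₂ (proj₁ fo)))) (s≤s (proj₂ (proj₁ fo)))

  flip-shareFacet : ∀ r → r ≤ N → Flippable r → ShareFacet s (flipAt r)
  flip-shareFacet r rN fo = shareFacet-intro s (flipAt r) Ie Je neq (HasEdge⇒Mem s Ie (subst₂ (HasEdge s) (sym Ilo) (sym Ihi) (path-edge r rN)))
      (HasEdge⇒Mem (flipAt r) Je (subst₂ (HasEdge (flipAt r)) (sym Jlo) (sym Jhi) (partner∈flip r fo))) f g
    where
    Ie : Edge (suc N)
    Ie = toEdge (path-lo<hi r rN) (s≤s (path-hi≤N r rN))
    Je : Edge (suc N)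
    Je = toEdge (proj₁ (proj₁ fo)) (s≤s (proj₂ (proj₁ fo)))
    Ilo : loℕ Ie ≡ cL r
    Ilo = toEdge-lo (path-lo<hi r rN) (s≤s (path-hi≤N r rN))
    Ihi : hiℕ Ie ≡ cH r
    Ihi = toEdge-hi (path-lo<hi r rN) (s≤s (path-hi≤N r rN))
    Jlo : loℕ Je ≡ partnerLo r
    Jlo = toEdge-lo (proj₁ (proj₁ fo)) (s≤s (proj₂ (proj₁ fo)))
    Jhi : hiℕ Je ≡ partnerHi r
    Jhi = toEdge-hi (proj₁ (proj₁ fo)) (s≤s (proj₂ (proj₁ fo)))
    neq : s ≢ flipAt r
    neq e = proj₁ (proj₂ fo) (subst (λ z → HasEdge z (partnerLo r) (partnerHi r)) (sym e) (partner∈flip r fo))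
    f : ∀ {a b} → HasEdge s a b → DistinctPair a b (loℕ Ie) (hiℕ Ie) → HasEdge (flipAt r) a b × DistinctPair a b (loℕ Je) (hiℕ Je)
    f {a} {b} m ne = hasEdge-swap-kept s (c r) (partner r) m (λ (e1 , e2) → ne (trans e1 (sym Ilo) , trans e2 (sym Ihi))) ,
      λ (e1 , e2) → proj₁ (proj₂ fo) (subst₂ (HasEdge s) (trans e1 Jlo) (trans e2 Jhi) m)
    g : ∀ {a b} → HasEdge (flipAt r) a b → DistinctPair a b (loℕ Je) (hiℕ Je) → HasEdge s a b × DistinctPair a b (loℕ Ie) (hiℕ Ie)
    g {a} {b} m ne with hasEdge-swap⁻ s (c r) (partner r) m
    ... | inj₁ (m' , ne') = m' , λ (e1 , e2) → ne' (trans e1 Ilo , trans e2 Ihi)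
    ... | inj₂ (e1 , e2) = ⊥-elim (ne (trans e1 (sym Jlo) , trans e2 (sym Jhi)))

  crossesPathBut? : ∀ r x y → Dec (CrossesPathBut r x y)
  crossesPathBut? r x y with ℕₚ.allUpTo? (λ t → Decidable.¬? (t ℕₚ.≟ r) Decidable.→-dec cross? x y (cL t) (cH t)) (suc N)
  ... | yes h = yes (λ t tN tne → h (s≤s tN) tne)
  ... | no nh = no (λ h → nh (λ {t} tN tne → h t (ℕₚ.≤-pred tN) tne))

  flippable? : ∀ r → Dec (Flippable r)
  flippable? r = ((partnerLo r ℕ.<? partnerHi r) Decidable.×-dec (partnerHi r ℕ.≤? N)) Decidable.×-dec (Decidable.¬? (hasEdge? s (partnerLo r) (partnerHi r))) Decidable.×-dec crossesPathBut? r (partnerLo r) (partnerHi r)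

module Neighbours (N : ℕ) (N≥2 : 2 ≤ N) (s : VSet (suc N)) (mt : MaxThrackle s) (pv : Pivot s) where
  open MaxThrackle mt
  open Pivot pv
  open Path N N≥2 s mt pv
  open Flips N N≥2 s mt pv

  module Neighbour (t : VSet (suc N)) (ms : MaxSimplex t) (sh : ShareFacet s t) where
    mtT : MaxThrackle t
    mtT = maxSimplex⇒maxThrackle t ms
    sf : ShareFacetℕ s t
    sf = shareFacet-elim s t wf (MaxThrackle.wf mtT) sh
    open ShareFacetℕ sf

    dropped-on-path : Σ ℕ λ r → r ≤ N × i1 ≡ cL r × i2 ≡ cH r
    dropped-on-path = edge-on-path mI
    r : ℕ
    r = proj₁ dropped-on-path
    rN : r ≤ N
    rN = proj₁ (proj₂ dropped-on-path)
    ei1 : i1 ≡ cL r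
    ei1 = proj₁ (proj₂ (proj₂ dropped-on-path))
    ei2 : i2 ≡ cH r
    ei2 = proj₂ (proj₂ (proj₂ dropped-on-path))

    added∉s : ¬ HasEdge s j1 j2
    added∉s mj with j1 ℕₚ.≟ i1 | j2 ℕₚ.≟ i2
    ... | yes q1 | yes q2 = neq (vset-ext-hasEdge st ts)
      where
      st : ∀ {a b} → HasEdge s a b → HasEdge t a b
      st {a} {b} m with a ℕₚ.≟ j1 | b ℕₚ.≟ j2
      ... | yes refl | yes refl = mJ
      ... | no ne | _ = proj₁ (fwd m (λ (e1 , _) → ne (trans e1 (sym q1))))
      ... | yes _ | no ne = proj₁ (fwd m (λ (_ , e2) → ne (trans e2 (sym q2))))
      ts : ∀ {a b} → HasEdge t a b → HasEdge s a b
      ts {a} {b} m with a ℕₚ.≟ j1 | b ℕₚ.≟ j2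
      ... | yes refl | yes refl = subst₂ (HasEdge s) (sym q1) (sym q2) mI
      ... | no ne | _ = proj₁ (bwd m (λ (e1 , _) → ne e1))
      ... | yes _ | no ne = proj₁ (bwd m (λ (_ , e2) → ne e2))
    ... | no ne | _ = proj₂ (fwd mj (λ (e1 , _) → ne e1)) (refl , refl)
    ... | yes _ | no ne = proj₂ (fwd mj (λ (_ , e2) → ne e2)) (refl , refl)

    added-crosses : CrossesPathBut r j1 j2
    added-crosses t' tN tne = cross-sym (MaxThrackle.crossing mtT (proj₁ (fwd (path-edge t' tN) (λ (e1 , e2) → path-distinct tne (trans e1 ei1 , trans e2 ei2)))) mJ)

    added-valid : ValidEdge N j1 j2
    added-valid = j12 , ℕₚ.≤-pred (proj₂ (hasEdge-bounded t mJ))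

    added≡partner : (j1 , j2) ≡ partner r
    added≡partner = partner-unique r rN added-valid added∉s added-crosses

    flippable : Flippable r
    flippable = flippable-intro r (sym added≡partner) added-valid added∉s added-crosses

    t≡flip : t ≡ flipAt r
    t≡flip = vset-ext-hasEdge tT Tt
      where
      tT : ∀ {a b} → HasEdge t a b → HasEdge (flipAt r) a b
      tT {a} {b} m with a ℕₚ.≟ j1 | b ℕₚ.≟ j2
      ... | yes refl | yes refl = subst₂ (HasEdge (flipAt r)) (sym (cong proj₁ added≡partner)) (sym (cong proj₂ added≡partner)) (partner∈flip r flippable)
      ... | no ne | _ = let (ms' , ni) = bwd m (λ (e1 , _) → ne e1) in hasEdge-swap-kept s (c r) (partner r) ms' (λ (e1 , e2) → ni (trans e1 (sym ei1) , trans e2 (sym ei2)))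
      ... | yes _ | no ne = let (ms' , ni) = bwd m (λ (_ , e2) → ne e2) in hasEdge-swap-kept s (c r) (partner r) ms' (λ (e1 , e2) → ni (trans e1 (sym ei1) , trans e2 (sym ei2)))
      Tt : ∀ {a b} → HasEdge (flipAt r) a b → HasEdge t a b
      Tt {a} {b} m with hasEdge-swap⁻ s (c r) (partner r) m
      ... | inj₁ (ms' , nc) = proj₁ (fwd ms' (λ (e1 , e2) → nc (trans e1 ei1 , trans e2 ei2)))
      ... | inj₂ (e1 , e2) = subst₂ (HasEdge t) (trans (cong proj₁ added≡partner) (sym e1)) (trans (cong proj₂ added≡partner) (sym e2)) mJ

  neighbour⇒flip : ∀ t → MaxSimplex t → ShareFacet s t → Σ ℕ λ r → r ≤ N × Flippable r × t ≡ flipAt r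
  neighbour⇒flip t ms sh = r , rN , flippable , t≡flip
    where open Neighbour t ms sh

  flip-drops-edge : ∀ r → r ≤ N → Flippable r → ¬ HasEdge (flipAt r) (cL r) (cH r)
  flip-drops-edge r rN fo m = Sum.[ (λ x → proj₂ x (refl , refl)) , (λ x → proj₁ (proj₂ fo) (subst₂ (HasEdge s) (proj₁ x) (proj₂ x) (path-edge r rN))) ] (hasEdge-swap⁻ s (c r) (partner r) m)

  flip-injective : ∀ {r r'} → r ≤ N → Flippable r → Flippable r' → flipAt r ≡ flipAt r' → r ≡ r'
  flip-injective {r} {r'} rN fo fo' eq with r ℕₚ.≟ r'
  ... | yes e = e
  ... | no ne = ⊥-elim (flip-drops-edge r rN fo (subst (λ z → HasEdge z (cL r) (cH r)) (sym eq) (hasEdge-swap-kept s (c r') (partner r') (path-edge r rN) (path-distinct ne))))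

-- Bends

module Bends (N : ℕ) (N≥2 : 2 ≤ N) (s : VSet (suc N)) (mt : MaxThrackle s) (pv : Pivot s) where
  open MaxThrackle mt
  open Pivot pv
  open Path N N≥2 s mt pv
  open Flips N N≥2 s mt pv

  Adjℕ : ℕ → ℕ → Set
  Adjℕ x y = HasEdge s x y ⊎ HasEdge s y x
  TwoNeighbours : ℕ → Set
  TwoNeighbours x = Σ ℕ λ y → Σ ℕ λ z → y ≢ z × Adjℕ x y × Adjℕ x z

  oneNeighbour⇒¬two : ∀ {x w} → (∀ {y} → Adjℕ x y → y ≡ w) → ¬ TwoNeighbours x
  oneNeighbour⇒¬two h (y , z , ne , ny , nz) = ne (trans (h ny) (sym (h nz)))

  pin-rank : ∀ {t q} → (t ≤ q → ⊥) → (suc (suc q) ≤ t → ⊥) → t ≡ suc q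
  pin-rank {t} {q} h1 h2 with ℕₚ.<-cmp t (suc q)
  ... | tri< lt _ _ = ⊥-elim (h1 (ℕₚ.≤-pred lt))
  ... | tri≈ _ e _ = e
  ... | tri> _ _ gt = ⊥-elim (h2 gt)

  first-raise⇒oneNeighbour : raisesLo 0 ≡ true → ∀ {y} → Adjℕ 0 y → y ≡ p
  first-raise⇒oneNeighbour r0 (inj₂ m) = ⊥-elim (ℕₚ.<⇒≱ (hasEdge-< s wf m) z≤n)
  first-raise⇒oneNeighbour r0 (inj₁ m) with edge-on-path m
  ... | zero , _ , _ , e2 = e2
  ... | suc t , tN , e1 , _ = ⊥-elim (ℕₚ.<⇒≱ (s≤s z≤n) (subst (1 ≤_) (sym e1) (subst (_≤ cL (suc t)) cL1 (proj₁ (path-mono {1} {suc t} (s≤s z≤n))))))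
    where
    cL1 : cL 1 ≡ 1
    cL1 with step-at 0
    ... | inj₁ (_ , e1 , _) = e1
    ... | inj₂ (e , _ , _) = ⊥-elim (false≢true (trans (sym e) r0))

  last-up⇒oneNeighbour : raisesLo N-1 ≡ false → ∀ {y} → Adjℕ N y → y ≡ p
  last-up⇒oneNeighbour uN (inj₁ m) = ⊥-elim (ℕₚ.<⇒≱ (hasEdge-< s wf m) (hasEdge-hi≤N s m))
  last-up⇒oneNeighbour uN (inj₂ m) with edge-on-path m
  ... | t , tN , e1 , e2 with t ℕₚ.≟ N
  ...   | yes refl = trans e1 (proj₁ path-end)
  ...   | no tne = ⊥-elim (ℕₚ.<⇒≱ (subst (cH t <_) cHNm (s≤s (proj₂ (path-mono tNm)))) (ℕₚ.≤-reflexive e2))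
    where
    cHNm : suc (cH N-1) ≡ N
    cHNm with step-at N-1
    ... | inj₁ (e , _ , _) = ⊥-elim (false≢true (trans (sym uN) e))
    ... | inj₂ (_ , _ , e2) = trans (sym e2) cH-last
    tNm : t ≤ N-1
    tNm = ℕₚ.≤-pred (subst (t <_) (sym suc[N-1]≡N) (ℕₚ.≤∧≢⇒< tN tne))

  raise-raise⇒oneNeighbour : ∀ q → suc (suc q) ≤ N → cL (suc q) ≡ suc (cL q) → cL (suc (suc q)) ≡ suc (cL (suc q)) →
    ∀ {y} → Adjℕ (cL (suc q)) y → y ≡ cH (suc q)
  raise-raise⇒oneNeighbour q sqN a1 a2 (inj₂ m) = ⊥-elim (ℕₚ.<⇒≱ (subst (cL (suc q) <_) (sym a2) ℕₚ.≤-refl) (ℕₚ.≤-trans (path-lo≤p (suc (suc q)) sqN) (proj₂ (straddle m))))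
  raise-raise⇒oneNeighbour q sqN a1 a2 (inj₁ m) with edge-on-path m
  ... | t , tN , e1 , e2 = trans e2 (cong cH tq)
    where
    tq : t ≡ suc q
    tq = pin-rank (λ tle → ℕₚ.<⇒≱ (subst (cL q <_) (sym a1) ℕₚ.≤-refl) (ℕₚ.≤-trans (ℕₚ.≤-reflexive e1) (proj₁ (path-mono tle))))
             (λ tge → ℕₚ.<⇒≱ (subst (cL (suc q) <_) (sym a2) ℕₚ.≤-refl) (ℕₚ.≤-trans (proj₁ (path-mono tge)) (ℕₚ.≤-reflexive (sym e1))))

  up-up⇒oneNeighbour : ∀ q → suc q ≤ N → cH (suc q) ≡ suc (cH q) → cH (suc (suc q)) ≡ suc (cH (suc q)) →
    ∀ {y} → Adjℕ (cH (suc q)) y → y ≡ cL (suc q)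
  up-up⇒oneNeighbour q rN b1 b2 (inj₁ m) = ⊥-elim (ℕₚ.<⇒≱ (subst (cH q <_) (sym b1) ℕₚ.≤-refl) (ℕₚ.≤-trans (proj₁ (straddle m)) (path-p≤hi q (ℕₚ.≤-trans (ℕₚ.n≤1+n q) rN))))
  up-up⇒oneNeighbour q rN b1 b2 (inj₂ m) with edge-on-path m
  ... | t , tN , e1 , e2 = trans e1 (cong cL tq)
    where
    tq : t ≡ suc q
    tq = pin-rank (λ tle → ℕₚ.<⇒≱ (subst (cH q <_) (sym b1) ℕₚ.≤-refl) (ℕₚ.≤-trans (ℕₚ.≤-reflexive e2) (proj₂ (path-mono tle))))
             (λ tge → ℕₚ.<⇒≱ (subst (cH (suc q) <_) (sym b2) ℕₚ.≤-refl) (ℕₚ.≤-trans (proj₂ (path-mono tge)) (ℕₚ.≤-reflexive (sym e2))))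

  twoNeighbours⇒bend : ∀ r → r ≤ N → TwoNeighbours (cL r) → TwoNeighbours (cH r) → Bend r
  twoNeighbours⇒bend zero rN d1 d2 with raisesLo 0 Boolₚ.≟ false
  ... | yes e = inj₁ (refl , e)
  ... | no ne = ⊥-elim (oneNeighbour⇒¬two (first-raise⇒oneNeighbour (Boolₚ.¬-not ne)) d1)
  twoNeighbours⇒bend (suc q) rN d1 d2 with suc q ℕₚ.≟ N
  ... | yes eN with raisesLo N-1 Boolₚ.≟ true
  ...   | yes e = inj₂ (inj₁ (eN , e))
  ...   | no ne = ⊥-elim (oneNeighbour⇒¬two (last-up⇒oneNeighbour (Boolₚ.¬-not ne)) (subst TwoNeighbours (trans (cong cH eN) (proj₂ path-end)) d2))
  twoNeighbours⇒bend (suc q) rN d1 d2 | no neN with raisesLo q Boolₚ.≟ raisesLo (suc q)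
  ... | no ne = inj₂ (inj₂ (q , refl , ℕₚ.≤∧≢⇒< rN neN , ne))
  ... | yes eq with step-at q | step-at (suc q)
  ...   | inj₁ (r1 , _ , _) | inj₂ (r2 , _ , _) = ⊥-elim (false≢true (trans (sym r2) (trans (sym eq) r1)))
  ...   | inj₂ (r1 , _ , _) | inj₁ (r2 , _ , _) = ⊥-elim (false≢true (trans (sym r1) (trans eq r2)))
  ...   | inj₁ (_ , a1 , _) | inj₁ (_ , a2 , _) = ⊥-elim (oneNeighbour⇒¬two (raise-raise⇒oneNeighbour q (ℕₚ.≤∧≢⇒< rN neN) a1 a2) d1)
  ...   | inj₂ (_ , _ , b1) | inj₂ (_ , _ , b2) = ⊥-elim (oneNeighbour⇒¬two (up-up⇒oneNeighbour q rN b1 b2) d2)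

  up-at-p⇒bend : ∀ u → u < N → cH u ≡ p → raisesLo u ≡ false → Σ ℕ λ r → r ≤ N × Bend r × p ≡ cH r
  up-at-p⇒bend zero uN hu bu = 0 , z≤n , inj₁ (refl , bu) , sym hu
  up-at-p⇒bend (suc q) uN hu bu with step-at q
  ... | inj₁ (r1 , _ , _) = suc q , ℕₚ.<⇒≤ uN , inj₂ (inj₂ (q , refl , uN , λ e → false≢true (trans (sym bu) (trans (sym e) r1)))) , sym hu
  ... | inj₂ (_ , _ , b1) = ⊥-elim (ℕₚ.<⇒≱ (s≤s (path-p≤hi q (ℕₚ.≤-trans (ℕₚ.n≤1+n q) (ℕₚ.<⇒≤ uN)))) (ℕₚ.≤-reflexive (trans (sym b1) hu)))

  bend-at-pivot : Σ ℕ λ r → r ≤ N × Bend r × p ≡ cH r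
  bend-at-pivot with greatestBelow (λ u → cH u ℕₚ.≟ p) (suc N)
  ... | inj₂ h = ⊥-elim (h 0 (s≤s z≤n) refl)
  ... | inj₁ (u , u<sN , hu , gmax) = up-at-p⇒bend u uN hu bu
    where
    uN : u < N
    uN = ℕₚ.≤∧≢⇒< (ℕₚ.≤-pred u<sN) (λ e → ℕₚ.<-irrefl (sym (trans (sym (proj₂ path-end)) (trans (cong cH (sym e)) hu))) p<N)
    bu : raisesLo u ≡ false
    bu with step-at u
    ... | inj₂ (e , _ , _) = e
    ... | inj₁ (_ , _ , e2) = ⊥-elim (ℕₚ.1+n≰n (gmax (suc u) (s≤s uN) (trans e2 hu)))

  raise-after-repeated-lo⇒bend : ∀ {x} u → u < N → cL u ≡ x → raisesLo u ≡ true → ∀ t → t < u → cL t ≡ x → Σ ℕ λ r → r ≤ N × Bend r × x ≡ cL r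
  raise-after-repeated-lo⇒bend (suc q) uN hu bu t tu ht with step-at q
  ... | inj₂ (r1 , _ , _) = suc q , ℕₚ.<⇒≤ uN , inj₂ (inj₂ (q , refl , uN , λ e → false≢true (trans (sym r1) (trans e bu)))) , sym hu
  ... | inj₁ (_ , a1 , _) = ⊥-elim (ℕₚ.1+n≰n (subst (_≤ cL q) (trans (sym hu) a1) (subst (_≤ cL q) ht (proj₁ (path-mono (ℕₚ.≤-pred tu))))))

  repeated-lo⇒bend : ∀ {x t1 t2} → x < p → t1 ≤ N → t2 ≤ N → t1 ≢ t2 → cL t1 ≡ x → cL t2 ≡ x → Σ ℕ λ r → r ≤ N × Bend r × x ≡ cL r
  repeated-lo⇒bend {x} {t1} {t2} xp t1N t2N ne h1 h2 with greatestBelow (λ u → cL u ℕₚ.≟ x) (suc N)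
  ... | inj₂ h = ⊥-elim (h t1 (s≤s t1N) h1)
  ... | inj₁ (u , u<sN , hu , gmax) = raise-after-repeated-lo⇒bend u uN hu bu (proj₁ earlier) (proj₁ (proj₂ earlier)) (proj₂ (proj₂ earlier))
    where
    uN : u < N
    uN = ℕₚ.≤∧≢⇒< (ℕₚ.≤-pred u<sN) (λ e → ℕₚ.<-irrefl (trans (sym hu) (trans (cong cL e) (proj₁ path-end))) xp)
    bu : raisesLo u ≡ true
    bu with step-at u
    ... | inj₁ (e , _ , _) = e
    ... | inj₂ (_ , e1 , _) = ⊥-elim (ℕₚ.1+n≰n (gmax (suc u) (s≤s uN) (trans e1 hu)))
    earlier : Σ ℕ λ t → t < u × cL t ≡ x
    earlier with t1 ℕₚ.≟ u
    ... | yes refl = t2 , ℕₚ.≤∧≢⇒< (gmax t2 (s≤s t2N) h2) (λ e → ne (sym e)) , h2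
    ... | no t1u = t1 , ℕₚ.≤∧≢⇒< (gmax t1 (s≤s t1N) h1) t1u , h1

  first-repeated-hi⇒bend : ∀ {x} u → cH u ≡ x → p < x → (∀ y → cH y ≡ x → u ≤ y) → ∀ t → t ≤ N → u < t → cH t ≡ x → Σ ℕ λ r → r ≤ N × Bend r × x ≡ cH r
  first-repeated-hi⇒bend zero hu px gmin t tN ut ht = ⊥-elim (ℕₚ.<-irrefl hu px)
  first-repeated-hi⇒bend (suc q) hu px gmin t tN ut ht with step-at q | step-at (suc q)
  ... | inj₁ (_ , _ , b1) | _ = ⊥-elim (ℕₚ.1+n≰n (gmin q (trans (sym b1) hu)))
  ... | inj₂ (r1 , _ , _) | inj₂ (_ , _ , b2) = ⊥-elim (ℕₚ.1+n≰n (subst₂ _≤_ (trans b2 (cong suc hu)) ht (proj₂ (path-mono ut))))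
  ... | inj₂ (r1 , _ , _) | inj₁ (r2 , _ , _) = suc q , ℕₚ.≤-trans (ℕₚ.<⇒≤ ut) tN , inj₂ (inj₂ (q , refl , ℕₚ.<-≤-trans ut tN , λ e → false≢true (trans (sym r1) (trans e r2)))) , sym hu

  repeated-hi⇒bend : ∀ {x t1 t2} → p < x → t1 ≤ N → t2 ≤ N → t1 ≢ t2 → cH t1 ≡ x → cH t2 ≡ x → Σ ℕ λ r → r ≤ N × Bend r × x ≡ cH r
  repeated-hi⇒bend {x} {t1} {t2} px t1N t2N ne h1 h2 with leastBelow (λ u → cH u ℕₚ.≟ x) (suc N)
  ... | inj₂ h = ⊥-elim (h t1 (s≤s t1N) h1)
  ... | inj₁ (u , u<sN , hu , gmin) with t1 ℕₚ.≟ u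
  ...   | yes refl = first-repeated-hi⇒bend u hu px gmin t2 t2N (ℕₚ.≤∧≢⇒< (gmin t2 h2) ne) h2
  ...   | no t1u = first-repeated-hi⇒bend u hu px gmin t1 t1N (ℕₚ.≤∧≢⇒< (gmin t1 h1) (λ e → t1u (sym e))) h1

  twoNeighbours⇒bend-at : ∀ x → TwoNeighbours x → Σ ℕ λ r → r ≤ N × Bend r × (x ≡ cL r ⊎ x ≡ cH r)
  twoNeighbours⇒bend-at x (y , z , ne , ny , nz) with ℕₚ.<-cmp x p
  ... | tri≈ _ refl _ = let (r , rN , b , e) = bend-at-pivot in r , rN , b , inj₂ e
  ... | tri< xp _ _ = let (r , rN , b , e) = repeated-endpoint ny nz in r , rN , b , inj₁ e
    where
    edge-at-x : ∀ {w} → Adjℕ x w → Σ ℕ λ t → t ≤ N × cL t ≡ x × cH t ≡ w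
    edge-at-x (inj₂ m) = ⊥-elim (ℕₚ.<⇒≱ xp (proj₂ (straddle m)))
    edge-at-x (inj₁ m) = let (t , tN , e1 , e2) = edge-on-path m in t , tN , sym e1 , sym e2
    repeated-endpoint : Adjℕ x y → Adjℕ x z → Σ ℕ λ r → r ≤ N × Bend r × x ≡ cL r
    repeated-endpoint ny nz = let (t1 , t1N , a1 , b1) = edge-at-x ny ; (t2 , t2N , a2 , b2) = edge-at-x nz in
      repeated-lo⇒bend xp t1N t2N (λ e → ne (trans (sym b1) (trans (cong cH e) b2))) a1 a2
  ... | tri> _ _ px = let (r , rN , b , e) = repeated-endpoint ny nz in r , rN , b , inj₂ e
    where
    edge-at-x : ∀ {w} → Adjℕ x w → Σ ℕ λ t → t ≤ N × cH t ≡ x × cL t ≡ w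
    edge-at-x (inj₁ m) = ⊥-elim (ℕₚ.<⇒≱ px (proj₁ (straddle m)))
    edge-at-x (inj₂ m) = let (t , tN , e1 , e2) = edge-on-path m in t , tN , sym e2 , sym e1
    repeated-endpoint : Adjℕ x y → Adjℕ x z → Σ ℕ λ r → r ≤ N × Bend r × x ≡ cH r
    repeated-endpoint ny nz = let (t1 , t1N , a1 , b1) = edge-at-x ny ; (t2 , t2N , a2 , b2) = edge-at-x nz in
      repeated-hi⇒bend px t1N t2N (λ e → ne (trans (sym b1) (trans (cong cL e) b2))) a1 a2

  ¬bend⇒straight : ∀ q → suc q < N → ¬ Bend (suc q) → raisesLo q ≡ raisesLo (suc q)
  ¬bend⇒straight q lt nb with raisesLo q Boolₚ.≟ raisesLo (suc q)
  ... | yes e = e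
  ... | no ne = ⊥-elim (nb (inj₂ (inj₂ (q , refl , lt , ne))))

  straight-run : ∀ r k → suc (k + r) ≤ N → (∀ t → r < t → t < suc (k + r) → ¬ Bend t) →
    (raisesLo r ≡ true × cH (suc (k + r)) ≡ cH r × raisesLo (k + r) ≡ true) ⊎ (raisesLo r ≡ false × cL (suc (k + r)) ≡ cL r × raisesLo (k + r) ≡ false)
  straight-run r zero _ _ with step-at r
  ... | inj₁ (e , _ , e2) = inj₁ (e , e2 , e)
  ... | inj₂ (e , e1 , _) = inj₂ (e , e1 , e)
  straight-run r (suc k) lt nb with straight-run r k (ℕₚ.<⇒≤ lt) (λ t rt tk → nb t rt (ℕₚ.m≤n⇒m≤1+n tk))
                             | ¬bend⇒straight (k + r) lt (nb (suc (k + r)) (s≤s (ℕₚ.m≤n+m r k)) ℕₚ.≤-refl)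
                             | step-at (suc (k + r))
  ... | inj₁ (e , h , eb) | eq | inj₁ (_ , _ , e2) = inj₁ (e , trans e2 h , trans (sym eq) eb)
  ... | inj₁ (e , h , eb) | eq | inj₂ (e' , _ , _) = ⊥-elim (false≢true (trans (sym e') (trans (sym eq) eb)))
  ... | inj₂ (e , h , eb) | eq | inj₂ (_ , e1 , _) = inj₂ (e , trans e1 h , trans (sym eq) eb)
  ... | inj₂ (e , h , eb) | eq | inj₁ (e' , _ , _) = ⊥-elim (false≢true (trans (sym eb) (trans eq e')))

  ShareEndpoint : ℕ → ℕ → Set
  ShareEndpoint r r' = cL r ≡ cL r' ⊎ cH r ≡ cH r'

  noBendBetween⇒shareEndpoint : ∀ r r' → r < r' → r' ≤ N → (∀ t → r < t → t < r' → ¬ Bend t) → ShareEndpoint r r'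
  noBendBetween⇒shareEndpoint r r' lt r'N nb = subst (ShareEndpoint r) eq (go (straight-run r k (subst (_≤ N) (sym eq) r'N) (λ t a b → nb t a (subst (t <_) eq b))))
    where
    k : ℕ
    k = r' ∸ suc r
    eq : suc (k + r) ≡ r'
    eq = trans (sym (ℕₚ.+-suc k r)) (ℕₚ.m∸n+n≡m lt)
    go : (raisesLo r ≡ true × cH (suc (k + r)) ≡ cH r × raisesLo (k + r) ≡ true) ⊎ (raisesLo r ≡ false × cL (suc (k + r)) ≡ cL r × raisesLo (k + r) ≡ false) →
         ShareEndpoint r (suc (k + r))
    go (inj₁ (_ , h , _)) = inj₂ (sym h)
    go (inj₂ (_ , h , _)) = inj₁ (sym h)

  bend? : ∀ r → Dec (Bend r)
  bend? r = ((r ℕₚ.≟ 0) Decidable.×-dec (raisesLo 0 Boolₚ.≟ false)) Decidable.⊎-dec ((r ℕₚ.≟ N) Decidable.×-dec (raisesLo N-1 Boolₚ.≟ true)) Decidable.⊎-dec (third r)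
    where
    third : ∀ r → Dec (Σ ℕ λ q → r ≡ suc q × suc q < N × raisesLo q ≢ raisesLo (suc q))
    third zero = no (λ { (q , () , _) })
    third (suc q) with (suc q ℕ.<? N) Decidable.×-dec (Decidable.¬? (raisesLo q Boolₚ.≟ raisesLo (suc q)))
    ... | yes (a , b) = yes (q , refl , a , b)
    ... | no h = no (λ { (q' , refl , a , b) → h (a , b) })

  -- Consecutive bends share an endpoint, so a property carried across shared endpoints reaches
  -- every bend from one of them.
  module BendInduction (CE : ℕ → Set)
              (clos : ∀ {r r'} → r ≤ N → r' ≤ N → Bend r' → CE r → ShareEndpoint r r' → CE r')
              (r0 : ℕ) (r0N : r0 ≤ N) (b0 : Bend r0) (ce0 : CE r0) where

    BendFrom : ℕ → ℕ → Set
    BendFrom lb u = Bend u × lb ≤ u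
    bendFrom? : ∀ lb u → Dec (BendFrom lb u)
    bendFrom? lb u = bend? u Decidable.×-dec (lb ℕ.≤? u)
    BendAfter : ℕ → ℕ → Set
    BendAfter lb u = Bend u × lb < u
    bendAfter? : ∀ lb u → Dec (BendAfter lb u)
    bendAfter? lb u = bend? u Decidable.×-dec (lb ℕ.<? u)

    shareEndpoint-sym : ∀ {r r'} → ShareEndpoint r r' → ShareEndpoint r' r
    shareEndpoint-sym (inj₁ e) = inj₁ (sym e)
    shareEndpoint-sym (inj₂ e) = inj₂ (sym e)

    up : ∀ k j → j ≤ k → j + r0 ≤ N → Bend (j + r0) → CE (j + r0)
    up zero zero _ _ _ = ce0
    up (suc k) j jk jN bj with j ℕₚ.≤? k
    ... | yes jk' = up k j jk' jN bj
    ... | no njk with ℕₚ.≤-antisym jk (ℕₚ.≰⇒> njk)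
    ...   | refl with greatestBelow (bendFrom? r0) (suc k + r0)
    ...     | inj₂ h = ⊥-elim (h r0 (s≤s (ℕₚ.m≤n+m r0 k)) (b0 , ℕₚ.≤-refl))
    ...     | inj₁ (u , ub , (bu , r0u) , gmax) = clos uN jN bj ceu sh
      where
      uN : u ≤ N
      uN = ℕₚ.≤-trans (ℕₚ.<⇒≤ ub) jN
      eu : (u ∸ r0) + r0 ≡ u
      eu = ℕₚ.m∸n+n≡m r0u
      ceu : CE u
      ceu = subst CE eu (up k (u ∸ r0) (ℕₚ.≤-pred (ℕₚ.+-cancelʳ-< r0 (u ∸ r0) (suc k) (subst (_< suc k + r0) (sym eu) ub)))
                (subst (_≤ N) (sym eu) uN) (subst Bend (sym eu) bu))
      sh : ShareEndpoint u (suc k + r0)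
      sh = noBendBetween⇒shareEndpoint u (suc k + r0) ub jN (λ t ut tb bt → ℕₚ.<⇒≱ ut (gmax t tb (bt , ℕₚ.≤-trans r0u (ℕₚ.<⇒≤ ut))))

    down : ∀ k r → r ≤ r0 → r0 ≤ k + r → Bend r → CE r
    down zero r rr0 r0r br = subst CE (ℕₚ.≤-antisym r0r rr0) ce0
    down (suc k) r rr0 r0r br with r0 ℕₚ.≤? k + r
    ... | yes le = down k r rr0 le br
    ... | no nle with leastBelow (bendAfter? r) (suc r0)
    ...   | inj₂ h = ⊥-elim (h r0 ℕₚ.≤-refl (b0 , ℕₚ.<-≤-trans (s≤s (ℕₚ.m≤n+m r k)) (ℕₚ.≰⇒> nle)))
    ...   | inj₁ (u , u<sr0 , (bu , ru) , gmin) = clos uN rN br ceu (shareEndpoint-sym {r} {u} sh)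
      where
      uN : u ≤ N
      uN = ℕₚ.≤-trans (ℕₚ.≤-pred u<sr0) r0N
      rN : r ≤ N
      rN = ℕₚ.≤-trans rr0 r0N
      ceu : CE u
      ceu = down k u (ℕₚ.≤-pred u<sr0) (ℕₚ.≤-trans r0r (ℕₚ.≤-trans (ℕₚ.≤-reflexive (sym (ℕₚ.+-suc k r))) (ℕₚ.+-monoʳ-≤ k ru))) bu
      sh : ShareEndpoint r u
      sh = noBendBetween⇒shareEndpoint r u ru uN (λ t rt tu bt → ℕₚ.<⇒≱ tu (gmin t (bt , rt)))

    all-bends : ∀ r → r ≤ N → Bend r → CE r
    all-bends r rN br with r0 ℕₚ.≤? r
    ... | yes r0r = subst CE (ℕₚ.m∸n+n≡m r0r) (up (r ∸ r0) (r ∸ r0) ℕₚ.≤-refl (subst (_≤ N) (sym (ℕₚ.m∸n+n≡m r0r)) rN) (subst Bend (sym (ℕₚ.m∸n+n≡m r0r)) br))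
    ... | no nr0r = down r0 r (ℕₚ.<⇒≤ (ℕₚ.≰⇒> nr0r)) (ℕₚ.m≤m+n r0 r) br

module ExceptionalShapes (N : ℕ) (N≥2 : 2 ≤ N) (s : VSet (suc N)) (mt : MaxThrackle s) (pv : Pivot s) where
  open MaxThrackle mt
  open Pivot pv
  open Path N N≥2 s mt pv
  open Flips N N≥2 s mt pv
  open Bends N N≥2 s mt pv

  record ExceptionalShape (r : ℕ) : Set where
    field
      x y z : ℕ
      ex : x ≡ cL r
      ey : y ≡ cH r
      nxz : Adjℕ x z
      nyz : Adjℕ y z
      xy≢ : x ≢ y
      xz≢ : x ≢ z
      yz≢ : y ≢ z
      nx : ∀ {u} → Adjℕ x u → u ≡ y ⊎ u ≡ z
      ny : ∀ {u} → Adjℕ y u → u ≡ x ⊎ u ≡ z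
      leaf : ∀ {t} → t ≢ x → t ≢ y → t ≢ z → ¬ TwoNeighbours t

  exceptional-shape-first : raisesLo 0 ≡ false → suc p ≡ N → ExceptionalShape 0
  exceptional-shape-first b0 e = record
    { x = 0 ; y = p ; z = N ; ex = refl ; ey = refl
    ; nxz = inj₁ (subst₂ (HasEdge s) c1L (trans (up-first⇒cH1 b0) e) (path-edge 1 (ℕₚ.≤-trans (s≤s z≤n) N≥2)))
    ; nyz = inj₁ edge-pN
    ; xy≢ = λ eq → ℕₚ.<-irrefl eq p≥1
    ; xz≢ = λ eq → N≢0 (sym eq)
    ; yz≢ = λ eq → ℕₚ.<-irrefl eq p<N
    ; nx = x-neighbours ; ny = y-neighbours ; leaf = off-triangle-leaf }
    where
    c1L : cL 1 ≡ 0
    c1L with step-at 0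
    ... | inj₁ (e' , _ , _) = ⊥-elim (false≢true (trans (sym b0) e'))
    ... | inj₂ (_ , e1 , _) = e1
    cH≥ : ∀ t → 1 ≤ t → N ≤ cH t
    cH≥ t t1 = subst (_≤ cH t) (trans (up-first⇒cH1 b0) e) (cH-mono t1)
    x-neighbours : ∀ {u} → Adjℕ 0 u → u ≡ p ⊎ u ≡ N
    x-neighbours (inj₂ m) = ⊥-elim (ℕₚ.<⇒≱ (hasEdge-< s wf m) z≤n)
    x-neighbours (inj₁ m) = Sum.map (λ z → z) (λ z → trans z e) (≤≤suc⇒≡⊎≡suc (proj₂ (straddle m)) (subst (_ ≤_) (sym e) (hasEdge-hi≤N s m)))
    y-neighbours : ∀ {u} → Adjℕ p u → u ≡ 0 ⊎ u ≡ N
    y-neighbours (inj₁ m) = inj₂ (ℕₚ.≤-antisym (hasEdge-hi≤N s m) (subst (_≤ _) e (hasEdge-< s wf m)))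
    y-neighbours (inj₂ m) with edge-on-path m
    ... | zero , _ , e1 , _ = inj₁ e1
    ... | suc t , tN , _ , e2 = ⊥-elim (ℕₚ.<⇒≱ p<N (ℕₚ.≤-trans (cH≥ (suc t) (s≤s z≤n)) (ℕₚ.≤-reflexive (sym e2))))
    off-triangle-leaf : ∀ {t} → t ≢ 0 → t ≢ p → t ≢ N → ¬ TwoNeighbours t
    off-triangle-leaf {t} t0 tp tN = oneNeighbour⇒¬two h
      where
      h : ∀ {u} → Adjℕ t u → u ≡ N
      h (inj₂ m) = ⊥-elim (Sum.[ tp , (λ z → tN (trans z e)) ] (≤≤suc⇒≡⊎≡suc (proj₂ (straddle m)) (subst (_ ≤_) (sym e) (hasEdge-hi≤N s m))))
      h (inj₁ m) with edge-on-path m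
      ... | zero , _ , e1 , _ = ⊥-elim (t0 e1)
      ... | suc t' , tN' , _ , e2 = ℕₚ.≤-antisym (hasEdge-hi≤N s m) (ℕₚ.≤-trans (cH≥ (suc t') (s≤s z≤n)) (ℕₚ.≤-reflexive (sym e2)))

  exceptional-shape-last : raisesLo N-1 ≡ true → p ≡ 1 → ExceptionalShape N
  exceptional-shape-last bN' e = record
    { x = p ; y = N ; z = 0 ; ex = sym (proj₁ path-end) ; ey = sym (proj₂ path-end)
    ; nxz = inj₂ edge-0p
    ; nyz = inj₂ (subst₂ (HasEdge s) cLNm cHNm (path-edge N-1 N-1≤N))
    ; xy≢ = λ eq → ℕₚ.<-irrefl eq p<N
    ; xz≢ = λ eq → ℕₚ.<-irrefl (sym eq) p≥1
    ; yz≢ = N≢0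
    ; nx = x-neighbours ; ny = y-neighbours ; leaf = off-triangle-leaf }
    where
    cLNm : cL N-1 ≡ 0
    cLNm = trans (raise-last⇒cL bN') (cong pred e)
    cHNm : cH N-1 ≡ N
    cHNm with step-at N-1
    ... | inj₁ (_ , _ , e2) = trans (sym e2) cH-last
    ... | inj₂ (e' , _ , _) = ⊥-elim (false≢true (trans (sym e') bN'))
    x-neighbours : ∀ {u} → Adjℕ p u → u ≡ N ⊎ u ≡ 0
    x-neighbours (inj₂ m) = inj₂ (ℕₚ.n<1⇒n≡0 (subst (_ <_) e (hasEdge-< s wf m)))
    x-neighbours (inj₁ m) with edge-on-path m
    ... | t , tN , e1 , e2 with t ℕₚ.≟ N
    ...   | yes refl = inj₁ (trans e2 (proj₂ path-end))
    ...   | no tne = ⊥-elim (ℕₚ.<-irrefl (sym (trans e1 (ℕₚ.n≤0⇒n≡0 (subst (cL t ≤_) cLNm (cL-mono tNm))))) p≥1)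
      where
      tNm : t ≤ N-1
      tNm = ℕₚ.≤-pred (subst (t <_) (sym suc[N-1]≡N) (ℕₚ.≤∧≢⇒< tN tne))
    y-neighbours : ∀ {u} → Adjℕ N u → u ≡ p ⊎ u ≡ 0
    y-neighbours (inj₁ m) = ⊥-elim (ℕₚ.<⇒≱ (hasEdge-< s wf m) (hasEdge-hi≤N s m))
    y-neighbours (inj₂ m) = Sum.swap (Sum.map (λ z → z) (λ z → trans z (sym e)) (≤≤suc⇒≡⊎≡suc z≤n (subst (_ ≤_) e (proj₁ (straddle m)))))
    off-triangle-leaf : ∀ {t} → t ≢ p → t ≢ N → t ≢ 0 → ¬ TwoNeighbours t
    off-triangle-leaf {t} tp tN t0 = oneNeighbour⇒¬two h
      where
      h : ∀ {u} → Adjℕ t u → u ≡ 0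
      h (inj₁ m) = ⊥-elim (Sum.[ t0 , (λ z → tp (trans z (sym e))) ] (≤≤suc⇒≡⊎≡suc z≤n (subst (_ ≤_) e (proj₁ (straddle m)))))
      h (inj₂ m) with edge-on-path m
      ... | t' , tN' , e1 , e2 with t' ℕₚ.≟ N
      ...   | yes refl = ⊥-elim (tN (trans e2 (proj₂ path-end)))
      ...   | no tne = trans e1 (ℕₚ.n≤0⇒n≡0 (subst (cL t' ≤_) cLNm (cL-mono tNm)))
        where
        tNm : t' ≤ N-1
        tNm = ℕₚ.≤-pred (subst (t' <_) (sym suc[N-1]≡N) (ℕₚ.≤∧≢⇒< tN' tne))

  module InnerExceptional (q : ℕ) (lt : suc q < N) (e : suc (cL q) ≡ cH q)
    (a1 : cL (suc q) ≡ cL q) (b1 : cH (suc q) ≡ suc (cH q))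
    (a2 : cL (suc (suc q)) ≡ suc (cL (suc q))) (b2 : cH (suc (suc q)) ≡ cH (suc q)) where

    a : ℕ
    a = cL q
    qN : q ≤ N
    qN = ℕₚ.≤-trans (ℕₚ.n≤1+n q) (ℕₚ.<⇒≤ lt)
    yb : cH (suc q) ≡ suc (suc a)
    yb = trans b1 (cong suc (sym e))
    c2L : cL (suc (suc q)) ≡ suc a
    c2L = trans a2 (cong suc a1)
    pe : p ≡ suc a
    pe = ℕₚ.≤-antisym (subst (p ≤_) (sym e) (path-p≤hi q qN)) (subst (_≤ p) c2L (path-lo≤p (suc (suc q)) lt))

    a-neighbours : ∀ {u} → Adjℕ a u → u ≡ suc (suc a) ⊎ u ≡ suc a
    a-neighbours (inj₂ m) = ⊥-elim (ℕₚ.1+n≰n (subst (_≤ a) pe (proj₂ (straddle m))))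
    a-neighbours {u} (inj₁ m) with edge-on-path m
    ... | t , tN , e1 , e2 with trichotomy-suc t q
    ...   | inj₁ tq = inj₂ (ℕₚ.≤-antisym (ℕₚ.≤-trans (ℕₚ.≤-reflexive e2) (subst (cH t ≤_) (sym e) (cH-mono tq))) (subst (_≤ u) pe (proj₂ (straddle m))))
    ...   | inj₂ (inj₁ refl) = inj₁ (trans e2 yb)
    ...   | inj₂ (inj₂ tq) = ⊥-elim (ℕₚ.1+n≰n (subst (suc a ≤_) (sym e1) (subst (_≤ cL t) c2L (cL-mono tq))))

    a+2-neighbours : ∀ {u} → Adjℕ (suc (suc a)) u → u ≡ a ⊎ u ≡ suc a
    a+2-neighbours (inj₁ m) = ⊥-elim (ℕₚ.1+n≰n (subst (suc (suc a) ≤_) pe (proj₁ (straddle m))))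
    a+2-neighbours (inj₂ m) with edge-on-path m
    ... | t , tN , e1 , e2 with trichotomy-suc t q
    ...   | inj₁ tq = ⊥-elim (ℕₚ.1+n≰n (subst (_≤ suc a) (sym e2) (subst (cH t ≤_) (sym e) (cH-mono tq))))
    ...   | inj₂ (inj₁ refl) = inj₁ (trans e1 a1)
    ...   | inj₂ (inj₂ tq) = inj₂ (ℕₚ.≤-antisym (subst (_ ≤_) pe (proj₁ (straddle m))) (ℕₚ.≤-trans (ℕₚ.≤-reflexive (sym c2L)) (ℕₚ.≤-trans (cL-mono tq) (ℕₚ.≤-reflexive (sym e1)))))

    below-a⇒neighbour-p : ∀ {t u} → t ≢ a → t ≢ suc a → HasEdge s t u → u ≡ p
    below-a⇒neighbour-p {t} ta tz m with edge-on-path m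
    ... | t' , tN' , e1 , e2 with ℕₚ.<-cmp t' q
    ...   | tri< t'q _ _ = ℕₚ.≤-antisym (ℕₚ.≤-trans (ℕₚ.≤-reflexive e2) (ℕₚ.≤-trans (cH-mono (ℕₚ.<⇒≤ t'q)) (ℕₚ.≤-reflexive (trans (sym e) (sym pe))))) (proj₂ (straddle m))
    ...   | tri≈ _ refl _ = ⊥-elim (ta e1)
    ...   | tri> _ _ gt = ⊥-elim (ℕₚ.<⇒≱ tlt (ℕₚ.≤-trans (cL-mono (ℕₚ.<⇒≤ gt)) (ℕₚ.≤-reflexive (sym e1))))
      where
      tlt : t < a
      tlt with ℕₚ.m≤n⇒m<n∨m≡n (subst (t ≤_) pe (proj₁ (straddle m)))
      ... | inj₂ eq = ⊥-elim (tz eq)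
      ... | inj₁ (s≤s t≤a) = ℕₚ.≤∧≢⇒< t≤a ta

    above-a+2⇒neighbour-p : ∀ {t u} → t ≢ suc (suc a) → t ≢ suc a → HasEdge s u t → u ≡ p
    above-a+2⇒neighbour-p {t} tb tz m with edge-on-path m
    ... | t' , tN' , e1 , e2 with ℕₚ.<-cmp t' (suc q)
    ...   | tri> _ _ gt = ℕₚ.≤-antisym (ℕₚ.≤-trans (ℕₚ.≤-reflexive e1) (path-lo≤p t' tN')) (ℕₚ.≤-trans (ℕₚ.≤-reflexive pe) (ℕₚ.≤-trans (ℕₚ.≤-reflexive (sym c2L)) (ℕₚ.≤-trans (cL-mono gt) (ℕₚ.≤-reflexive (sym e1)))))
    ...   | tri≈ _ refl _ = ⊥-elim (tb (trans e2 yb))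
    ...   | tri< lt' _ _ = ⊥-elim (ℕₚ.<⇒≱ tgt (ℕₚ.≤-trans (ℕₚ.≤-reflexive e2) (ℕₚ.≤-trans (cH-mono (ℕₚ.<⇒≤ lt')) (ℕₚ.≤-reflexive yb))))
      where
      tgt : suc (suc a) < t
      tgt with ℕₚ.m≤n⇒m<n∨m≡n (subst (_≤ t) pe (proj₂ (straddle m)))
      ... | inj₂ eq = ⊥-elim (tz (sym eq))
      ... | inj₁ lt2 with ℕₚ.m≤n⇒m<n∨m≡n lt2
      ...   | inj₂ eq = ⊥-elim (tb (sym eq))
      ...   | inj₁ lt3 = lt3

    off-triangle-leaf : ∀ {t} → t ≢ a → t ≢ suc (suc a) → t ≢ suc a → ¬ TwoNeighbours t
    off-triangle-leaf ta tb tz = oneNeighbour⇒¬two (Sum.[ below-a⇒neighbour-p ta tz , above-a+2⇒neighbour-p tb tz ])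

    shape : ExceptionalShape (suc q)
    shape = record
      { x = a ; y = suc (suc a) ; z = suc a ; ex = sym a1 ; ey = sym yb
      ; nxz = inj₁ (subst (HasEdge s a) (sym e) (path-edge q qN))
      ; nyz = inj₂ (subst₂ (HasEdge s) c2L (trans b2 yb) (path-edge (suc (suc q)) lt))
      ; xy≢ = λ eq → ℕₚ.<-irrefl eq (ℕₚ.n≤1+n (suc a))
      ; xz≢ = λ eq → ℕₚ.<-irrefl eq ℕₚ.≤-refl
      ; yz≢ = λ eq → ℕₚ.<-irrefl (sym eq) ℕₚ.≤-refl
      ; nx = a-neighbours ; ny = a+2-neighbours ; leaf = off-triangle-leaf }

  exceptional-shape-inner : ∀ q → suc q < N → raisesLo q ≡ false → raisesLo (suc q) ≡ true → suc (cL q) ≡ cH q → ExceptionalShape (suc q)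
  exceptional-shape-inner q lt r1 r2 e with step-at q | step-at (suc q)
  ... | inj₁ (r1' , _ , _) | _ = ⊥-elim (false≢true (trans (sym r1) r1'))
  ... | _ | inj₂ (r2' , _ , _) = ⊥-elim (false≢true (trans (sym r2') r2))
  ... | inj₂ (_ , a1 , b1) | inj₁ (_ , a2 , b2) = InnerExceptional.shape q lt e a1 b1 a2 b2

  exceptional-shape : ∀ r → Exceptional r → ExceptionalShape r
  exceptional-shape r (inj₁ (refl , b0 , e)) = exceptional-shape-first b0 e
  exceptional-shape r (inj₂ (inj₁ (refl , bN' , e))) = exceptional-shape-last bN' e
  exceptional-shape r (inj₂ (inj₂ (q , refl , lt , r1 , r2 , e))) = exceptional-shape-inner q lt r1 r2 e

  TriangleAt : ℕ → ℕ → Set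
  TriangleAt r z = (∀ {u} → Adjℕ (cL r) u → u ≡ cH r ⊎ u ≡ z) × (∀ {u} → Adjℕ (cH r) u → u ≡ cL r ⊎ u ≡ z)

  triangle-at-first⇒exceptional : ∀ {z} → raisesLo 0 ≡ false → TriangleAt 0 z → Exceptional 0
  triangle-at-first⇒exceptional {z} b0 (nx , ny)
    with nx (inj₁ (subst₂ (HasEdge s) c1L (up-first⇒cH1 b0) (path-edge 1 (ℕₚ.≤-trans (s≤s z≤n) N≥2)))) | ny (inj₁ edge-pN)
    where
    c1L : cL 1 ≡ 0
    c1L with step-at 0
    ... | inj₁ (e' , _ , _) = ⊥-elim (false≢true (trans (sym b0) e'))
    ... | inj₂ (_ , e1 , _) = e1
  ... | inj₁ e1 | _ = ⊥-elim (ℕₚ.1+n≢n e1)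
  ... | inj₂ _ | inj₁ e2 = ⊥-elim (N≢0 e2)
  ... | inj₂ e1 | inj₂ e2 = inj₁ (refl , b0 , trans e1 (sym e2))

  triangle-at-last⇒exceptional : ∀ {z} → raisesLo N-1 ≡ true → TriangleAt N z → Exceptional N
  triangle-at-last⇒exceptional {z} bN' (nx , ny) with ny (inj₂ (subst₂ (HasEdge s) refl (trans cHNm (sym (proj₂ path-end))) (path-edge N-1 N-1≤N)))
    where
    cHNm : cH N-1 ≡ N
    cHNm with step-at N-1
    ... | inj₁ (_ , _ , e2) = trans (sym e2) cH-last
    ... | inj₂ (e' , _ , _) = ⊥-elim (false≢true (trans (sym e') bN'))
  ... | inj₁ e1 = ⊥-elim (ℕₚ.<-irrefl (trans (sym (raise-last⇒cL bN')) (trans e1 (proj₁ path-end))) (pred< p≥1))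
  ... | inj₂ e1 with nx (inj₂ (subst (HasEdge s 0) (sym (proj₁ path-end)) edge-0p))
  ...   | inj₁ e2 = ⊥-elim (N≢0 (sym (trans e2 (proj₂ path-end))))
  ...   | inj₂ e2 = inj₂ (inj₁ (refl , bN' , p1))
    where
    pp : pred p ≡ 0
    pp = trans (sym (raise-last⇒cL bN')) (trans e1 (sym e2))
    p1 : p ≡ 1
    p1 with p | p≥1 | pp
    ... | suc zero | _ | _ = refl

  triangle-at-inner⇒exceptional : ∀ {z} q → suc q < N → raisesLo q ≢ raisesLo (suc q) → TriangleAt (suc q) z → Exceptional (suc q)
  triangle-at-inner⇒exceptional {z} q lt ne (nx , ny) with step-at q | step-at (suc q)
  ... | inj₁ (r1 , _ , _) | inj₁ (r2 , _ , _) = ⊥-elim (ne (trans r1 (sym r2)))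
  ... | inj₂ (r1 , _ , _) | inj₂ (r2 , _ , _) = ⊥-elim (ne (trans r1 (sym r2)))
  ... | inj₁ (r1 , a1 , b1) | inj₂ (r2 , a2 , b2)
    with nx (inj₁ (subst (λ w → HasEdge s w (cH (suc (suc q)))) a2 (path-edge (suc (suc q)) lt)))
       | ny (inj₂ (subst (HasEdge s (cL q)) (sym b1) (path-edge q qN)))
    where
    qN : q ≤ N
    qN = ℕₚ.≤-trans (ℕₚ.n≤1+n q) (ℕₚ.<⇒≤ lt)
  ...   | inj₁ e1 | _ = ⊥-elim (ℕₚ.1+n≢n (trans (sym b2) e1))
  ...   | inj₂ _ | inj₁ e2 = ⊥-elim (ℕₚ.1+n≢n (trans (sym a1) (sym e2)))
  ...   | inj₂ e1 | inj₂ e2 = ⊥-elim (ℕₚ.<-irrefl refl z<z)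
    where
    z<z : z < z
    z<z = subst₂ _<_ e2 e1 (ℕₚ.<-trans (subst (cL q <_) (sym a1) ℕₚ.≤-refl)
            (ℕₚ.<-trans (path-lo<hi (suc q) (ℕₚ.<⇒≤ lt)) (subst (cH (suc q) <_) (sym b2) ℕₚ.≤-refl)))
  triangle-at-inner⇒exceptional {z} q lt ne (nx , ny) | inj₂ (r1 , a1 , b1) | inj₁ (r2 , a2 , b2)
    with nx (inj₁ (subst (λ w → HasEdge s w (cH q)) (sym a1) (path-edge q qN)))
       | ny (inj₂ (subst (HasEdge s (cL (suc (suc q)))) b2 (path-edge (suc (suc q)) lt)))
    where
    qN : q ≤ N
    qN = ℕₚ.≤-trans (ℕₚ.n≤1+n q) (ℕₚ.<⇒≤ lt)
  ...   | inj₁ e1 | _ = ⊥-elim (ℕₚ.1+n≢n (trans (sym b1) (sym e1)))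
  ...   | inj₂ _ | inj₁ e2 = ⊥-elim (ℕₚ.1+n≢n (trans (sym a2) e2))
  ...   | inj₂ e1 | inj₂ e2 = inj₂ (inj₂ (q , refl , lt , r1 , r2 , trans (cong suc (sym a1)) (trans (sym a2) (trans e2 (sym e1)))))

  triangle-at-bend⇒exceptional : ∀ r → Bend r → ∀ {z} → TriangleAt r z → Exceptional r
  triangle-at-bend⇒exceptional r (inj₁ (refl , b0)) = triangle-at-first⇒exceptional b0
  triangle-at-bend⇒exceptional r (inj₂ (inj₁ (refl , bN'))) = triangle-at-last⇒exceptional bN'
  triangle-at-bend⇒exceptional r (inj₂ (inj₂ (q , refl , lt , ne))) = triangle-at-inner⇒exceptional q lt ne

  step-twoNeighbours : ∀ k → suc k ≤ N → (TwoNeighbours (cH k) × cH (suc k) ≡ cH k) ⊎ (TwoNeighbours (cL k) × cL (suc k) ≡ cL k)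
  step-twoNeighbours k kN with step-at k
  ... | inj₁ (_ , a1 , b1) = inj₁ ((cL k , cL (suc k) , (λ e → ℕₚ.1+n≢n (trans (sym a1) (sym e))) ,
          inj₂ (path-edge k (ℕₚ.≤-trans (ℕₚ.n≤1+n k) kN)) , inj₂ (subst (HasEdge s (cL (suc k))) b1 (path-edge (suc k) kN))) , b1)
  ... | inj₂ (_ , a1 , b1) = inj₂ ((cH k , cH (suc k) , (λ e → ℕₚ.1+n≢n (trans (sym b1) (sym e))) ,
          inj₁ (path-edge k (ℕₚ.≤-trans (ℕₚ.n≤1+n k) kN)) , inj₁ (subst (λ w → HasEdge s w (cH (suc k))) a1 (path-edge (suc k) kN))) , a1)

  edge-twoNeighbours : ∀ {a b} → HasEdge s a b → TwoNeighbours a ⊎ TwoNeighbours b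
  edge-twoNeighbours m with edge-on-path m
  ... | t , tN , e1 , e2 with t ℕₚ.≟ N
  ...   | no tne = Sum.map (λ x → subst TwoNeighbours (sym e1) (proj₁ x)) (λ x → subst TwoNeighbours (sym e2) (proj₁ x))
                      (Sum.swap (step-twoNeighbours t (ℕₚ.≤∧≢⇒< tN tne)))
  ...   | yes refl with step-twoNeighbours N-1 (ℕₚ.≤-reflexive suc[N-1]≡N)
  ...     | inj₁ (d , eq) = inj₂ (subst TwoNeighbours (trans (sym eq) (trans (cong cH suc[N-1]≡N) (sym e2))) d)
  ...     | inj₂ (d , eq) = inj₁ (subst TwoNeighbours (trans (sym eq) (trans (cong cL suc[N-1]≡N) (sym e1))) d)

  cL-intermediate : ∀ k → k ≤ N → ∀ t → t ≤ cL k → Σ ℕ λ j → j ≤ N × cL j ≡ t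
  cL-intermediate zero _ t tl = 0 , z≤n , sym (ℕₚ.n≤0⇒n≡0 tl)
  cL-intermediate (suc k) kN t tl with t ℕₚ.≤? cL k
  ... | yes le = cL-intermediate k (ℕₚ.≤-trans (ℕₚ.n≤1+n k) kN) t le
  ... | no nle = suc k , kN , ℕₚ.≤-antisym up tl
    where
    up : cL (suc k) ≤ t
    up with step-at k
    ... | inj₁ (_ , a1 , _) = subst (_≤ t) (sym a1) (ℕₚ.≰⇒> nle)
    ... | inj₂ (_ , a1 , _) = subst (_≤ t) (sym a1) (ℕₚ.<⇒≤ (ℕₚ.≰⇒> nle))

  cH-intermediate : ∀ k → k ≤ N → ∀ t → p ≤ t → t ≤ cH k → Σ ℕ λ j → j ≤ N × cH j ≡ t
  cH-intermediate zero _ t pt tl = 0 , z≤n , ℕₚ.≤-antisym pt tl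
  cH-intermediate (suc k) kN t pt tl with t ℕₚ.≤? cH k
  ... | yes le = cH-intermediate k (ℕₚ.≤-trans (ℕₚ.n≤1+n k) kN) t pt le
  ... | no nle = suc k , kN , ℕₚ.≤-antisym up tl
    where
    up : cH (suc k) ≤ t
    up with step-at k
    ... | inj₂ (_ , _ , b1) = subst (_≤ t) (sym b1) (ℕₚ.≰⇒> nle)
    ... | inj₁ (_ , _ , b1) = subst (_≤ t) (sym b1) (ℕₚ.<⇒≤ (ℕₚ.≰⇒> nle))

  every-vertex-adjacent : ∀ t → t ≤ N → Σ ℕ λ w → Adjℕ t w
  every-vertex-adjacent t tN with t ℕₚ.≤? p
  ... | yes tp = let (j , jN , e) = cL-intermediate N ℕₚ.≤-refl t (subst (t ≤_) (sym (proj₁ path-end)) tp) in cH j , inj₁ (subst (λ w → HasEdge s w (cH j)) e (path-edge j jN))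
  ... | no ntp = let (j , jN , e) = cH-intermediate N ℕₚ.≤-refl t (ℕₚ.<⇒≤ (ℕₚ.≰⇒> ntp)) (subst (t ≤_) (sym (proj₂ path-end)) tN) in cL j , inj₂ (subst (HasEdge s (cL j)) e (path-edge j jN))

module BendsAtVertex (N : ℕ) (N≥2 : 2 ≤ N) (s : VSet (suc N)) (mt : MaxThrackle s) (pv : Pivot s) where
  open MaxThrackle mt
  open Pivot pv
  open Path N N≥2 s mt pv
  open Flips N N≥2 s mt pv
  open Bends N N≥2 s mt pv
  open ExceptionalShapes N N≥2 s mt pv

  EndpointOf : ℕ → ℕ → Set
  EndpointOf x r = x ≡ cL r ⊎ x ≡ cH r

  same-cL⇒up : ∀ k → cL (suc k) ≡ cL k → raisesLo k ≡ false
  same-cL⇒up k e with step-at k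
  ... | inj₁ (_ , a1 , _) = ⊥-elim (ℕₚ.1+n≢n (trans (sym a1) e))
  ... | inj₂ (r , _ , _) = r
  same-cH⇒raise : ∀ k → cH (suc k) ≡ cH k → raisesLo k ≡ true
  same-cH⇒raise k e with step-at k
  ... | inj₂ (_ , _ , b1) = ⊥-elim (ℕₚ.1+n≢n (trans (sym b1) e))
  ... | inj₁ (r , _ , _) = r

  cL-sandwich : ∀ {a b k} → a ≤ k → k ≤ b → cL a ≡ cL b → cL k ≡ cL a
  cL-sandwich ak kb e = ℕₚ.≤-antisym (ℕₚ.≤-trans (cL-mono kb) (ℕₚ.≤-reflexive (sym e))) (cL-mono ak)
  cH-sandwich : ∀ {a b k} → a ≤ k → k ≤ b → cH a ≡ cH b → cH k ≡ cH a
  cH-sandwich ak kb e = ℕₚ.≤-antisym (ℕₚ.≤-trans (cH-mono kb) (ℕₚ.≤-reflexive (sym e))) (cH-mono ak)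

  inner-bend⇒turn : ∀ q → Bend (suc q) → suc q < N → raisesLo q ≢ raisesLo (suc q)
  inner-bend⇒turn q (inj₁ (() , _)) lt
  inner-bend⇒turn q (inj₂ (inj₁ (e , _))) lt = ⊥-elim (ℕₚ.<-irrefl e lt)
  inner-bend⇒turn q (inj₂ (inj₂ (q' , refl , _ , ne))) lt = ne

  endpoint-below-p : ∀ {x r} → x < p → r ≤ N → EndpointOf x r → cL r ≡ x
  endpoint-below-p xp rN (inj₁ e) = sym e
  endpoint-below-p {x} {r} xp rN (inj₂ e) = ⊥-elim (ℕₚ.<⇒≱ xp (subst (p ≤_) (sym e) (path-p≤hi r rN)))
  endpoint-above-p : ∀ {x r} → p < x → r ≤ N → EndpointOf x r → cH r ≡ x
  endpoint-above-p px rN (inj₂ e) = sym e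
  endpoint-above-p {x} {r} px rN (inj₁ e) = ⊥-elim (ℕₚ.<⇒≱ px (subst (_≤ p) (sym e) (path-lo≤p r rN)))

  no-bends-at-p-hi : ∀ r → suc r ≤ N → Bend r → cH r ≡ p → cH (suc r) ≡ p → ⊥
  no-bends-at-p-hi zero _ (inj₁ (_ , b0)) h0 h1 = false≢true (trans (sym b0) (same-cH⇒raise 0 (trans h1 (sym h0))))
  no-bends-at-p-hi zero _ (inj₂ (inj₁ (e0 , _))) _ _ = N≢0 (sym e0)
  no-bends-at-p-hi zero _ (inj₂ (inj₂ (_ , () , _))) _ _
  no-bends-at-p-hi (suc q1) rN b h0 h1 = inner-bend⇒turn q1 b rN (trans (same-cH⇒raise q1 eA) (sym (same-cH⇒raise (suc q1) (trans h1 (sym h0)))))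
    where
    eA : cH (suc q1) ≡ cH q1
    eA = trans h0 (ℕₚ.≤-antisym (path-p≤hi q1 (ℕₚ.≤-trans (ℕₚ.n≤1+n q1) (ℕₚ.<⇒≤ rN))) (ℕₚ.≤-trans (cH-mono (ℕₚ.n≤1+n q1)) (ℕₚ.≤-reflexive h0)))

  no-bends-at-p-lo : ∀ r → r ≤ N → 1 ≤ r → Bend r → cL r ≡ p → cL (pred r) ≡ p → ⊥
  no-bends-at-p-lo (suc q3) rN _ b h0 h1 with same-cL⇒up q3 (trans h0 (sym h1)) | suc q3 ℕₚ.≟ N
  ... | u3 | yes eN = g b
    where
    g : Bend (suc q3) → ⊥
    g (inj₁ (() , _))
    g (inj₂ (inj₁ (_ , bN'))) = false≢true (trans (sym u3) (subst (λ k → raisesLo k ≡ true) (sym (cong pred eN)) bN'))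
    g (inj₂ (inj₂ (_ , refl , lt , _))) = ℕₚ.<-irrefl eN lt
  ... | u3 | no ne = inner-bend⇒turn q3 b lt (trans u3 (sym (same-cL⇒up (suc q3) e')))
    where
    lt : suc q3 < N
    lt = ℕₚ.≤∧≢⇒< rN ne
    e' : cL (suc (suc q3)) ≡ cL (suc q3)
    e' = trans (ℕₚ.≤-antisym (path-lo≤p (suc (suc q3)) lt) (ℕₚ.≤-trans (ℕₚ.≤-reflexive (sym h0)) (cL-mono (ℕₚ.n≤1+n (suc q3))))) (sym h0)

  ThreeBendsAt : ℕ → ℕ → ℕ → ℕ → Set
  ThreeBendsAt x r1 r2 r3 = r1 < r2 × r2 < r3 × r3 ≤ N × (Bend r1 × Bend r2 × Bend r3) × (EndpointOf x r1 × EndpointOf x r2 × EndpointOf x r3)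

  no-three-bends-below-p : ∀ {x r1 q r3} → x < p → ¬ ThreeBendsAt x r1 (suc q) r3
  no-three-bends-below-p {x} {r1} {q} {r3} xp (l12 , l23 , r3N , (_ , b2 , _) , (o1 , o2 , o3)) =
    inner-bend⇒turn q b2 sqN (trans (same-cL⇒up q e1) (sym (same-cL⇒up (suc q) e2)))
    where
    sqN : suc q < N
    sqN = ℕₚ.<-≤-trans l23 r3N
    r2N : suc q ≤ N
    r2N = ℕₚ.<⇒≤ sqN
    r1N : r1 ≤ N
    r1N = ℕₚ.≤-trans (ℕₚ.<⇒≤ l12) r2N
    e13 : cL r1 ≡ cL r3
    e13 = trans (endpoint-below-p xp r1N o1) (sym (endpoint-below-p xp r3N o3))
    e1 : cL (suc q) ≡ cL q
    e1 = trans (endpoint-below-p xp r2N o2) (trans (sym (endpoint-below-p xp r1N o1)) (sym (cL-sandwich (ℕₚ.≤-pred l12) (ℕₚ.≤-trans (ℕₚ.n≤1+n q) (ℕₚ.<⇒≤ l23)) e13)))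
    e2 : cL (suc (suc q)) ≡ cL (suc q)
    e2 = trans (cL-sandwich (ℕₚ.≤-trans (ℕₚ.<⇒≤ l12) (ℕₚ.n≤1+n _)) l23 e13) (trans (endpoint-below-p xp r1N o1) (sym (endpoint-below-p xp r2N o2)))

  no-three-bends-above-p : ∀ {x r1 q r3} → p < x → ¬ ThreeBendsAt x r1 (suc q) r3
  no-three-bends-above-p {x} {r1} {q} {r3} px (l12 , l23 , r3N , (_ , b2 , _) , (o1 , o2 , o3)) =
    inner-bend⇒turn q b2 sqN (trans (same-cH⇒raise q e1) (sym (same-cH⇒raise (suc q) e2)))
    where
    sqN : suc q < N
    sqN = ℕₚ.<-≤-trans l23 r3N
    r2N : suc q ≤ N
    r2N = ℕₚ.<⇒≤ sqN
    r1N : r1 ≤ N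
    r1N = ℕₚ.≤-trans (ℕₚ.<⇒≤ l12) r2N
    e13 : cH r1 ≡ cH r3
    e13 = trans (endpoint-above-p px r1N o1) (sym (endpoint-above-p px r3N o3))
    e1 : cH (suc q) ≡ cH q
    e1 = trans (endpoint-above-p px r2N o2) (trans (sym (endpoint-above-p px r1N o1)) (sym (cH-sandwich (ℕₚ.≤-pred l12) (ℕₚ.≤-trans (ℕₚ.n≤1+n q) (ℕₚ.<⇒≤ l23)) e13)))
    e2 : cH (suc (suc q)) ≡ cH (suc q)
    e2 = trans (cH-sandwich (ℕₚ.≤-trans (ℕₚ.<⇒≤ l12) (ℕₚ.n≤1+n _)) l23 e13) (trans (endpoint-above-p px r1N o1) (sym (endpoint-above-p px r2N o2)))

  no-three-bends-at-p : ∀ {r1 q r3} → ¬ ThreeBendsAt p r1 (suc q) r3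
  no-three-bends-at-p {r1} {q} {r3} (l12 , l23 , r3N , (b1 , _ , b3) , (_ , inj₂ e , _)) =
    no-bends-at-p-hi r1 (ℕₚ.≤-trans l12 r2N) b1 hr1 (trans (cH-sandwich (ℕₚ.n≤1+n r1) l12 (trans hr1 e)) hr1)
    where
    r2N : suc q ≤ N
    r2N = ℕₚ.<⇒≤ (ℕₚ.<-≤-trans l23 r3N)
    hr1 : cH r1 ≡ p
    hr1 = ℕₚ.≤-antisym (ℕₚ.≤-trans (cH-mono (ℕₚ.<⇒≤ l12)) (ℕₚ.≤-reflexive (sym e))) (path-p≤hi r1 (ℕₚ.≤-trans (ℕₚ.<⇒≤ l12) r2N))
  no-three-bends-at-p {r1} {q} {r3} (l12 , l23 , r3N , (b1 , _ , b3) , (_ , inj₁ e , _)) =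
    no-bends-at-p-lo r3 r3N (ℕₚ.≤-trans (s≤s z≤n) l23) b3 hr3 hp3
    where
    hr3 : cL r3 ≡ p
    hr3 = ℕₚ.≤-antisym (path-lo≤p r3 r3N) (ℕₚ.≤-trans (ℕₚ.≤-reflexive e) (cL-mono (ℕₚ.<⇒≤ l23)))
    hp3 : cL (pred r3) ≡ p
    hp3 = ℕₚ.≤-antisym (path-lo≤p (pred r3) (ℕₚ.≤-trans ℕₚ.pred[n]≤n r3N)) (ℕₚ.≤-trans (ℕₚ.≤-reflexive e) (cL-mono (ℕₚ.≤-pred (subst (suc (suc q) ≤_) (sym (ℕₚ.suc-pred r3 ⦃ ℕ.>-nonZero (ℕₚ.≤-trans (s≤s z≤n) l23) ⦄)) l23))))

  no-three-bends : ∀ {x r1 r2 r3} → r1 < r2 → r2 < r3 → r3 ≤ N → Bend r1 → Bend r2 → Bend r3 → EndpointOf x r1 → EndpointOf x r2 → EndpointOf x r3 → ⊥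
  no-three-bends {x} {r1} {suc q} l12 l23 r3N b1 b2 b3 o1 o2 o3 with ℕₚ.<-cmp x p
  ... | tri< xp _ _ = no-three-bends-below-p xp (l12 , l23 , r3N , (b1 , b2 , b3) , (o1 , o2 , o3))
  ... | tri> _ _ px = no-three-bends-above-p px (l12 , l23 , r3N , (b1 , b2 , b3) , (o1 , o2 , o3))
  ... | tri≈ _ refl _ = no-three-bends-at-p (l12 , l23 , r3N , (b1 , b2 , b3) , (o1 , o2 , o3))

  no-three-distinct-bends : ∀ {x r1 r2 r3} → r1 ≢ r2 → r1 ≢ r3 → r2 ≢ r3 → r1 ≤ N → r2 ≤ N → r3 ≤ N →
    Bend r1 → Bend r2 → Bend r3 → EndpointOf x r1 → EndpointOf x r2 → EndpointOf x r3 → ⊥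
  no-three-distinct-bends {x} {r1} {r2} {r3} n12 n13 n23 r1N r2N r3N b1 b2 b3 o1 o2 o3 with ℕₚ.<-cmp r1 r2 | ℕₚ.<-cmp r2 r3 | ℕₚ.<-cmp r1 r3
  ... | tri≈ _ e _ | _ | _ = n12 e
  ... | _ | tri≈ _ e _ | _ = n23 e
  ... | _ | _ | tri≈ _ e _ = n13 e
  ... | tri< a _ _ | tri< b _ _ | _ = no-three-bends a b r3N b1 b2 b3 o1 o2 o3
  ... | tri< a _ _ | tri> _ _ b | tri< c _ _ = no-three-bends c b r2N b1 b3 b2 o1 o3 o2
  ... | tri< a _ _ | tri> _ _ b | tri> _ _ c = no-three-bends c a r2N b3 b1 b2 o3 o1 o2
  ... | tri> _ _ a | tri< b _ _ | tri< c _ _ = no-three-bends a c r3N b2 b1 b3 o2 o1 o3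
  ... | tri> _ _ a | tri< b _ _ | tri> _ _ c = no-three-bends b c r1N b2 b3 b1 o2 o3 o1
  ... | tri> _ _ a | tri> _ _ b | _ = no-three-bends b a r1N b3 b2 b1 o3 o2 o1

-- The bends are the cycle edges

module CycleBends (N : ℕ) (N≥2 : 2 ≤ N) (Δ : VSet (suc N)) (ms : MaxSimplex Δ) (v0 : Fin (suc N)) (R : List (Fin (suc N))) (cyc : IsCycle Δ (v0 ∷ R)) where
  mt : MaxThrackle Δ
  mt = maxSimplex⇒maxThrackle Δ ms
  pv : Pivot Δ
  pv = PivotOf.pivot N N≥2 Δ mt
  open MaxThrackle mt
  open Pivot pv
  open Path N N≥2 Δ mt pv
  open Flips N N≥2 Δ mt pv
  open Neighbours N N≥2 Δ mt pv
  open Bends N N≥2 Δ mt pv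
  open ExceptionalShapes N N≥2 Δ mt pv
  open BendsAtVertex N N≥2 Δ mt pv

  V : Set
  V = Fin (suc N)
  C : List V
  C = v0 ∷ R
  closedC : List V
  closedC = v0 ∷ (R ++ v0 ∷ [])
  cycleEdges : List (V × V)
  cycleEdges = adjacentPairs closedC

  C-long : 2 ≤ length R
  C-long = ℕₚ.≤-pred (proj₁ cyc)
  C-unique : Unique C
  C-unique = proj₁ (proj₂ cyc)
  C-linked : Linked (Adj Δ) closedC
  C-linked = proj₂ (proj₂ cyc)

  adj⇒adjℕ : ∀ {u v : V} → Adj Δ u v → Adjℕ (toℕ u) (toℕ v)
  adj⇒adjℕ {u} {v} (inj₁ e) = inj₁ (hasEdge (trans (entryℕ-toℕ Δ u v) e))
  adj⇒adjℕ {u} {v} (inj₂ e) = inj₂ (hasEdge (trans (entryℕ-toℕ Δ v u) e))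

  adjℕ⇒adj : ∀ {u v : V} → Adjℕ (toℕ u) (toℕ v) → Adj Δ u v
  adjℕ⇒adj {u} {v} (inj₁ m) = inj₁ (trans (sym (entryℕ-toℕ Δ u v)) (entry≡true m))
  adjℕ⇒adj {u} {v} (inj₂ m) = inj₂ (trans (sym (entryℕ-toℕ Δ v u)) (entry≡true m))

  adjℕ⇒≢ : ∀ {a b} → Adjℕ a b → a ≢ b
  adjℕ⇒≢ (inj₁ m) e = ℕₚ.<-irrefl e (hasEdge-< Δ wf m)
  adjℕ⇒≢ (inj₂ m) e = ℕₚ.<-irrefl (sym e) (hasEdge-< Δ wf m)

  cycleEdge-adj : ∀ {u v} → (u , v) ∈ cycleEdges → Adj Δ u v
  cycleEdge-adj m = linked-adjacentPairs C-linked m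

  closedC⊆C : ∀ {x} → x ∈ closedC → x ∈ C
  closedC⊆C (here e) = here e
  closedC⊆C (there m) with ∈ₚ.∈-++⁻ R m
  ... | inj₁ m' = there m'
  ... | inj₂ (here e) = here e

  cycleEdge-ends : ∀ {u v} → (u , v) ∈ cycleEdges → u ∈ C × v ∈ C
  cycleEdge-ends m = let (a , b) = adjacentPairs-∈ {xs = closedC} m in closedC⊆C a , closedC⊆C b

  cycleEdges-distinct : AllPairs DistinctUnordered cycleEdges
  cycleEdges-distinct = closedWalk-pairs-distinct v0 R C-unique C-long

  cycle-succ : ∀ {x} → x ∈ C → ∃ λ y → (x , y) ∈ cycleEdges
  cycle-succ m = ∃-successor C v0 m

  cycle-pred : ∀ {x} → x ∈ C → ∃ λ y → (y , x) ∈ cycleEdges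
  cycle-pred {x} m = ∃-predecessor v0 (R ++ v0 ∷ []) (g m)
    where
    g : x ∈ C → x ∈ (R ++ v0 ∷ [])
    g (here e) = ∈ₚ.∈-++⁺ʳ R (here e)
    g (there m') = ∈ₚ.∈-++⁺ˡ m'

  succ≢pred : ∀ {x y w} → (x , y) ∈ cycleEdges → (w , x) ∈ cycleEdges → y ≢ w
  succ≢pred {x} {y} {w} m1 m2 refl with allPairs-∈ cycleEdges-distinct m1 m2
  ... | inj₁ e = adjℕ⇒≢ (adj⇒adjℕ (cycleEdge-adj m1)) (cong toℕ (cong proj₁ e))
  ... | inj₂ (inj₁ nu) = nu (inj₂ (refl , refl))
  ... | inj₂ (inj₂ nu) = nu (inj₂ (refl , refl))

  adjℕ-sym : ∀ {a b} → Adjℕ a b → Adjℕ b a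
  adjℕ-sym (inj₁ m) = inj₂ m
  adjℕ-sym (inj₂ m) = inj₁ m

  cycle-twoNeighbours : ∀ {x} → x ∈ C → TwoNeighbours (toℕ x)
  cycle-twoNeighbours m with cycle-succ m | cycle-pred m
  ... | (y , m1) | (w , m2) = toℕ y , toℕ w , (λ e → succ≢pred m1 m2 (toℕ-injective e)) , adj⇒adjℕ (cycleEdge-adj m1) , adjℕ-sym (adj⇒adjℕ (cycleEdge-adj m2))

  EdgeAt : V × V → ℕ → Set
  EdgeAt (u , v) r = (toℕ u ≡ cL r × toℕ v ≡ cH r) ⊎ (toℕ u ≡ cH r × toℕ v ≡ cL r)

  edge-rank : ∀ {u v} → Adj Δ u v → Σ ℕ λ r → r ≤ N × EdgeAt (u , v) r
  edge-rank a with adj⇒adjℕ a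
  ... | inj₁ m = let (r , rN , e1 , e2) = edge-on-path m in r , rN , inj₁ (e1 , e2)
  ... | inj₂ m = let (r , rN , e1 , e2) = edge-on-path m in r , rN , inj₂ (e2 , e1)

  edgeRank : V × V → ℕ
  edgeRank (u , v) = (toℕ u + toℕ v) ∸ p

  edgeRank-at : ∀ {e r} → EdgeAt e r → edgeRank e ≡ r
  edgeRank-at {u , v} {r} (inj₁ (e1 , e2)) = trans (cong (_∸ p) (trans (cong₂ _+_ e1 e2) (path-rank r))) (ℕₚ.m+n∸n≡m r p)
  edgeRank-at {u , v} {r} (inj₂ (e1 , e2)) = trans (cong (_∸ p) (trans (cong₂ _+_ e1 e2) (trans (ℕₚ.+-comm (cH r) (cL r)) (path-rank r)))) (ℕₚ.m+n∸n≡m r p)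

  cycleEdge-bend : ∀ {e} → e ∈ cycleEdges → Σ ℕ λ r → r ≤ N × EdgeAt e r × Bend r
  cycleEdge-bend {u , v} m = prAux (edge-rank (cycleEdge-adj m)) (cycle-twoNeighbours (proj₁ (cycleEdge-ends m))) (cycle-twoNeighbours (proj₂ (cycleEdge-ends m)))
    where
    prAux : Σ ℕ (λ r → r ≤ N × EdgeAt (u , v) r) → TwoNeighbours (toℕ u) → TwoNeighbours (toℕ v) → Σ ℕ λ r → r ≤ N × EdgeAt (u , v) r × Bend r
    prAux (r , rN , inj₁ (e1 , e2)) du dv = r , rN , inj₁ (e1 , e2) , twoNeighbours⇒bend r rN (subst TwoNeighbours e1 du) (subst TwoNeighbours e2 dv)
    prAux (r , rN , inj₂ (e1 , e2)) du dv = r , rN , inj₂ (e1 , e2) , twoNeighbours⇒bend r rN (subst TwoNeighbours e2 dv) (subst TwoNeighbours e1 du)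

  CycleEdgeAt : ℕ → Set
  CycleEdgeAt r = Σ (V × V) λ e → e ∈ cycleEdges × EdgeAt e r

  -- A vertex of C lies on the two bends of its own cycle edges and on no third bend
  -- (no-three-distinct-bends), so every bend sharing an endpoint with a cycle edge is a cycle edge.
  cycleEdge-at-vertex : ∀ x → x ∈ C → ∀ r' → r' ≤ N → Bend r' → EndpointOf (toℕ x) r' → CycleEdgeAt r'
  cycleEdge-at-vertex x x∈C r' r'N b' o' = at-neighbours (cycle-succ x∈C) (cycle-pred x∈C)
    where
    choose : ∀ {y1 y2} → (x , y1) ∈ cycleEdges → (y2 , x) ∈ cycleEdges → ∀ r1 r2 → r1 ≤ N → r2 ≤ N → EdgeAt (x , y1) r1 → EdgeAt (y2 , x) r2 → Bend r1 → Bend r2 →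
           Dec (r' ≡ r1) → Dec (r' ≡ r2) → CycleEdgeAt r'
    choose {y1} {y2} m1 m2 r1 r2 r1N r2N o1 o2 b1 b2 (yes refl) _ = (x , y1) , m1 , o1
    choose {y1} {y2} m1 m2 r1 r2 r1N r2N o1 o2 b1 b2 (no _) (yes refl) = (y2 , x) , m2 , o2
    choose {y1} {y2} m1 m2 r1 r2 r1N r2N o1 o2 b1 b2 (no n1) (no n2) =
      ⊥-elim (no-three-distinct-bends r1≢r2 (λ e → n1 (sym e)) (λ e → n2 (sym e)) r1N r2N r'N b1 b2 b' on1 on2 o')
      where
      on1 : EndpointOf (toℕ x) r1
      on1 = Sum.map proj₁ proj₁ o1
      on2 : EndpointOf (toℕ x) r2
      on2 = Sum.swap (Sum.map proj₂ proj₂ o2)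
      ne : y1 ≢ y2
      ne = succ≢pred m1 m2
      same-rank-impossible : EdgeAt (x , y1) r1 → EdgeAt (y2 , x) r1 → ⊥
      same-rank-impossible (inj₁ (a , _)) (inj₁ (_ , b)) = ℕₚ.<-irrefl (trans (sym a) b) (path-lo<hi r1 r1N)
      same-rank-impossible (inj₁ (_ , a)) (inj₂ (b , _)) = ne (toℕ-injective (trans a (sym b)))
      same-rank-impossible (inj₂ (_ , a)) (inj₁ (b , _)) = ne (toℕ-injective (trans a (sym b)))
      same-rank-impossible (inj₂ (a , _)) (inj₂ (_ , b)) = ℕₚ.<-irrefl (trans (sym b) a) (path-lo<hi r1 r1N)
      r1≢r2 : r1 ≢ r2
      r1≢r2 e = same-rank-impossible o1 (subst (EdgeAt (y2 , x)) (sym e) o2)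
    at-ranks : ∀ {y1 y2} → (x , y1) ∈ cycleEdges → (y2 , x) ∈ cycleEdges → Σ ℕ (λ r → r ≤ N × EdgeAt (x , y1) r × Bend r) → Σ ℕ (λ r → r ≤ N × EdgeAt (y2 , x) r × Bend r) → CycleEdgeAt r'
    at-ranks m1 m2 (r1 , r1N , o1 , b1) (r2 , r2N , o2 , b2) = choose m1 m2 r1 r2 r1N r2N o1 o2 b1 b2 (r' ℕₚ.≟ r1) (r' ℕₚ.≟ r2)
    at-neighbours : (∃ λ y → (x , y) ∈ cycleEdges) → (∃ λ y → (y , x) ∈ cycleEdges) → CycleEdgeAt r'
    at-neighbours (y1 , m1) (y2 , m2) = at-ranks m1 m2 (cycleEdge-bend m1) (cycleEdge-bend m2)

  cycleEdge-propagates : ∀ {r r'} → r ≤ N → r' ≤ N → Bend r' → CycleEdgeAt r → ShareEndpoint r r' → CycleEdgeAt r'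
  cycleEdge-propagates {r} {r'} rN r'N b' ((u , v) , m , oe) sh = via-endpoint (cycleEdge-ends m) oe sh
    where
    via-endpoint : u ∈ C × v ∈ C → EdgeAt (u , v) r → ShareEndpoint r r' → CycleEdgeAt r'
    via-endpoint (mu , mv) (inj₁ (e1 , _)) (inj₁ sh1) = cycleEdge-at-vertex u mu r' r'N b' (inj₁ (trans e1 sh1))
    via-endpoint (mu , mv) (inj₁ (_ , e2)) (inj₂ sh2) = cycleEdge-at-vertex v mv r' r'N b' (inj₂ (trans e2 sh2))
    via-endpoint (mu , mv) (inj₂ (_ , e2)) (inj₁ sh1) = cycleEdge-at-vertex v mv r' r'N b' (inj₁ (trans e2 sh1))
    via-endpoint (mu , mv) (inj₂ (e1 , _)) (inj₂ sh2) = cycleEdge-at-vertex u mu r' r'N b' (inj₂ (trans e1 sh2))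

  first-cycleEdge : Σ ℕ λ r → r ≤ N × Bend r × CycleEdgeAt r
  first-cycleEdge = at-successor (cycle-succ {v0} (here refl))
    where
    at-rank : ∀ {y} → (v0 , y) ∈ cycleEdges → Σ ℕ (λ r → r ≤ N × EdgeAt (v0 , y) r × Bend r) → Σ ℕ λ r → r ≤ N × Bend r × CycleEdgeAt r
    at-rank {y} m (r , rN , o , b) = r , rN , b , (v0 , y) , m , o
    at-successor : (∃ λ y → (v0 , y) ∈ cycleEdges) → Σ ℕ λ r → r ≤ N × Bend r × CycleEdgeAt r
    at-successor (y , m) = at-rank m (cycleEdge-bend m)

  bend⇒cycleEdge : ∀ r → r ≤ N → Bend r → CycleEdgeAt r
  bend⇒cycleEdge = BendInduction.all-bends CycleEdgeAt cycleEdge-propagates (proj₁ first-cycleEdge) (proj₁ (proj₂ first-cycleEdge)) (proj₁ (proj₂ (proj₂ first-cycleEdge))) (proj₂ (proj₂ (proj₂ first-cycleEdge)))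

  twoNeighbours⇒onCycle : ∀ (x : V) → TwoNeighbours (toℕ x) → x ∈ C
  twoNeighbours⇒onCycle x d = at-bend (twoNeighbours⇒bend-at (toℕ x) d)
    where
    endpoint-on-cycle : ∀ {u v r} → u ∈ C × v ∈ C → EndpointOf (toℕ x) r → EdgeAt (u , v) r → x ∈ C
    endpoint-on-cycle (mu , mv) (inj₁ a) (inj₁ (e1 , _)) = subst (_∈ C) (toℕ-injective (trans e1 (sym a))) mu
    endpoint-on-cycle (mu , mv) (inj₁ a) (inj₂ (_ , e2)) = subst (_∈ C) (toℕ-injective (trans e2 (sym a))) mv
    endpoint-on-cycle (mu , mv) (inj₂ a) (inj₁ (_ , e2)) = subst (_∈ C) (toℕ-injective (trans e2 (sym a))) mv
    endpoint-on-cycle (mu , mv) (inj₂ a) (inj₂ (e1 , _)) = subst (_∈ C) (toℕ-injective (trans e1 (sym a))) mu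
    via-cycleEdge : ∀ {r} → EndpointOf (toℕ x) r → CycleEdgeAt r → x ∈ C
    via-cycleEdge {r} on ((u , v) , m , oe) = endpoint-on-cycle {u} {v} {r} (cycleEdge-ends m) on oe
    at-bend : (Σ ℕ λ r → r ≤ N × Bend r × EndpointOf (toℕ x) r) → x ∈ C
    at-bend (r , rN , b , on) = via-cycleEdge {r} on (bend⇒cycleEdge r rN b)

  flipAlong : V × V → VSet (suc N)
  flipAlong e = flipAt (edgeRank e)
  flippableEdge? : ∀ e → Dec (Flippable (edgeRank e))
  flippableEdge? e = flippable? (edgeRank e)
  flippableEdges : List (V × V)
  flippableEdges = filter flippableEdge? cycleEdges
  neighbours : List (VSet (suc N))
  neighbours = map flipAlong flippableEdges

  edgeRank≤N : ∀ {e} → e ∈ cycleEdges → edgeRank e ≤ N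
  edgeRank≤N {e} m = at-rank (cycleEdge-bend m)
    where
    at-rank : Σ ℕ (λ r → r ≤ N × EdgeAt e r × Bend r) → edgeRank e ≤ N
    at-rank (r , rN , o , b) = subst (_≤ N) (sym (edgeRank-at {e} {r} o)) rN

  flipAlong-injective : ∀ {a b} → a ∈ cycleEdges → b ∈ cycleEdges → Flippable (edgeRank a) → Flippable (edgeRank b) → flipAlong a ≡ flipAlong b → SameUnordered a b
  flipAlong-injective {a1 , a2} {b1 , b2} ma mb fa fb eq = at-ranks (cycleEdge-bend ma) (cycleEdge-bend mb) (flip-injective (edgeRank≤N ma) fa fb eq)
    where
    same-rank⇒same : ∀ {r} → EdgeAt (a1 , a2) r → EdgeAt (b1 , b2) r → SameUnordered (a1 , a2) (b1 , b2)
    same-rank⇒same (inj₁ (x1 , x2)) (inj₁ (y1 , y2)) = inj₁ (toℕ-injective (trans x1 (sym y1)) , toℕ-injective (trans x2 (sym y2)))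
    same-rank⇒same (inj₁ (x1 , x2)) (inj₂ (y1 , y2)) = inj₂ (toℕ-injective (trans x1 (sym y2)) , toℕ-injective (trans x2 (sym y1)))
    same-rank⇒same (inj₂ (x1 , x2)) (inj₁ (y1 , y2)) = inj₂ (toℕ-injective (trans x1 (sym y2)) , toℕ-injective (trans x2 (sym y1)))
    same-rank⇒same (inj₂ (x1 , x2)) (inj₂ (y1 , y2)) = inj₁ (toℕ-injective (trans x1 (sym y1)) , toℕ-injective (trans x2 (sym y2)))
    at-ranks : Σ ℕ (λ r → r ≤ N × EdgeAt (a1 , a2) r × Bend r) → Σ ℕ (λ r → r ≤ N × EdgeAt (b1 , b2) r × Bend r) → edgeRank (a1 , a2) ≡ edgeRank (b1 , b2) → SameUnordered (a1 , a2) (b1 , b2)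
    at-ranks (ra , _ , oa , _) (rb , _ , ob , _) e = same-rank⇒same {ra} oa (subst (EdgeAt (b1 , b2)) (trans (sym (edgeRank-at {b1 , b2} {rb} ob)) (trans (sym e) (edgeRank-at {a1 , a2} {ra} oa))) ob)

  neighbours-unique : Unique neighbours
  neighbours-unique = map-unique flipAlong (allPairs-mono-∈ (AllPairsₚ.filter⁺ flippableEdge? cycleEdges-distinct) distinct⇒flips-differ)
    where
    distinct⇒flips-differ : ∀ {a b} → a ∈ flippableEdges → b ∈ flippableEdges → DistinctUnordered a b → flipAlong a ≢ flipAlong b
    distinct⇒flips-differ ma mb nu eq = let (ma' , fa) = ∈ₚ.∈-filter⁻ flippableEdge? {xs = cycleEdges} ma ; (mb' , fb) = ∈ₚ.∈-filter⁻ flippableEdge? {xs = cycleEdges} mb in nu (flipAlong-injective ma' mb' fa fb eq)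

  neighbours-complete : ∀ Δ' → MaxSimplex Δ' × ShareFacet Δ Δ' → Δ' ∈ neighbours
  neighbours-complete Δ' (ms' , sf) = at-flip (neighbour⇒flip Δ' ms' sf)
    where
    via-cycleEdge : ∀ {r} → Flippable r → Δ' ≡ flipAt r → CycleEdgeAt r → Δ' ∈ neighbours
    via-cycleEdge {r} fo eq (e , m , o) = subst (_∈ neighbours) (trans (cong flipAt (edgeRank-at {e} {r} o)) (sym eq))
      (∈ₚ.∈-map⁺ flipAlong (∈ₚ.∈-filter⁺ flippableEdge? m (subst Flippable (sym (edgeRank-at {e} {r} o)) fo)))
    at-flip : (Σ ℕ λ r → r ≤ N × Flippable r × Δ' ≡ flipAt r) → Δ' ∈ neighbours
    at-flip (r , rN , fo , eq) = via-cycleEdge fo eq (bend⇒cycleEdge r rN (flippable⇒bend r rN fo))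

  neighbours-sound : ∀ Δ' → Δ' ∈ neighbours → MaxSimplex Δ' × ShareFacet Δ Δ'
  neighbours-sound Δ' m = at-edge (∈ₚ.∈-map⁻ flipAlong m)
    where
    at-edge : (∃ λ e → e ∈ flippableEdges × Δ' ≡ flipAlong e) → MaxSimplex Δ' × ShareFacet Δ Δ'
    at-edge (e , mf , eq) = let (me , fo) = ∈ₚ.∈-filter⁻ flippableEdge? {xs = cycleEdges} mf in
      subst (λ z → MaxSimplex z × ShareFacet Δ z) (sym eq) (flip-maxSimplex (edgeRank e) (edgeRank≤N me) fo , flip-shareFacet (edgeRank e) (edgeRank≤N me) fo)

  degree-flippableEdges : HasDegree Δ (length flippableEdges)
  degree-flippableEdges = neighbours , neighbours-unique , (λ Δ' → mk⇔ (neighbours-complete Δ') (neighbours-sound Δ')) , Listₚ.length-map flipAlong flippableEdges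

  adjℕ-bounded : ∀ {a b} → Adjℕ a b → a < suc N × b < suc N
  adjℕ-bounded (inj₁ m) = hasEdge-bounded Δ m
  adjℕ-bounded (inj₂ m) = Product.swap (hasEdge-bounded Δ m)

  toℕ≡⇒≡fromℕ< : ∀ {t : V} {a} (an : a < suc N) → toℕ t ≡ a → t ≡ fromℕ< an
  toℕ≡⇒≡fromℕ< an e = toℕ-injective (trans e (sym (toℕ-fromℕ< an)))

  adjℕ⇒adj-fromℕ< : ∀ {a b} (an : a < suc N) (bn : b < suc N) → Adjℕ a b → Adj Δ (fromℕ< an) (fromℕ< bn)
  adjℕ⇒adj-fromℕ< an bn nb = adjℕ⇒adj (subst₂ Adjℕ (sym (toℕ-fromℕ< an)) (sym (toℕ-fromℕ< bn)) nb)

  OneOf3 : ℕ → ℕ → ℕ → ℕ → Set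
  OneOf3 x y z v = v ≡ x ⊎ v ≡ y ⊎ v ≡ z

  oneOf3-index : ∀ {x y z v} → OneOf3 x y z v → Fin 3
  oneOf3-index (inj₁ _) = Fin.zero
  oneOf3-index (inj₂ (inj₁ _)) = Fin.suc Fin.zero
  oneOf3-index (inj₂ (inj₂ _)) = Fin.suc (Fin.suc Fin.zero)

  oneOf3-index-injective : ∀ {x y z a b} (pa : OneOf3 x y z a) (pb : OneOf3 x y z b) → oneOf3-index pa ≡ oneOf3-index pb → a ≡ b
  oneOf3-index-injective (inj₁ e1) (inj₁ e2) _ = trans e1 (sym e2)
  oneOf3-index-injective (inj₂ (inj₁ e1)) (inj₂ (inj₁ e2)) _ = trans e1 (sym e2)
  oneOf3-index-injective (inj₂ (inj₂ e1)) (inj₂ (inj₂ e2)) _ = trans e1 (sym e2)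
  oneOf3-index-injective (inj₁ _) (inj₂ (inj₁ _)) ()
  oneOf3-index-injective (inj₁ _) (inj₂ (inj₂ _)) ()
  oneOf3-index-injective (inj₂ (inj₁ _)) (inj₁ _) ()
  oneOf3-index-injective (inj₂ (inj₁ _)) (inj₂ (inj₂ _)) ()
  oneOf3-index-injective (inj₂ (inj₂ _)) (inj₁ _) ()
  oneOf3-index-injective (inj₂ (inj₂ _)) (inj₂ (inj₁ _)) ()

  cycle-length-3 : ∀ {x y z} → (∀ {v} → v ∈ C → OneOf3 x y z (toℕ v)) → length C ≡ 3
  cycle-length-3 cl = ℕₚ.≤-antisym (unique-length≤ C C-unique (λ m → oneOf3-index (cl m)) (λ ma mb e → toℕ-injective (oneOf3-index-injective (cl ma) (cl mb) e))) (proj₁ cyc)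

  exceptional⇒triangle∧twoDegTwo : ∀ r → r ≤ N → ExceptionalShape r → length C ≡ 3 × TwoDegTwo Δ
  exceptional⇒triangle∧twoDegTwo r rN ed = cycle-length-3 classify , fx , fy , fxy , deg2x , deg2y
    where
    open ExceptionalShape ed
    nxy : Adjℕ x y
    nxy = inj₁ (subst₂ (HasEdge Δ) (sym ex) (sym ey) (path-edge r rN))
    xn : x < suc N
    xn = proj₁ (adjℕ-bounded nxy)
    yn : y < suc N
    yn = proj₂ (adjℕ-bounded nxy)
    zn : z < suc N
    zn = proj₂ (adjℕ-bounded nxz)
    fx fy fz : V
    fx = fromℕ< xn
    fy = fromℕ< yn
    fz = fromℕ< zn
    tx : toℕ fx ≡ x
    tx = toℕ-fromℕ< xn
    ty : toℕ fy ≡ y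
    ty = toℕ-fromℕ< yn
    tz : toℕ fz ≡ z
    tz = toℕ-fromℕ< zn
    fxy : fx ≢ fy
    fxy e = xy≢ (trans (sym tx) (trans (cong toℕ e) ty))
    deg2x : DegTwo Δ fx
    deg2x = fy , fz , (λ e → yz≢ (trans (sym ty) (trans (cong toℕ e) tz))) , adjℕ⇒adj-fromℕ< xn yn nxy , adjℕ⇒adj-fromℕ< xn zn nxz ,
      λ t a → Sum.map (toℕ≡⇒≡fromℕ< yn) (toℕ≡⇒≡fromℕ< zn) (nx (subst (λ w → Adjℕ w (toℕ t)) tx (adj⇒adjℕ a)))
    deg2y : DegTwo Δ fy
    deg2y = fx , fz , (λ e → xz≢ (trans (sym tx) (trans (cong toℕ e) tz))) , adjℕ⇒adj-fromℕ< yn xn (adjℕ-sym nxy) , adjℕ⇒adj-fromℕ< yn zn nyz ,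
      λ t a → Sum.map (toℕ≡⇒≡fromℕ< xn) (toℕ≡⇒≡fromℕ< zn) (ny (subst (λ w → Adjℕ w (toℕ t)) ty (adj⇒adjℕ a)))
    classify : ∀ {v} → v ∈ C → OneOf3 x y z (toℕ v)
    classify {v} m with toℕ v ℕₚ.≟ x | toℕ v ℕₚ.≟ y | toℕ v ℕₚ.≟ z
    ... | yes e | _ | _ = inj₁ e
    ... | no _ | yes e | _ = inj₂ (inj₁ e)
    ... | no _ | no _ | yes e = inj₂ (inj₂ e)
    ... | no n1 | no n2 | no n3 = ⊥-elim (leaf n1 n2 n3 (cycle-twoNeighbours m))

  degree-cycleLength : ¬ (length C ≡ 3 × TwoDegTwo Δ) → HasDegree Δ (length C)
  degree-cycleLength h = subst (HasDegree Δ) flippableEdges-length degree-flippableEdges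
    where
    flippable-or-exceptional : ∀ {e} r → r ≤ N → EdgeAt e r → Flippable r ⊎ Exceptional r → Flippable (edgeRank e)
    flippable-or-exceptional {e} r rN o (inj₁ fo) = subst Flippable (sym (edgeRank-at {e} {r} o)) fo
    flippable-or-exceptional {e} r rN o (inj₂ ex) = ⊥-elim (h (exceptional⇒triangle∧twoDegTwo r rN (exceptional-shape r ex)))
    at-bend : ∀ {e} → Σ ℕ (λ r → r ≤ N × EdgeAt e r × Bend r) → Flippable (edgeRank e)
    at-bend {e} (r , rN , o , b) = flippable-or-exceptional {e} r rN o (bend⇒flippable⊎exceptional r b)
    all-flippable : All (λ e → Flippable (edgeRank e)) cycleEdges
    all-flippable = All.tabulate (λ m → at-bend (cycleEdge-bend m))
    cycleEdges-length : length cycleEdges ≡ length C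
    cycleEdges-length = trans (adjacentPairs-length v0 (R ++ v0 ∷ [])) (trans (Listₚ.length-++ R) (ℕₚ.+-comm (length R) 1))
    flippableEdges-length : length flippableEdges ≡ length C
    flippableEdges-length = trans (cong length (Listₚ.filter-all flippableEdge? all-flippable)) cycleEdges-length

  AtMostTwoNeighbours : V → Set
  AtMostTwoNeighbours v = Σ ℕ λ p1 → Σ ℕ λ p2 → ∀ {u} → Adjℕ (toℕ v) u → u ≡ p1 ⊎ u ≡ p2

  two-of-two : ∀ {B : Set} {Q : B → Set} {u1 u2 a b : B} → (∀ {t} → Q t → t ≡ u1 ⊎ t ≡ u2) → Q a → Q b → a ≢ b → ∀ {t} → Q t → t ≡ a ⊎ t ≡ b
  two-of-two h qa qb ne qt with h qa | h qb | h qt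
  ... | inj₁ refl | inj₁ refl | _ = ⊥-elim (ne refl)
  ... | inj₂ refl | inj₂ refl | _ = ⊥-elim (ne refl)
  ... | inj₁ refl | inj₂ refl | inj₁ refl = inj₁ refl
  ... | inj₁ refl | inj₂ refl | inj₂ refl = inj₂ refl
  ... | inj₂ refl | inj₁ refl | inj₁ refl = inj₂ refl
  ... | inj₂ refl | inj₁ refl | inj₂ refl = inj₁ refl

  adjℕ-fin : ∀ {a b} → Adjℕ a b → Σ V λ t → toℕ t ≡ b
  adjℕ-fin nb = fromℕ< (proj₂ (adjℕ-bounded nb)) , toℕ-fromℕ< (proj₂ (adjℕ-bounded nb))

  degTwo⇒atMostTwo : ∀ {v} → DegTwo Δ v → AtMostTwoNeighbours v
  degTwo⇒atMostTwo {v} (u1 , u2 , _ , _ , _ , h) = toℕ u1 , toℕ u2 , g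
    where
    g : ∀ {u} → Adjℕ (toℕ v) u → u ≡ toℕ u1 ⊎ u ≡ toℕ u2
    g {u} nb with adjℕ-fin nb
    ... | t , et = Sum.map (λ e → trans (sym et) (cong toℕ e)) (λ e → trans (sym et) (cong toℕ e)) (h t (adjℕ⇒adj (subst (Adjℕ (toℕ v)) (sym et) nb)))

  exceptional-atMostTwo : ∀ {r a b} → ExceptionalShape r → EdgeAt (a , b) r → AtMostTwoNeighbours a × AtMostTwoNeighbours b
  exceptional-atMostTwo {r} {a} {b} ed (inj₁ (e1 , e2)) = (y , z , λ nb → nx (subst (λ w → Adjℕ w _) (trans e1 (sym ex)) nb)) , (x , z , λ nb → ny (subst (λ w → Adjℕ w _) (trans e2 (sym ey)) nb))
    where open ExceptionalShape ed
  exceptional-atMostTwo {r} {a} {b} ed (inj₂ (e1 , e2)) = (x , z , λ nb → ny (subst (λ w → Adjℕ w _) (trans e1 (sym ey)) nb)) , (y , z , λ nb → nx (subst (λ w → Adjℕ w _) (trans e2 (sym ex)) nb))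
    where open ExceptionalShape ed

  neighbours-on-cycle : ∀ {v} → v ∈ C → AtMostTwoNeighbours v → ∀ {t} → Adj Δ v t → t ∈ C
  neighbours-on-cycle {v} m (p1 , p2 , h) {t} a = between-succ-pred (cycle-succ m) (cycle-pred m)
    where
    between-succ-pred : (∃ λ y → (v , y) ∈ cycleEdges) → (∃ λ y → (y , v) ∈ cycleEdges) → t ∈ C
    between-succ-pred (y1 , m1) (y2 , m2) with two-of-two {Q = Adjℕ (toℕ v)} h (adj⇒adjℕ (cycleEdge-adj m1)) (adjℕ-sym (adj⇒adjℕ (cycleEdge-adj m2))) (λ e → succ≢pred m1 m2 (toℕ-injective e)) (adj⇒adjℕ a)
    ... | inj₁ e = subst (_∈ C) (sym (toℕ-injective e)) (proj₂ (cycleEdge-ends m1))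
    ... | inj₂ e = subst (_∈ C) (sym (toℕ-injective e)) (proj₁ (cycleEdge-ends m2))

  ∈C? : ∀ (t : V) → Dec (t ∈ C)
  ∈C? t = Data.List.Membership.DecPropositional._∈?_ Finₚ._≟_ t C

  all-on-cycle : (∀ {v} → v ∈ C → AtMostTwoNeighbours v) → ∀ t → t ∈ C
  all-on-cycle two t with ∈C? t
  ... | yes m = m
  ... | no nm = some-neighbour (every-vertex-adjacent (toℕ t) (ℕₚ.≤-pred (toℕ<n t)))
    where
    via-neighbour : ∀ {w} → Adjℕ (toℕ t) w → Σ V (λ fw → toℕ fw ≡ w) → t ∈ C
    via-neighbour {w} nb (fw , ew) with ∈C? fw
    ... | yes mw = neighbours-on-cycle mw (two mw) (adjℕ⇒adj (adjℕ-sym (subst (Adjℕ (toℕ t)) (sym ew) nb)))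
    ... | no nmw = ⊥-elim (Sum.[ (λ d → nm (twoNeighbours⇒onCycle t d)) , (λ d → nmw (twoNeighbours⇒onCycle fw (subst TwoNeighbours (sym ew) d))) ] (ed nb))
      where
      ed : Adjℕ (toℕ t) w → TwoNeighbours (toℕ t) ⊎ TwoNeighbours w
      ed (inj₁ m) = edge-twoNeighbours m
      ed (inj₂ m) = Sum.swap (edge-twoNeighbours m)
    some-neighbour : (Σ ℕ λ w → Adjℕ (toℕ t) w) → t ∈ C
    some-neighbour (w , nb) = via-neighbour nb (adjℕ-fin nb)

module TriangleCycle (N : ℕ) (N≥2 : 2 ≤ N) (Δ : VSet (suc N)) (ms : MaxSimplex Δ) (v0 v1 v2 : Fin (suc N)) (cyc : IsCycle Δ (v0 ∷ v1 ∷ v2 ∷ [])) where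
  open CycleBends N N≥2 Δ ms v0 (v1 ∷ v2 ∷ []) cyc
  open Path N N≥2 Δ mt pv
  open Flips N N≥2 Δ mt pv
  open Bends N N≥2 Δ mt pv
  open ExceptionalShapes N N≥2 Δ mt pv

  adj-sym : ∀ {u v} → Adj Δ u v → Adj Δ v u
  adj-sym (inj₁ e) = inj₂ e
  adj-sym (inj₂ e) = inj₁ e

  adjℕ-within : ∀ {v p q : V} → (∀ {t} → Adj Δ v t → t ≡ p ⊎ t ≡ q) → ∀ {u} → Adjℕ (toℕ v) u → u ≡ toℕ p ⊎ u ≡ toℕ q
  adjℕ-within {v} h {u} nb with adjℕ-fin nb
  ... | t , et = Sum.map (λ e → trans (sym et) (cong toℕ e)) (λ e → trans (sym et) (cong toℕ e)) (h (adjℕ⇒adj (subst (Adjℕ (toℕ v)) (sym et) nb)))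

  degTwo-neighbours : ∀ {v p q : V} → DegTwo Δ v → Adj Δ v p → Adj Δ v q → p ≢ q → ∀ {t} → Adj Δ v t → t ≡ p ⊎ t ≡ q
  degTwo-neighbours {v} (u1 , u2 , _ , _ , _ , h) ap aq ne = two-of-two {Q = Adj Δ v} (λ {t} a → h t a) ap aq ne

  -- With a, b of degree two on the triangle a b c, the bend ab is exceptional, while an
  -- exceptional bc or ca would give every triangle vertex degree two, i.e. G would be the triangle.
  module TwoDegTwoVertices (a b c : V) (mab : (a , b) ∈ cycleEdges) (mbc : (b , c) ∈ cycleEdges) (mca : (c , a) ∈ cycleEdges) (da : DegTwo Δ a) (db : DegTwo Δ b)
             (cover : ∀ {v} → v ∈ C → v ≡ a ⊎ v ≡ b ⊎ v ≡ c) (ntri : ¬ IsTriangle Δ C) where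
    aAB : Adj Δ a b
    aAB = cycleEdge-adj mab
    aBC : Adj Δ b c
    aBC = cycleEdge-adj mbc
    aCA : Adj Δ c a
    aCA = cycleEdge-adj mca
    neq : ∀ {u v} → Adj Δ u v → u ≢ v
    neq ad e = adjℕ⇒≢ (adj⇒adjℕ ad) (cong toℕ e)
    ha : ∀ {t} → Adj Δ a t → t ≡ b ⊎ t ≡ c
    ha = degTwo-neighbours da aAB (adj-sym aCA) (neq aBC)
    hb : ∀ {t} → Adj Δ b t → t ≡ a ⊎ t ≡ c
    hb = degTwo-neighbours db (adj-sym aAB) aBC (λ e → neq aCA (sym e))

    all-atMostTwo⇒⊥ : (AtMostTwoNeighbours a) → (AtMostTwoNeighbours b) → (AtMostTwoNeighbours c) → ⊥
    all-atMostTwo⇒⊥ ta tb tc = ntri (refl , all-on-cycle two)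
      where
      two : ∀ {v} → v ∈ C → AtMostTwoNeighbours v
      two m with cover m
      ... | inj₁ refl = ta
      ... | inj₂ (inj₁ refl) = tb
      ... | inj₂ (inj₂ refl) = tc

    ab-¬flippable-at : ∀ {r} → EdgeAt (a , b) r → Bend r → ¬ Flippable r
    ab-¬flippable-at {r} (inj₁ (e1 , e2)) bd = exceptional⇒¬flippable r (triangle-at-bend⇒exceptional r bd {toℕ c}
       ((λ nb → Sum.map₁ (λ e → trans e e2) (adjℕ-within ha (subst (λ w → Adjℕ w _) (sym e1) nb))) ,
        (λ nb → Sum.map₁ (λ e → trans e e1) (adjℕ-within hb (subst (λ w → Adjℕ w _) (sym e2) nb)))))
    ab-¬flippable-at {r} (inj₂ (e1 , e2)) bd = exceptional⇒¬flippable r (triangle-at-bend⇒exceptional r bd {toℕ c}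
       ((λ nb → Sum.map₁ (λ e → trans e e1) (adjℕ-within hb (subst (λ w → Adjℕ w _) (sym e2) nb))) ,
        (λ nb → Sum.map₁ (λ e → trans e e2) (adjℕ-within ha (subst (λ w → Adjℕ w _) (sym e1) nb)))))

    ab-¬flippable : ¬ Flippable (edgeRank (a , b))
    ab-¬flippable = at-bend (cycleEdge-bend mab)
      where
      at-bend : Σ ℕ (λ r → r ≤ N × EdgeAt (a , b) r × Bend r) → ¬ Flippable (edgeRank (a , b))
      at-bend (r , rN , o , bd) fo = ab-¬flippable-at o bd (subst Flippable (edgeRank-at {a , b} {r} o) fo)

    bc-flippable : Flippable (edgeRank (b , c))
    bc-flippable = at-bend (cycleEdge-bend mbc)
      where
      by-cases : ∀ r → r ≤ N → EdgeAt (b , c) r → Flippable r ⊎ Exceptional r → Flippable (edgeRank (b , c))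
      by-cases r rN o (inj₁ fo) = subst Flippable (sym (edgeRank-at {b , c} {r} o)) fo
      by-cases r rN o (inj₂ ex) = let (tb , tc) = exceptional-atMostTwo (exceptional-shape r ex) o in ⊥-elim (all-atMostTwo⇒⊥ (degTwo⇒atMostTwo da) tb tc)
      at-bend : Σ ℕ (λ r → r ≤ N × EdgeAt (b , c) r × Bend r) → Flippable (edgeRank (b , c))
      at-bend (r , rN , o , bd) = by-cases r rN o (bend⇒flippable⊎exceptional r bd)

    ca-flippable : Flippable (edgeRank (c , a))
    ca-flippable = at-bend (cycleEdge-bend mca)
      where
      by-cases : ∀ r → r ≤ N → EdgeAt (c , a) r → Flippable r ⊎ Exceptional r → Flippable (edgeRank (c , a))
      by-cases r rN o (inj₁ fo) = subst Flippable (sym (edgeRank-at {c , a} {r} o)) fo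
      by-cases r rN o (inj₂ ex) = let (tc , ta) = exceptional-atMostTwo (exceptional-shape r ex) o in ⊥-elim (all-atMostTwo⇒⊥ ta (degTwo⇒atMostTwo db) tc)
      at-bend : Σ ℕ (λ r → r ≤ N × EdgeAt (c , a) r × Bend r) → Flippable (edgeRank (c , a))
      at-bend (r , rN , o , bd) = by-cases r rN o (bend⇒flippable⊎exceptional r bd)

  v₀v₁∈ : (v0 , v1) ∈ cycleEdges
  v₀v₁∈ = here refl
  v₁v₂∈ : (v1 , v2) ∈ cycleEdges
  v₁v₂∈ = there (here refl)
  v₂v₀∈ : (v2 , v0) ∈ cycleEdges
  v₂v₀∈ = there (there (here refl))

  cover₀₁₂ : ∀ {v} → v ∈ C → v ≡ v0 ⊎ v ≡ v1 ⊎ v ≡ v2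
  cover₀₁₂ (here e) = inj₁ e
  cover₀₁₂ (there (here e)) = inj₂ (inj₁ e)
  cover₀₁₂ (there (there (here e))) = inj₂ (inj₂ e)
  cover₁₂₀ : ∀ {v} → v ∈ C → v ≡ v1 ⊎ v ≡ v2 ⊎ v ≡ v0
  cover₁₂₀ (here e) = inj₂ (inj₂ e)
  cover₁₂₀ (there (here e)) = inj₁ e
  cover₁₂₀ (there (there (here e))) = inj₂ (inj₁ e)
  cover₂₀₁ : ∀ {v} → v ∈ C → v ≡ v2 ⊎ v ≡ v0 ⊎ v ≡ v1
  cover₂₀₁ (here e) = inj₂ (inj₁ e)
  cover₂₀₁ (there (here e)) = inj₂ (inj₂ e)
  cover₂₀₁ (there (there (here e))) = inj₁ e

  flippable-length-01 : DegTwo Δ v0 → DegTwo Δ v1 → ¬ IsTriangle Δ C → length flippableEdges ≡ 2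
  flippable-length-01 d0 d1 nt = filter-length-3₁ flippableEdge? (v0 , v1) (v1 , v2) (v2 , v0) GG.ab-¬flippable GG.bc-flippable GG.ca-flippable
    where module GG = TwoDegTwoVertices v0 v1 v2 v₀v₁∈ v₁v₂∈ v₂v₀∈ d0 d1 cover₀₁₂ nt
  flippable-length-12 : DegTwo Δ v1 → DegTwo Δ v2 → ¬ IsTriangle Δ C → length flippableEdges ≡ 2
  flippable-length-12 d1 d2 nt = filter-length-3₂ flippableEdge? (v0 , v1) (v1 , v2) (v2 , v0) GG.ca-flippable GG.ab-¬flippable GG.bc-flippable
    where module GG = TwoDegTwoVertices v1 v2 v0 v₁v₂∈ v₂v₀∈ v₀v₁∈ d1 d2 cover₁₂₀ nt
  flippable-length-20 : DegTwo Δ v2 → DegTwo Δ v0 → ¬ IsTriangle Δ C → length flippableEdges ≡ 2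
  flippable-length-20 d2 d0 nt = filter-length-3₃ flippableEdge? (v0 , v1) (v1 , v2) (v2 , v0) GG.bc-flippable GG.ca-flippable GG.ab-¬flippable
    where module GG = TwoDegTwoVertices v2 v0 v1 v₂v₀∈ v₀v₁∈ v₁v₂∈ d2 d0 cover₂₀₁ nt

  degTwo⇒twoNeighbours : ∀ {v} → DegTwo Δ v → TwoNeighbours (toℕ v)
  degTwo⇒twoNeighbours (u1 , u2 , ne , a1 , a2 , _) = toℕ u1 , toℕ u2 , (λ e → ne (toℕ-injective e)) , adj⇒adjℕ a1 , adj⇒adjℕ a2

  flippableEdges-length-2 : ¬ IsTriangle Δ C → TwoDegTwo Δ → length flippableEdges ≡ 2
  flippableEdges-length-2 nt (fx , fy , fxy , dx , dy) = go (twoNeighbours⇒onCycle fx (degTwo⇒twoNeighbours dx)) (twoNeighbours⇒onCycle fy (degTwo⇒twoNeighbours dy))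
    where
    go : fx ∈ C → fy ∈ C → length flippableEdges ≡ 2
    go (here refl) (here refl) = ⊥-elim (fxy refl)
    go (there (here refl)) (there (here refl)) = ⊥-elim (fxy refl)
    go (there (there (here refl))) (there (there (here refl))) = ⊥-elim (fxy refl)
    go (here refl) (there (here refl)) = flippable-length-01 dx dy nt
    go (there (here refl)) (here refl) = flippable-length-01 dy dx nt
    go (there (here refl)) (there (there (here refl))) = flippable-length-12 dx dy nt
    go (there (there (here refl))) (there (here refl)) = flippable-length-12 dy dx nt
    go (there (there (here refl))) (here refl) = flippable-length-20 dx dy nt
    go (here refl) (there (there (here refl))) = flippable-length-20 dy dx nt

  degree-two : ¬ IsTriangle Δ C → TwoDegTwo Δ → HasDegree Δ 2
  degree-two nt td = subst (HasDegree Δ) (flippableEdges-length-2 nt td) degree-flippableEdges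

-- The case n = 3

covering-triangle⇒n≤3 : ∀ {n} (C : List (Fin n)) → length C ≡ 3 → (∀ v → v ∈ C) → n ≤ 3
covering-triangle⇒n≤3 {n} C len all with n ℕₚ.≤? 3
... | yes le = le
... | no nle with Finₚ.pigeonhole (subst (_< n) (sym len) (ℕₚ.≰⇒> nle)) (λ v → Any.index (all v))
...   | i , j , i<j , eq = ⊥-elim (ℕₚ.<-irrefl (cong toℕ (trans (Anyₚ.lookup-index (all i)) (trans (cong (List.lookup C) eq) (sym (Anyₚ.lookup-index (all j)))))) i<j)

edges-of-3 : ∀ {x y} → x < y → y < 3 → (x ≡ 0 × y ≡ 1) ⊎ (x ≡ 0 × y ≡ 2) ⊎ (x ≡ 1 × y ≡ 2)
edges-of-3 {zero} {suc zero} _ _ = inj₁ (refl , refl)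
edges-of-3 {zero} {suc (suc zero)} _ _ = inj₂ (inj₁ (refl , refl))
edges-of-3 {suc zero} {suc (suc zero)} _ _ = inj₂ (inj₂ (refl , refl))
edges-of-3 {_} {suc (suc (suc _))} _ (s≤s (s≤s (s≤s ())))
edges-of-3 {suc zero} {suc zero} (s≤s ()) _
edges-of-3 {suc (suc _)} {suc zero} (s≤s ()) _
edges-of-3 {suc (suc _)} {suc (suc zero)} (s≤s (s≤s ())) _
edges-of-3 {_} {zero} () _

cross-on-3 : ∀ {x y a b} → x < y → y < 3 → a < b → b < 3 → Cross x y a b
cross-on-3 xy y3 ab b3 with edges-of-3 xy y3 | edges-of-3 ab b3
... | inj₁ (refl , refl) | inj₁ (refl , refl) = Decidable.toWitness {a? = cross? 0 1 0 1} _
... | inj₁ (refl , refl) | inj₂ (inj₁ (refl , refl)) = Decidable.toWitness {a? = cross? 0 1 0 2} _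
... | inj₁ (refl , refl) | inj₂ (inj₂ (refl , refl)) = Decidable.toWitness {a? = cross? 0 1 1 2} _
... | inj₂ (inj₁ (refl , refl)) | inj₁ (refl , refl) = Decidable.toWitness {a? = cross? 0 2 0 1} _
... | inj₂ (inj₁ (refl , refl)) | inj₂ (inj₁ (refl , refl)) = Decidable.toWitness {a? = cross? 0 2 0 2} _
... | inj₂ (inj₁ (refl , refl)) | inj₂ (inj₂ (refl , refl)) = Decidable.toWitness {a? = cross? 0 2 1 2} _
... | inj₂ (inj₂ (refl , refl)) | inj₁ (refl , refl) = Decidable.toWitness {a? = cross? 1 2 0 1} _
... | inj₂ (inj₂ (refl , refl)) | inj₂ (inj₁ (refl , refl)) = Decidable.toWitness {a? = cross? 1 2 0 2} _
... | inj₂ (inj₂ (refl , refl)) | inj₂ (inj₂ (refl , refl)) = Decidable.toWitness {a? = cross? 1 2 1 2} _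

maxSimplex-on-3-full : ∀ (s : VSet 3) → MaxSimplex s → ∀ {a b} → a < b → b < 3 → HasEdge s a b
maxSimplex-on-3-full s ms ab b3 = MaxThrackle.maximal mt ab b3 (λ m → cross-on-3 ab b3 (hasEdge-< s (MaxThrackle.wf mt) m) (proj₂ (hasEdge-bounded s m)))
  where
  mt : MaxThrackle s
  mt = maxSimplex⇒maxThrackle s ms

triangle-case : ∀ n → 3 ≤ n → (Δ : VSet n) → MaxSimplex Δ → (C : List (Fin n)) → IsTriangle Δ C →
  (∀ I → Mem I Δ) × (∀ Δ' → MaxSimplex Δ' → Δ' ≡ Δ) × HasDegree Δ 0
triangle-case n h Δ ms C (len , all) with ℕₚ.≤-antisym (covering-triangle⇒n≤3 C len all) h
... | refl = full , unique , deg0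
  where
  full : ∀ I → Mem I Δ
  full I = HasEdge⇒Mem Δ I (maxSimplex-on-3-full Δ ms (lo<hi I) (toℕ<n (hi I)))
  unique : ∀ Δ' → MaxSimplex Δ' → Δ' ≡ Δ
  unique Δ' ms' = vset-ext-hasEdge (λ m → maxSimplex-on-3-full Δ ms (hasEdge-< Δ' (proj₁ (proj₁ ms')) m) (proj₂ (hasEdge-bounded Δ' m)))
                          (λ m → maxSimplex-on-3-full Δ' ms' (hasEdge-< Δ (proj₁ (proj₁ ms)) m) (proj₂ (hasEdge-bounded Δ m)))
  deg0 : HasDegree Δ 0
  deg0 = [] , [] , (λ Δ' → mk⇔ (λ p → ⊥-elim (proj₁ (proj₂ p) (sym (unique Δ' (proj₁ p))))) (λ ())) , refl

exceptional-case : ∀ (N : ℕ) (N≥2 : 2 ≤ N) (Δ : VSet (suc N)) (ms : MaxSimplex Δ) (v0 : Fin (suc N)) (R : List (Fin (suc N))) →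
  IsCycle Δ (v0 ∷ R) → ¬ IsTriangle Δ (v0 ∷ R) → length (v0 ∷ R) ≡ 3 → TwoDegTwo Δ → HasDegree Δ 2
exceptional-case N N≥2 Δ ms v0 (v1 ∷ v2 ∷ []) cyc nt _ td = TriangleCycle.degree-two N N≥2 Δ ms v0 v1 v2 cyc nt td
exceptional-case N N≥2 Δ ms v0 [] cyc nt () td
exceptional-case N N≥2 Δ ms v0 (v1 ∷ []) cyc nt () td
exceptional-case N N≥2 Δ ms v0 (v1 ∷ v2 ∷ v3 ∷ R) cyc nt () td

theorem5p6 : (n : ℕ) → 3 ≤ n → (Δ : VSet n) → MaxSimplex Δ →
    (C : List (Fin n)) → IsCycle Δ C →
    (IsTriangle Δ C →
    (∀ I → Mem I Δ) × (∀ Δ' → MaxSimplex Δ' → Δ' ≡ Δ) × HasDegree Δ 0)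
    × (¬ IsTriangle Δ C → length C ≡ 3 → TwoDegTwo Δ → HasDegree Δ 2)
    × (¬ IsTriangle Δ C → ¬ (length C ≡ 3 × TwoDegTwo Δ) → HasDegree Δ (length C))
theorem5p6 (suc (suc (suc k))) _ Δ ms [] (() , _)
theorem5p6 n@(suc (suc (suc k))) 3≤n@(s≤s (s≤s (s≤s _))) Δ ms C@(v₀ ∷ R) cyc =
    triangle-case n 3≤n Δ ms C
  , exceptional-case (suc (suc k)) (s≤s (s≤s z≤n)) Δ ms v₀ R cyc
  , λ _ → CycleBends.degree-cycleLength (suc (suc k)) (s≤s (s≤s z≤n)) Δ ms v₀ R cyc
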